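{- Let $W$ be a Coxeter group (with finite generating set $S$) which avoids all triangle groups in $\mathcal{T} = \{(2,b,c) : b,c \geq 3,\ b < \infty\}$. Then every $4$-palindromic element $w \in W$ is palindromic. Furthermore, if $W$ also avoids all triangle groups $(3,3,c)$ with $3 < c < \infty$, then every $2$-palindromic element $w \in W$ is palindromic.
   Context: $(W,S)$ is a Coxeter group with finite generating set $S$ and relations $(st)^{m_{st}} = e$, where $m_{st}\in\{1,2,3,\dots,\infty\}$, $m_{st}=1$ iff $s=t$ (no relation when $m_{st}=\infty$). $\ell$ is the length function and $\leq$ the Bruhat order. For $w \in W$, the Poincaré polynomial is $P_w(q)=\sum_{x\leq w} q^{\ell(x)} = \sum_i a_i q^i$, of degree $\ell(w)$. $w$ is palindromic if $a_i = a_{\ell(w)-i}$ for all $i$, and $k$-palindromic if $a_i = a_{\ell(w)-i}$ for all $0 \leq i < k$. A triangle group is denoted by a triple $(m_{rs}, m_{rt}, m_{st})$ for a generating set $\{r,s,t\}$. $W$ contains the triangle $(a,b,c)$ if there are distinct $r,s,t\in S$ with $(a,b,c) = (m_{rs},m_{rt},m_{st})$; otherwise $W$ avoids $(a,b,c)$. -}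

module Defs where

open import Data.Nat using (ℕ; zero; suc; _<_; _≤_; _∸_)
open import Data.Fin using (Fin)
open import Data.List using (List; []; _∷_; _++_; length; reverse)
open import Data.List.Relation.Unary.All using (All)
open import Data.List.Relation.Unary.Any using (Any)
open import Data.List.Relation.Unary.AllPairs using (AllPairs)
open import Data.Sum using (_⊎_)
open import Data.Maybe using (Maybe; just; nothing)
open import Data.Product using (Σ; ∃; _×_; _,_)
open import Relation.Binary.PropositionalEquality using (_≡_; _≢_)
open import Relation.Nullary using (¬_)

-- Coxeter matrix on the finite generating set S = Fin n.
-- m s t = just k  means m_{st} = k,  m s t = nothing  means m_{st} = ∞.
record CoxeterMatrix : Set where
  field
    rank : ℕ
    m    : Fin rank → Fin rank → Maybe ℕ
    m-diag : ∀ s → m s s ≡ just 1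
    m-sym  : ∀ s t → m s t ≡ m t s
    m-off  : ∀ s t → s ≢ t → ∀ k → m s t ≡ just k → 2 ≤ k

module Coxeter (M : CoxeterMatrix) where
  open CoxeterMatrix M

  S : Set
  S = Fin rank

  Word : Set
  Word = List S

  altPow : S → S → ℕ → Word
  altPow s t zero    = []
  altPow s t (suc k) = s ∷ t ∷ altPow s t k

  -- relators of the presentation: (st)^{m_st} for finite m_st (includes s s = e)
  data Relator : Word → Set where
    rel : ∀ s t k → m s t ≡ just k → Relator (altPow s t k)

  -- the congruence on words generated by the relators; W = Word / _≈_
  infix 4 _≈_
  data _≈_ : Word → Word → Set where
    ≈-refl  : ∀ {u} → u ≈ u
    ≈-sym   : ∀ {u v} → u ≈ v → v ≈ u
    ≈-trans : ∀ {u v w} → u ≈ v → v ≈ w → u ≈ w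
    ≈-rel   : ∀ u r v → Relator r → (u ++ r ++ v) ≈ (u ++ v)

  Reduced : Word → Set
  Reduced u = ∀ v → v ≈ u → length u ≤ length v

  Len : Word → ℕ → Set
  Len x k = Σ Word λ u → u ≈ x × Reduced u × length u ≡ k

  LenLt : Word → Word → Set
  LenLt x y = Σ ℕ λ i → Σ ℕ λ j → Len x i × Len y j × i < j

  -- reflections: conjugates u s u⁻¹ of simple generators
  reflWord : Word → S → Word
  reflWord u s = u ++ s ∷ reverse u

  BruhatStep : Word → Word → Set
  BruhatStep x y = Σ Word λ u → Σ S λ s → (y ≈ x ++ reflWord u s) × LenLt x y

  infix 4 _≤B_
  data _≤B_ : Word → Word → Set where
    ≤B-refl : ∀ {x y} → x ≈ y → x ≤B y
    ≤B-step : ∀ {x y z} → x ≤B y → BruhatStep y z → x ≤B z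

  Lower : Word → ℕ → Word → Set
  Lower w i x = x ≤B w × Len x i

  -- the ≈-invariant predicate P defines a set of group elements of cardinality c:
  -- a list of c pairwise distinct elements satisfying P and covering every element with P
  Count : (Word → Set) → ℕ → Set
  Count P c = Σ (List Word) λ L →
    length L ≡ c × All P L × AllPairs (λ a b → ¬ (a ≈ b)) L
    × (∀ x → P x → Any (λ y → x ≈ y) L)

  Coeff : Word → ℕ → ℕ → Set
  Coeff w i c = Count (Lower w i) c

  -- a_i = a_{ℓ(w)-i} for all 0 ≤ i < k (indices with i ≤ ℓ(w); for i > ℓ(w) both are 0)
  KPalindromic : ℕ → Word → Set
  KPalindromic k w = ∀ l → Len w l → ∀ i → i < k → i ≤ l →
    ∀ c → Coeff w i c → Coeff w (l ∸ i) c

  Palindromic : Word → Set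
  Palindromic w = ∀ l → Len w l → ∀ i → i ≤ l →
    ∀ c → Coeff w i c → Coeff w (l ∸ i) c

  Contains𝒯 : Set
  Contains𝒯 = Σ S λ r → Σ S λ s → Σ S λ t → r ≢ s × r ≢ t × s ≢ t ×
    m r s ≡ just 2 × (Σ ℕ λ b → m r t ≡ just b × 3 ≤ b) ×
    (m s t ≡ nothing ⊎ (Σ ℕ λ c → m s t ≡ just c × 3 ≤ c))

  Contains33c : Set
  Contains33c = Σ S λ r → Σ S λ s → Σ S λ t → r ≢ s × r ≢ t × s ≢ t ×
    m r s ≡ just 3 × m r t ≡ just 3 × (Σ ℕ λ c → m s t ≡ just c × 3 < c)

{-# OPTIONS --safe #-}

-- Let s be the letter whose last occurrence in a reduced word of w comes first, and write w = v u with
-- u in W_J and v minimal in v W_J, J = S ∖ {s}. Then u involves all of J, and w has at least as many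
-- coatoms as letters; equality passes to u and says that v is rigid: deleting a letter other than the
-- first from a reduced word of v makes v u non-reduced.
--
-- When W avoids 𝒯, two letters joined by a finite edge ≥ 3 fail to commute with the same letters. Hence
-- in a triangle of non-commuting letters no element has three descents, and rigid elements can be
-- listed: v is an alternating word, possibly followed by one or two pairs of letters of a triangle, or
-- a spiral in a triangle (3,3,3). In each case all letters of v other than s are left descents of u, so
-- the Poincaré polynomial of w is that of u times that of [e, v] ∩ W^J. These factors are palindromic,
-- except for one family in the triangles (3,3,c), 3 < c < ∞, whose coefficients 1, 1, 2, 2, … at the
-- bottom face 1, 1, 2, 3, … at the top; such a factor destroys 4-palindromicity.
--
-- The exchange condition comes from the parity of inversions; that s t has order exactly m s t is seen
-- in a permutation representation on a tree; together they solve the word problem.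
module Submission where

open import Defs
open import Data.Bool using (Bool; true; false; not; _xor_; if_then_else_)
open import Data.Bool.Properties using (not-involutive)
open import Data.Empty using (⊥; ⊥-elim)
open import Data.Fin using (toℕ)
open import Data.Fin.Properties using (_≟_; any?; toℕ-injective)
open import Data.List using (List; []; _∷_; _++_; length; reverse; map; applyUpTo; filter; deduplicate; cartesianProductWith; _∷ʳ_; initLast; _∷ʳ′_)
open import Data.List.Properties using (++-assoc; ++-identityʳ; length-++; unfold-reverse; reverse-++; reverse-involutive; length-reverse; map-++; map-applyUpTo; applyUpTo-∷ʳ; length-map; filter-accept; filter-reject; map-∘; map-id)
open import Data.List.Membership.Propositional using (_∈_; find; lose)
open import Data.List.Membership.Propositional.Properties using (∈-++⁺ˡ; ∈-++⁺ʳ; ∈-map⁺; ∈-filter⁺; ∈-filter⁻; ∈-applyUpTo⁺; ∈-cartesianProductWith⁺; ∈-cartesianProductWith⁻; ∈-deduplicate⁺; ∈-deduplicate⁻)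
open import Data.List.Relation.Unary.All as All using (All; []; _∷_)
import Data.List.Relation.Unary.All.Properties as Allₚ
open import Data.List.Relation.Unary.Any as Any using (Any; here; there)
import Data.List.Relation.Unary.Any.Properties as Anyₚ
open import Data.List.Relation.Unary.AllPairs as AllPairs using (AllPairs; []; _∷_)
import Data.List.Relation.Unary.AllPairs.Properties as AllPairsₚ
open import Data.List.Relation.Unary.Unique.DecPropositional.Properties using (deduplicate-!)
open import Data.List.Relation.Binary.Pointwise as PW using (Pointwise; []; _∷_)
open import Data.List.Relation.Binary.Sublist.Propositional as Sub using (_⊆_; []; _∷_; ⊆-refl; ⊆-trans; minimum)
open import Data.List.Relation.Binary.Permutation.Propositional as Perm using (_↭_; ↭-refl; ↭-trans; ↭-reflexive; prep)
import Data.List.Relation.Binary.Permutation.Propositional.Properties as Permₚ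
import Data.List.Relation.Binary.Sublist.Propositional.Properties as Subₚ
open import Data.Maybe using (Maybe; just; nothing)
open import Data.Maybe.Properties as Maybeₚ using (just-injective)
import Data.Nat
open import Data.Nat using (ℕ; zero; suc; _+_; _*_; _∸_; _≤_; _<_; _≤?_; _<?_; z≤n; s≤s; s≤s⁻¹)
open import Data.Nat.Properties using (≤-refl; ≤-trans; ≤-reflexive; ≤-antisym; <-irrefl; <-trans; <-≤-trans; ≤-<-trans; n≤1+n; m≤n⇒m≤1+n; <⇒≤; ≮⇒≥; ≰⇒>; ≤∧≢⇒<; +-suc; +-comm; +-assoc; +-identityʳ; +-cancelˡ-≡; +-cancelʳ-≤; +-monoʳ-≤; +-monoʳ-<; +-mono-<-≤; +-mono-≤-<; *-comm; *-distribʳ-+; *-monoʳ-<; *-monoʳ-≤; *-monoˡ-≤; *-mono-≤; m∸[m∸n]≡n; +-cancelˡ-<; +-mono-≤; m≤m+n; m≤n+m; suc-injective; 1+n≢n; 0≢1+n; 1+n≰n; m+n∸m≡n; m∸n+n≡m; m+[n∸m]≡n; m∸n≤m)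
open import Data.Nat.Tactic.RingSolver using (solve-∀)
open import Data.Product using (Σ; _×_; _,_; proj₁; proj₂)
import Data.Sum as Sum
open import Data.Sum using (_⊎_; inj₁; inj₂; [_,_]′)
open import Function using (_∘_; id; case_of_)
open import Relation.Binary.PropositionalEquality using (_≡_; _≢_; refl; sym; trans; cong; cong₂; subst; subst₂; module ≡-Reasoning)
open import Relation.Binary.Bundles using (Setoid)
import Relation.Binary.Reasoning.Setoid as SetoidReasoning
open import Relation.Nullary using (¬_; Dec; yes; no)
open import Relation.Nullary.Decidable using (map′; ¬?; _×-dec_; decidable-stable)

-- The definitions give only a presentation: neither that the orders `m s t` are attained nor that
-- equality in W is decidable may be assumed, while `Coeff` asks for explicit lists of elements. So
-- exchange is first proved up to double negation, and decidability is then won by induction on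
-- length. The reflection representation, with its real numbers cos(π/m), is replaced by words in a
-- tree: a vertex from which two letters descend lies inside a path of at least three vertices, so
-- these letters must not commute, and avoiding `𝒯` guarantees this. 2-palindromicity enters through
-- a₁, which counts letters, and the coefficient next to the top, which counts coatoms. Each factor
-- v adds one letter and has one coatom to pay for it; any further coatom is excluded, hence
-- rigidity. The classification ends because of `third-ascent`: in a triangle every further turn of
-- v forces another edge to be 3, so only (3,3,3) has arbitrarily long spirals. The exceptional
-- factors deviate first at index 3 and always in the same direction, so their defects cannot cancel
-- in a product.

module Words (M : CoxeterMatrix) where
  open CoxeterMatrix M
  open Coxeter M

  -- Cancellation in the group of words

  ≈-setoid : Setoid _ _
  ≈-setoid = record
    { Carrier = Word ; _≈_ = _≈_
    ; isEquivalence = record { refl = ≈-refl ; sym = ≈-sym ; trans = ≈-trans } }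

  module ≈R = SetoidReasoning ≈-setoid

  All-reverse : ∀ {P : S → Set} {u} → All P u → All P (reverse u)
  All-reverse [] = []
  All-reverse {P} {x ∷ u} (p ∷ ps) =
    subst (All P) (sym (unfold-reverse x u)) (Allₚ.++⁺ (All-reverse ps) (p ∷ []))

  ≡⇒≈ : ∀ {u v : Word} → u ≡ v → u ≈ v
  ≡⇒≈ refl = ≈-refl

  ++-congˡ : ∀ w {u v} → u ≈ v → w ++ u ≈ w ++ v
  ++-congˡ w ≈-refl = ≈-refl
  ++-congˡ w (≈-sym p) = ≈-sym (++-congˡ w p)
  ++-congˡ w (≈-trans p q) = ≈-trans (++-congˡ w p) (++-congˡ w q)
  ++-congˡ w (≈-rel u r v R) =
    subst₂ _≈_ (++-assoc w u (r ++ v)) (++-assoc w u v) (≈-rel (w ++ u) r v R)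

  ++-congʳ : ∀ w {u v} → u ≈ v → u ++ w ≈ v ++ w
  ++-congʳ w ≈-refl = ≈-refl
  ++-congʳ w (≈-sym p) = ≈-sym (++-congʳ w p)
  ++-congʳ w (≈-trans p q) = ≈-trans (++-congʳ w p) (++-congʳ w q)
  ++-congʳ w (≈-rel u r v R) = subst₂ _≈_
    (sym (trans (++-assoc u (r ++ v) w) (cong (u ++_) (++-assoc r v w))))
    (sym (++-assoc u v w)) (≈-rel u r (v ++ w) R)

  ∷-cong : ∀ s {u v} → u ≈ v → s ∷ u ≈ s ∷ v
  ∷-cong s = ++-congˡ (s ∷ [])

  ss≈ : ∀ s u → s ∷ s ∷ u ≈ u
  ss≈ s u = ≈-rel [] (s ∷ s ∷ []) u (rel s s 1 (m-diag s))

  ∷-cancel : ∀ s {u v} → s ∷ u ≈ s ∷ v → u ≈ v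
  ∷-cancel s {u} {v} p =
    ≈-trans (≈-sym (ss≈ s u)) (≈-trans (∷-cong s p) (ss≈ s v))

  ∷-swap : ∀ s {u v} → s ∷ u ≈ v → u ≈ s ∷ v
  ∷-swap s {u} p = ≈-trans (≈-sym (ss≈ s u)) (∷-cong s p)

  rev-cancel : ∀ u v → reverse u ++ u ++ v ≈ v
  rev-cancel [] v = ≈-refl
  rev-cancel (x ∷ u) v = begin
    reverse (x ∷ u) ++ x ∷ u ++ v        ≡⟨ cong (_++ x ∷ u ++ v) (unfold-reverse x u) ⟩
    (reverse u ++ x ∷ []) ++ x ∷ u ++ v  ≡⟨ ++-assoc (reverse u) (x ∷ []) _ ⟩
    reverse u ++ x ∷ x ∷ u ++ v          ≈⟨ ++-congˡ (reverse u) (ss≈ x (u ++ v)) ⟩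
    reverse u ++ u ++ v                  ≈⟨ rev-cancel u v ⟩
    v ∎
    where open ≈R

  cancel-rev : ∀ u v → u ++ reverse u ++ v ≈ v
  cancel-rev u v = subst (λ z → z ++ reverse u ++ v ≈ v) (reverse-involutive u)
    (rev-cancel (reverse u) v)

  ++-cancelˡ : ∀ w {u v} → w ++ u ≈ w ++ v → u ≈ v
  ++-cancelˡ w {u} {v} p = ≈-trans (≈-sym (rev-cancel w u))
    (≈-trans (++-congˡ (reverse w) p) (rev-cancel w v))

  ++-cancelʳ : ∀ w {u v} → u ++ w ≈ v ++ w → u ≈ v
  ++-cancelʳ w {u} {v} p = ≈-trans (≈-sym (lem u))
    (≈-trans (++-congʳ (reverse w) p) (lem v))
    where
      lem : ∀ x → (x ++ w) ++ reverse w ≈ x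
      lem x = begin
        (x ++ w) ++ reverse w        ≡⟨ ++-assoc x w _ ⟩
        x ++ w ++ reverse w          ≡⟨ cong (λ z → x ++ w ++ z) (sym (++-identityʳ (reverse w))) ⟩
        x ++ w ++ reverse w ++ []    ≈⟨ ++-congˡ x (cancel-rev w []) ⟩
        x ++ []                      ≡⟨ ++-identityʳ x ⟩
        x ∎
        where open ≈R

  reverse-cong : ∀ {u v} → u ≈ v → reverse u ≈ reverse v
  reverse-cong {u} {v} p = ++-cancelʳ v (begin
    reverse u ++ v        ≈⟨ ++-congˡ (reverse u) (≈-sym p) ⟩
    reverse u ++ u        ≡⟨ cong (reverse u ++_) (sym (++-identityʳ u)) ⟩
    reverse u ++ u ++ []  ≈⟨ rev-cancel u [] ⟩
    []                    ≈⟨ ≈-sym (rev-cancel v []) ⟩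
    reverse v ++ v ++ []  ≡⟨ cong (reverse v ++_) (++-identityʳ v) ⟩
    reverse v ++ v ∎)
    where open ≈R

  -- Alternating words and braid relations

  alt : ℕ → S → S → Word
  alt zero s t = []
  alt (suc n) s t = s ∷ alt n t s

  altPow≡alt : ∀ s t k → altPow s t k ≡ alt (k + k) s t
  altPow≡alt s t zero = refl
  altPow≡alt s t (suc k) = trans (cong (λ z → s ∷ t ∷ z) (altPow≡alt s t k))
    (cong (λ n → s ∷ alt n t s) (sym (+-suc k k)))

  length-alt : ∀ n s t → length (alt n s t) ≡ n
  length-alt zero s t = refl
  length-alt (suc n) s t = cong suc (length-alt n t s)

  alt-even-++ : ∀ s t j n → alt (j + j + n) s t ≡ alt (j + j) s t ++ alt n s t
  alt-even-++ s t zero n = refl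
  alt-even-++ s t (suc j) n rewrite +-suc j j = cong (λ z → s ∷ t ∷ z) (alt-even-++ s t j n)

  alt-rev : ∀ k s t → alt k s t ++ reverse (alt k t s) ≡ alt (k + k) s t
  alt-rev zero s t = refl
  alt-rev (suc k) s t = cong (s ∷_) (begin
    alt k t s ++ reverse (t ∷ alt k s t)          ≡⟨ cong (alt k t s ++_) (unfold-reverse t (alt k s t)) ⟩
    alt k t s ++ reverse (alt k s t) ++ t ∷ []    ≡⟨ sym (++-assoc (alt k t s) _ _) ⟩
    (alt k t s ++ reverse (alt k s t)) ++ t ∷ []  ≡⟨ cong (_++ t ∷ []) (alt-rev k t s) ⟩
    alt (k + k) t s ++ t ∷ []                     ≡⟨ sym (alt-even-++ t s k 1) ⟩
    alt (k + k + 1) t s                           ≡⟨ cong (λ n → alt n t s) (trans (+-assoc k k 1) (cong (k +_) (+-comm k 1))) ⟩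
    alt (k + suc k) t s ∎)
    where open ≡-Reasoning

  alt≈[]⇒braid : ∀ s t k → alt (k + k) s t ≈ [] → alt k s t ≈ alt k t s
  alt≈[]⇒braid s t k p = ++-cancelʳ (reverse (alt k t s)) (begin
    alt k s t ++ reverse (alt k t s)        ≡⟨ alt-rev k s t ⟩
    alt (k + k) s t                         ≈⟨ p ⟩
    []                                      ≈⟨ cancel-rev (alt k t s) [] ⟨
    alt k t s ++ reverse (alt k t s) ++ []  ≡⟨ cong (alt k t s ++_) (++-identityʳ _) ⟩
    alt k t s ++ reverse (alt k t s) ∎)
    where open ≈R

  relator≈[] : ∀ s t k → m s t ≡ just k → alt (k + k) s t ≈ []
  relator≈[] s t k e = subst (_≈ []) (trans (++-identityʳ _) (altPow≡alt s t k))
    (≈-rel [] (altPow s t k) [] (rel s t k e))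

  alt-braid : ∀ s t k → m s t ≡ just k → alt k s t ≈ alt k t s
  alt-braid s t k e = alt≈[]⇒braid s t k (relator≈[] s t k e)

  -- Inversion lists and their parities

  conj : S → Word → Word
  conj s t = s ∷ t ++ s ∷ []

  conj-cong : ∀ s {t t'} → t ≈ t' → conj s t ≈ conj s t'
  conj-cong s p = ∷-cong s (++-congʳ (s ∷ []) p)

  conj-conj : ∀ s t → conj s (conj s t) ≈ t
  conj-conj s t = ≈-trans (ss≈ s _) (≈-trans (≡⇒≈ (++-assoc t _ _))
    (≈-trans (++-congˡ t (ss≈ s [])) (≡⇒≈ (++-identityʳ t))))

  conj-swap : ∀ s {t t'} → conj s t ≈ t' → t ≈ conj s t'
  conj-swap s {t} p = ≈-trans (≈-sym (conj-conj s t)) (conj-cong s p)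

  -- The palindromes `s₁ … sᵢ … s₁`, one for each letter: multiplying the word on the left by the
  -- i-th of them deletes its i-th letter, see `invs⇒Del`.
  invs : Word → List Word
  invs [] = []
  invs (s ∷ u) = (s ∷ []) ∷ map (conj s) (invs u)

  -- Par t L b: the number of entries of L equal to t in W is odd iff b. It is a relation, not
  -- a function, because equality in W is not yet known to be decidable.
  data Par (t : Word) : List Word → Bool → Set where
    none : Par t [] false
    hit  : ∀ {x L b} → x ≈ t → Par t L b → Par t (x ∷ L) (not b)
    miss : ∀ {x L b} → ¬ (x ≈ t) → Par t L b → Par t (x ∷ L) b

  ¬¬-Dec : ∀ {A : Set} → ¬ ¬ Dec A
  ¬¬-Dec k = k (no (λ a → k (yes a)))

  Par-exists : ∀ t L → ¬ ¬ (Σ Bool (Par t L))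
  Par-exists t [] k = k (false , none)
  Par-exists t (x ∷ L) k = Par-exists t L λ (b , p) → ¬¬-Dec λ
    { (yes e) → k (not b , hit e p) ; (no e) → k (b , miss e p) }

  Par-unique : ∀ {t t' L L' b b'} → t ≈ t' → Pointwise _≈_ L L' → Par t L b → Par t' L' b' → b ≡ b'
  Par-unique e [] none none = refl
  Par-unique e (q ∷ qs) (hit _ p) (hit _ p') = cong not (Par-unique e qs p p')
  Par-unique e (q ∷ qs) (hit h p) (miss h' p') = ⊥-elim (h' (≈-trans (≈-sym q) (≈-trans h e)))
  Par-unique e (q ∷ qs) (miss h p) (hit h' p') = ⊥-elim (h (≈-trans q (≈-trans h' (≈-sym e))))
  Par-unique e (q ∷ qs) (miss _ p) (miss _ p') = Par-unique e qs p p'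

  Par-++⁻ : ∀ {t} L {L' b} → Par t (L ++ L') b → Σ Bool λ c → Σ Bool λ c' →
            Par t L c × Par t L' c' × b ≡ c xor c'
  Par-++⁻ [] p = _ , _ , none , p , refl
  Par-++⁻ (x ∷ L) (hit h p) with Par-++⁻ L p
  ... | true , c' , q , q' , refl = _ , _ , hit h q , q' , not-involutive c'
  ... | false , c' , q , q' , refl = _ , _ , hit h q , q' , refl
  Par-++⁻ (x ∷ L) (miss h p) with Par-++⁻ L p
  ... | c , c' , q , q' , e = _ , _ , miss h q , q' , e

  Par-map⁻ : ∀ {t} s L {b} → Par t (map (conj s) L) b → Par (conj s t) L b
  Par-map⁻ s [] none = none
  Par-map⁻ s (x ∷ L) (hit h p) = hit (conj-swap s h) (Par-map⁻ s L p)
  Par-map⁻ s (x ∷ L) (miss h p) = miss (λ e → h (≈-sym (conj-swap s (≈-sym e)))) (Par-map⁻ s L p)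

  conj-alt : ∀ i s t → conj s (alt (suc (i + i)) t s) ≡ alt (suc (suc i + suc i)) s t
  conj-alt i s t rewrite +-suc i i = cong (λ z → s ∷ t ∷ z)
    (trans (sym (alt-even-++ s t i 1)) (cong (λ n → alt n s t) (+-comm (i + i) 1)))
  applyUpTo-cong : ∀ {A : Set} {f g : ℕ → A} → (∀ i → f i ≡ g i) → ∀ n → applyUpTo f n ≡ applyUpTo g n
  applyUpTo-cong h zero = refl
  applyUpTo-cong h (suc n) = cong₂ _∷_ (h 0) (applyUpTo-cong (h ∘ suc) n)
  invs-alt : ∀ n s t → invs (alt n s t) ≡ applyUpTo (λ i → alt (suc (i + i)) s t) n
  invs-alt zero s t = refl
  invs-alt (suc n) s t = cong ((s ∷ []) ∷_) (trans (cong (map (conj s)) (invs-alt n t s))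
    (trans (map-applyUpTo _ (conj s) n) (applyUpTo-cong (λ i → conj-alt i s t) n)))
  upTo-++ : ∀ a b (f : ℕ → Word) → applyUpTo f (a + b) ≡ applyUpTo f a ++ applyUpTo (f ∘ (a +_)) b
  upTo-++ zero b f = refl
  upTo-++ (suc a) b f = cong (f 0 ∷_) (upTo-++ a b (f ∘ suc))

  -- The inversions of `(st)^k` are the alternating words of lengths 1, 3, 5, ...; the i-th and the
  -- (k+i)-th differ by the relator, so all values come in pairs.
  invs-even : ∀ s t k → m s t ≡ just k → ∀ {r b} → Par r (invs (altPow s t k)) b → b ≡ false
  invs-even s t k e {r} {b} p
    rewrite altPow≡alt s t k | invs-alt (k + k) s t | upTo-++ k k (λ i → alt (suc (i + i)) s t)
    with Par-++⁻ (applyUpTo (λ i → alt (suc (i + i)) s t) k) p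
  ... | c , c' , q , q' , refl = trans (cong (_xor c') (Par-unique ≈-refl (shift k (λ i → i) ) q q')) (xor-same c')
    where
      xor-same : ∀ c → c xor c ≡ false
      xor-same true = refl
      xor-same false = refl
      shift₁ : ∀ i → alt (suc (i + i)) s t ≈ alt (suc ((k + i) + (k + i))) s t
      shift₁ i = ≈-sym (≈-trans (≡⇒≈ (trans (cong (λ n → alt n s t) (arith k i)) (alt-even-++ s t k (suc (i + i)))))
        (++-congʳ _ (relator≈[] s t k e)))
        where
          arith : ∀ k i → suc ((k + i) + (k + i)) ≡ k + k + suc (i + i)
          arith = solve-∀
      shift : ∀ n (g : ℕ → ℕ) → Pointwise _≈_ (applyUpTo (λ i → alt (suc (g i + g i)) s t) n)
                          (applyUpTo (λ i → alt (suc ((k + g i) + (k + g i))) s t) n)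
      shift zero g = []
      shift (suc n) g = shift₁ (g 0) ∷ shift n (g ∘ suc)

  conjs : Word → Word → Word
  conjs [] t = t
  conjs (s ∷ u) t = conj s (conjs u t)

  conjs≡ : ∀ u t → conjs u t ≡ u ++ t ++ reverse u
  conjs≡ [] t = sym (++-identityʳ t)
  conjs≡ (s ∷ u) t = cong (s ∷_) (begin
    conjs u t ++ s ∷ []              ≡⟨ cong (_++ s ∷ []) (conjs≡ u t) ⟩
    (u ++ t ++ reverse u) ++ s ∷ []  ≡⟨ ++-assoc u _ _ ⟩
    u ++ (t ++ reverse u) ++ s ∷ []  ≡⟨ cong (u ++_) (++-assoc t _ _) ⟩
    u ++ t ++ reverse u ++ s ∷ []    ≡⟨ cong (λ z → u ++ t ++ z) (sym (unfold-reverse s u)) ⟩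
    u ++ t ++ reverse (s ∷ u) ∎)
    where open ≡-Reasoning

  invs-++ : ∀ u v → invs (u ++ v) ≡ invs u ++ map (conjs u) (invs v)
  invs-++ [] v = sym (map-id (invs v))
  invs-++ (s ∷ u) v = cong ((s ∷ []) ∷_) (trans (cong (map (conj s)) (invs-++ u v))
    (trans (map-++ (conj s) (invs u) _) (cong (map (conj s) (invs u) ++_) (sym (map-∘ (invs v))))))

  -- At the front, the inversions of `r` cancel in pairs and those of `v` are conjugated by a
  -- trivial element; a letter in front acts on both lists alike.
  Par-relator : ∀ u {r} v → Relator r → ∀ {t b b'} →
                Par t (invs (u ++ r ++ v)) b → Par t (invs (u ++ v)) b' → b ≡ b'
  Par-relator [] {r} v R {t} {b} {b'} p p' rewrite invs-++ r v with Par-++⁻ (invs r) p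
  ... | c , c' , q , q' , refl =
      trans (cong (_xor c') (even R q)) (Par-unique ≈-refl (same (invs v)) q' p')
    where
      even : ∀ {r c} → Relator r → Par t (invs r) c → c ≡ false
      even (rel s s' k e) = invs-even s s' k e
      trivial : ∀ x → conjs r x ≈ x
      trivial x = begin
        conjs r x              ≡⟨ conjs≡ r x ⟩
        r ++ x ++ reverse r    ≈⟨ ≈-rel [] r _ R ⟩
        x ++ reverse r         ≈⟨ ++-congˡ x (≈-rel [] r (reverse r) R) ⟨
        x ++ r ++ reverse r    ≡⟨ cong (λ z → x ++ r ++ z) (sym (++-identityʳ _)) ⟩
        x ++ r ++ reverse r ++ [] ≈⟨ ++-congˡ x (cancel-rev r []) ⟩
        x ++ []                ≡⟨ ++-identityʳ x ⟩
        x ∎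
        where open ≈R
      same : ∀ L → Pointwise _≈_ (map (conjs r) L) L
      same [] = []
      same (x ∷ L) = trivial x ∷ same L
  Par-relator (s ∷ u) v R (hit h p) (hit h' p') = cong not (Par-relator u v R (Par-map⁻ s _ p) (Par-map⁻ s _ p'))
  Par-relator (s ∷ u) v R (miss h p) (miss h' p') = Par-relator u v R (Par-map⁻ s _ p) (Par-map⁻ s _ p')
  Par-relator (s ∷ u) v R (hit h p) (miss h' p') = ⊥-elim (h' h)
  Par-relator (s ∷ u) v R (miss h p) (hit h' p') = ⊥-elim (h h')

  Bool-stable : ∀ {b b' : Bool} → ¬ ¬ (b ≡ b') → b ≡ b'
  Bool-stable {true} {true} k = refl
  Bool-stable {false} {false} k = refl
  Bool-stable {true} {false} k = ⊥-elim (k λ ())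
  Bool-stable {false} {true} k = ⊥-elim (k λ ())

  Par-cong : ∀ {u v} → u ≈ v → ∀ {t b b'} → Par t (invs u) b → Par t (invs v) b' → b ≡ b'
  Par-cong ≈-refl p q = Par-unique ≈-refl (PW.refl ≈-refl) p q
  Par-cong (≈-sym e) p q = sym (Par-cong e q p)
  -- The parity in the middle word exists only up to double negation, which is enough because
  -- equality of booleans is stable.
  Par-cong (≈-trans {v = v} e f) {t} p q = Bool-stable λ k → Par-exists t (invs v) λ (c , r) →
    k (trans (Par-cong e p r) (Par-cong f r q))
  Par-cong (≈-rel u r v R) p q = Par-relator u v R p q

  -- Prefixing `s` adds one occurrence of `s`, and conjugation by `s` fixes `s`.
  Par-∷ : ∀ s u {b b'} → Par (s ∷ []) (invs (s ∷ u)) b → Par (s ∷ []) (invs u) b' → b ≡ not b'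
  Par-∷ s u (hit _ p) q = cong not (Par-unique (ss≈ s (s ∷ [])) (PW.refl ≈-refl) (Par-map⁻ s _ p) q)
  Par-∷ s u (miss h _) q = ⊥-elim (h ≈-refl)

  -- Exchange

  data Del : Word → Word → Set where
    here  : ∀ {x u} → Del (x ∷ u) u
    there : ∀ {x u d} → Del u d → Del (x ∷ u) (x ∷ d)

  Del-length : ∀ {u d} → Del u d → length u ≡ suc (length d)
  Del-length here = refl
  Del-length (there δ) = cong suc (Del-length δ)

  Del-++ˡ : ∀ {u d} v → Del u d → Del (u ++ v) (d ++ v)
  Del-++ˡ v here = here
  Del-++ˡ v (there δ) = there (Del-++ˡ v δ)

  Del-++ʳ : ∀ u {v d} → Del v d → Del (u ++ v) (u ++ d)
  Del-++ʳ [] δ = δ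
  Del-++ʳ (x ∷ u) δ = there (Del-++ʳ u δ)

  Del-++⁻ : ∀ u {v d} → Del (u ++ v) d →
    (Σ Word λ d' → Del u d' × d ≡ d' ++ v) ⊎ (Σ Word λ d' → Del v d' × d ≡ u ++ d')
  Del-++⁻ [] δ = inj₂ (_ , δ , refl)
  Del-++⁻ (x ∷ u) here = inj₁ (_ , here , refl)
  Del-++⁻ (x ∷ u) (there δ) with Del-++⁻ u δ
  ... | inj₁ (d' , δ' , refl) = inj₁ (_ , there δ' , refl)
  ... | inj₂ (d' , δ' , refl) = inj₂ (_ , δ' , refl)

  Del-⊆ : ∀ {u d} → Del u d → d ⊆ u
  Del-⊆ here = Sub._∷ʳ_ _ ⊆-refl
  Del-⊆ (there δ) = refl ∷ Del-⊆ δ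

  invs⇒Del : ∀ {t} u → Any (_≈ t) (invs u) → Σ Word λ d → Del u d × t ++ u ≈ d
  invs⇒Del (x ∷ u) (here p) = u , here , ≈-trans (++-congʳ (x ∷ u) (≈-sym p)) (ss≈ x u)
  invs⇒Del {t} (x ∷ u) (there p) with invs⇒Del u (Any.map (conj-swap x) (Anyₚ.map⁻ p))
  ... | d , δ , e = x ∷ d , there δ , ∷-swap x (begin
      x ∷ t ++ x ∷ u    ≡⟨ cong (x ∷_) (sym (++-assoc t (x ∷ []) u)) ⟩
      conj x t ++ u     ≈⟨ e ⟩
      d ∎)
    where open ≈R

  Par-true : ∀ {t L b} → Par t L b → b ≡ true → Any (_≈ t) L
  Par-true (hit h p) _ = here h
  Par-true (miss h p) e = there (Par-true p e)

  ≤-stable : ∀ {a b} → ¬ ¬ (a ≤ b) → a ≤ b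
  ≤-stable {a} {b} k with a ≤? b
  ... | yes p = p
  ... | no p = ⊥-elim (k p)

  -- The letter `s` has opposite parities in `u` and in any word `v` for `s u`. If it is odd in `v`,
  -- a letter of `v` can be deleted to give a word for `u`, so `v` is long enough; if it is odd in
  -- `u`, the excluded deletion exists.
  weak-exchange : ∀ s {u} → Reduced u → (∀ {d} → Del u d → ¬ (s ∷ u ≈ d)) → Reduced (s ∷ u)
  weak-exchange s {u} ru h v v≈ = ≤-stable λ k →
    Par-exists (s ∷ []) (invs v) λ (b , p) → Par-exists (s ∷ []) (invs u) λ (b' , p') →
    Par-exists (s ∷ []) (invs (s ∷ u)) λ (c , q) → cases k p p' (trans (Par-cong v≈ p q) (Par-∷ s u q p'))
    where
      cases : ∀ {b b'} → ¬ (suc (length u) ≤ length v) →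
              Par (s ∷ []) (invs v) b → Par (s ∷ []) (invs u) b' → b ≡ not b' → ⊥
      cases {true} k p p' _ with invs⇒Del v (Par-true p refl)
      ... | d , δ , e = k (≤-trans (s≤s (ru d (≈-trans (≈-sym e) (≈-trans (∷-cong s v≈) (ss≈ s u)))))
                            (≤-reflexive (sym (Del-length δ))))
      cases {false} {true} k p p' _ with invs⇒Del u (Par-true p' refl)
      ... | d , δ , e = h δ e

  -- Coset representatives

  Reduced-tail : ∀ {s u} → Reduced (s ∷ u) → Reduced u
  Reduced-tail {s} r v e = s≤s⁻¹ (r (s ∷ v) (∷-cong s e))

  Reduced-suffix : ∀ u {v} → Reduced (u ++ v) → Reduced v
  Reduced-suffix [] r = r
  Reduced-suffix (x ∷ u) r = Reduced-suffix u (Reduced-tail r)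

  Reduced-prefix : ∀ u {v} → Reduced (u ++ v) → Reduced u
  Reduced-prefix u {v} r x e = +-cancelʳ-≤ (length v) _ _ (subst₂ _≤_ (length-++ u) (length-++ x)
    (r (x ++ v) (++-congʳ v e)))

  Reduced-cong : ∀ {u v} → Reduced u → v ≈ u → length v ≡ length u → Reduced v
  Reduced-cong r e l x p = subst (_≤ length x) (sym l) (r x (≈-trans p e))

  module Cosets (I : S → Set) where

    -- Double negation, because it is not yet decidable whether a new letter shortens the word; the
    -- result serves only to derive a contradiction.
    ¬¬-reduced : ∀ x → All I x → ¬ ¬ (Σ Word λ y → All I y × y ≈ x × Reduced y)
    ¬¬-reduced [] [] k = k ([] , [] , ≈-refl , λ _ _ → z≤n)
    ¬¬-reduced (s ∷ x) (i ∷ is) k = ¬¬-reduced x is λ (y , ys , e , r) → ¬¬-Dec {Σ Word λ d → Del y d × s ∷ y ≈ d} λ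
      { (yes (d , δ , p)) → k (d , del-all δ ys , ≈-trans (≈-sym p) (∷-cong s e) ,
           λ v q → s≤s⁻¹ (≤-trans (≤-reflexive (sym (Del-length δ)))
                       (r (s ∷ v) (≈-sym (∷-swap s (≈-trans p (≈-sym q)))))))
      ; (no h) → k (s ∷ y , i ∷ ys , ∷-cong s e , weak-exchange s r (λ δ p → h (_ , δ , p))) }
      where
        del-all : ∀ {u d} → Del u d → All I u → All I d
        del-all here (_ ∷ is) = is
        del-all (there δ) (i ∷ is) = i ∷ del-all δ is

    Minimal : Word → Set
    Minimal q = ∀ x p → All I x → p ≈ x ++ q → length q ≤ length p

    -- A failure would delete a letter of `x`, against `x` being reduced, or a letter of `q`, giving
    -- a shorter element of the coset.
    minimal-additive : ∀ {q} → Reduced q → Minimal q → ∀ x → All I x → Reduced x → Reduced (x ++ q)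
    minimal-additive rq mq [] _ _ = rq
    minimal-additive {q} rq mq (s ∷ x) (i ∷ is) r =
      weak-exchange s (minimal-additive rq mq x is (Reduced-tail r)) λ {d} δ e → cases e (Del-++⁻ x δ)
      where
        cases : ∀ {d} → s ∷ x ++ q ≈ d →
          (Σ Word λ d' → Del x d' × d ≡ d' ++ q) ⊎ (Σ Word λ d' → Del q d' × d ≡ x ++ d') → ⊥
        cases e (inj₁ (d' , δ , refl)) = 1+n≰n (≤-trans (n≤1+n _) (subst (λ n → suc n ≤ length d') (Del-length δ)
          (r d' (≈-sym (++-cancelʳ q e)))))
        cases e (inj₂ (d' , δ , refl)) = 1+n≰n (subst (_≤ length d') (Del-length δ)
          (mq (reverse x ++ s ∷ x) d' (Allₚ.++⁺ (All-reverse is) (i ∷ is)) (begin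
            d'                               ≈⟨ rev-cancel x d' ⟨
            reverse x ++ x ++ d'             ≈⟨ ++-congˡ (reverse x) e ⟨
            reverse x ++ s ∷ x ++ q          ≡⟨ sym (++-assoc (reverse x) (s ∷ x) q) ⟩
            (reverse x ++ s ∷ x) ++ q ∎)))
          where open ≈R

    -- If the coset has a shorter element, pass to a shortest one `p`. Then `q` is `y p` with
    -- lengths adding, and the first letter of `y` would be a descent of `q`.
    no-descent⇒minimal : ∀ {q} → Reduced q → (∀ {j} → I j → Reduced (j ∷ q)) → Minimal q
    no-descent⇒minimal {q} rq h x p xs e = ≮⇒≥ λ lt → go (suc (length p)) x p xs e ≤-refl lt
      where
        contra : ∀ x p → All I x → p ≈ x ++ q → Reduced p → Minimal p → length p < length q → ⊥
        contra x p xs e rp mp lt = ¬¬-reduced (reverse x) (All-reverse xs) λ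
          { ([] , _ , f , _) → <-irrefl refl (<-≤-trans lt (rq p (≈-sym (q≈ f))))
          ; (j ∷ y , i ∷ is , f , r) → 1+n≰n (≤-trans (n≤1+n _) (≤-trans
              (s≤s (minimal-additive rp mp (j ∷ y) (i ∷ is) r q (q≈ f)))
              (h i (y ++ p) (≈-sym (≈-trans (∷-cong j (q≈ f)) (ss≈ j _)))))) }
          where
            q≈ : ∀ {y} → y ≈ reverse x → q ≈ y ++ p
            q≈ {y} f = begin
              q                        ≈⟨ rev-cancel x q ⟨
              reverse x ++ x ++ q      ≈⟨ ++-congˡ (reverse x) e ⟨
              reverse x ++ p           ≈⟨ ++-congʳ p f ⟨
              y ++ p ∎
              where open ≈R
        go : ∀ n x p → All I x → p ≈ x ++ q → length p < n → length p < length q → ⊥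
        go (suc n) x p xs e le lt = contra x p xs e
            (λ p' f → below [] p' [] f) below lt
          where
            below : Minimal p
            below y p' ys f = ≮⇒≥ λ lt' → go n (y ++ x) p' (Allₚ.++⁺ ys xs)
              (≈-trans f (≈-trans (++-congˡ y e) (≡⇒≈ (sym (++-assoc y x q)))))
              (<-≤-trans lt' (s≤s⁻¹ le)) (<-trans lt' lt)

    additive : ∀ {q} → Reduced q → (∀ {j} → I j → Reduced (j ∷ q)) →
               ∀ x → All I x → Reduced x → Reduced (x ++ q)
    additive rq h = minimal-additive rq (no-descent⇒minimal rq h)

-- A permutation model in which s t has the prescribed order. The vertices are words, thought of as
-- vertices of a tree rooted at []; every generator either moves along an edge or fixes the vertex,
-- and `room x r` is the number of steps that the alternating path in the colours (head x), r may
-- still descend below x. Every two-coloured component with an edge is a path on μ r r' vertices.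
module Tree (M : CoxeterMatrix) (no𝒯 : ¬ Coxeter.Contains𝒯 M) where
  open CoxeterMatrix M
  open Coxeter M
  open Words M

  module Model (s₀ t₀ : S) (K : ℕ) where

    special : S → S → Set
    special r r' = (r ≡ s₀ × r' ≡ t₀) ⊎ (r ≡ t₀ × r' ≡ s₀)

    special? : ∀ r r' → Dec (special r r')
    special? r r' with r ≟ s₀ | r' ≟ t₀ | r ≟ t₀ | r' ≟ s₀
    ... | yes p | yes q | _ | _ = yes (inj₁ (p , q))
    ... | _ | _ | yes p | yes q = yes (inj₂ (p , q))
    ... | no p | _ | no q | _ = no λ { (inj₁ (a , _)) → p a ; (inj₂ (a , _)) → q a }
    ... | no p | _ | yes _ | no q = no λ { (inj₁ (a , _)) → p a ; (inj₂ (_ , a)) → q a }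
    ... | yes _ | no p | no q | _ = no λ { (inj₁ (_ , a)) → p a ; (inj₂ (a , _)) → q a }
    ... | yes _ | no p | yes _ | no q = no λ { (inj₁ (_ , a)) → p a ; (inj₂ (_ , a)) → q a }

    -- An infinite edge imposes no relation, so its length in the model is free: `K` for the pair
    -- under test, and 2 elsewhere, which keeps all other infinite edges from producing long paths.
    weight : ∀ {A : Set} → Maybe ℕ → Dec A → ℕ
    weight (just k) _ = k
    weight nothing (yes _) = K
    weight nothing (no _) = 2

    μ : S → S → ℕ
    μ r r' = weight (m r r') (special? r r')

    μ-just : ∀ {r r' k} → m r r' ≡ just k → μ r r' ≡ k
    μ-just e rewrite e = refl

    μ-special : m s₀ t₀ ≡ nothing → μ s₀ t₀ ≡ K
    μ-special e rewrite e with special? s₀ t₀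
    ... | yes _ = refl
    ... | no h = ⊥-elim (h (inj₁ (refl , refl)))

    special-sym : ∀ {r r'} → special r r' → special r' r
    special-sym (inj₁ (p , q)) = inj₂ (q , p)
    special-sym (inj₂ (p , q)) = inj₁ (q , p)

    μ-sym : ∀ r r' → μ r r' ≡ μ r' r
    μ-sym r r' rewrite m-sym r r' with m r' r | special? r r' | special? r' r
    ... | just _ | _ | _ = refl
    ... | nothing | yes _ | yes _ = refl
    ... | nothing | no _ | no _ = refl
    ... | nothing | yes p | no q = ⊥-elim (q (special-sym p))
    ... | nothing | no p | yes q = ⊥-elim (p (special-sym q))

    -- Avoiding `𝒯` excludes (2, b, c) only for finite b. When both edges at `h` are infinite, at
    -- most one of them is the special one, and the other has weight 2.
    no-commuting-pair : ∀ {h r r'} → h ≢ r → h ≢ r' → r ≢ r' → 3 ≤ μ h r → 3 ≤ μ h r' → m r r' ≢ just 2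
    no-commuting-pair {h} {r} {r'} hr hr' rr' p p' e
      with m h r in eq | m h r' in eq' | special? h r | special? h r'
    ... | just b | just c | _ | _ = no𝒯 (r , r' , h , rr' , hr ∘ sym , hr' ∘ sym , e ,
            (b , trans (m-sym r h) eq , p) , inj₂ (c , trans (m-sym r' h) eq' , p'))
    ... | just b | nothing | _ | _ = no𝒯 (r , r' , h , rr' , hr ∘ sym , hr' ∘ sym , e ,
            (b , trans (m-sym r h) eq , p) , inj₁ (trans (m-sym r' h) eq'))
    ... | nothing | just c | _ | _ = no𝒯 (r' , r , h , rr' ∘ sym , hr' ∘ sym , hr ∘ sym ,
            trans (m-sym r' r) e , (c , trans (m-sym r' h) eq' , p') , inj₁ (trans (m-sym r h) eq))
    ... | nothing | nothing | yes a | yes b = rr' (same a b)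
      where
        same : special h r → special h r' → r ≡ r'
        same (inj₁ (_ , refl)) (inj₁ (_ , refl)) = refl
        same (inj₂ (_ , refl)) (inj₂ (_ , refl)) = refl
        same (inj₁ (refl , refl)) (inj₂ (e , refl)) = sym e
        same (inj₂ (refl , refl)) (inj₁ (e , refl)) = sym e
    ... | nothing | nothing | yes _ | no _ with s≤s (s≤s ()) ← p'
    ... | nothing | nothing | no _ | _ with s≤s (s≤s ()) ← p

    -- A path with its top in the middle descends one step on one side and μ ∸ 2 steps on the other.
    share : S → S → ℕ
    share r r' with toℕ r <? toℕ r'
    ... | yes _ = 0
    ... | no _ = μ r r' ∸ 3

    share-sum : ∀ {r r'} → r ≢ r' → share r r' + share r' r ≡ μ r r' ∸ 3
    share-sum {r} {r'} rr' with toℕ r <? toℕ r' | toℕ r' <? toℕ r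
    ... | yes p | yes q = ⊥-elim (<-irrefl refl (<-trans p q))
    ... | yes p | no q = cong (_∸ 3) (μ-sym r' r)
    ... | no p | yes q = +-identityʳ _
    ... | no p | no q = ⊥-elim (rr' (toℕ-injective (≤-antisym (≮⇒≥ q) (≮⇒≥ p))))

    share≤ : ∀ r r' → share r r' ≤ μ r r' ∸ 2
    share≤ r r' with toℕ r <? toℕ r'
    ... | yes _ = z≤n
    ... | no _ = ∸-mono≤ (μ r r')
      where
        ∸-mono≤ : ∀ n → n ∸ 3 ≤ n ∸ 2
        ∸-mono≤ 0 = z≤n
        ∸-mono≤ 1 = z≤n
        ∸-mono≤ 2 = z≤n
        ∸-mono≤ (suc (suc (suc n))) = n≤1+n n

    head? : S → Word → Bool
    head? r [] = false
    head? r (y ∷ _) with r ≟ y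
    ... | yes _ = true
    ... | no _ = false

    head?-refl : ∀ r x → head? r (r ∷ x) ≡ true
    head?-refl r x with r ≟ r
    ... | yes _ = refl
    ... | no h = ⊥-elim (h refl)

    head?-≢ : ∀ {r h} x → r ≢ h → head? r (h ∷ x) ≡ false
    head?-≢ {r} {h} x n with r ≟ h
    ... | yes e = ⊥-elim (n e)
    ... | no _ = refl

    -- Three ways for the path in the colours `h`, `r` to reach `h ∷ x`: it came down through `x`
    -- and has one step less left; it starts at `x`, which `r` fixes; or `x` is its top, with `r`
    -- descending on the other side.
    below : Bool → ℕ → ℕ → S → S → ℕ
    below true _ n h r = n ∸ 1
    below false zero _ h r = μ h r ∸ 2
    below false (suc _) _ h r = share h r

    room : Word → S → ℕ
    -- Only `s₀` moves the root, so that a word starting with `t₀` stays one step behind, see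
    -- `alt-≉`.
    room [] r = if head? r (s₀ ∷ []) then 1 else 0
    room (h ∷ x) r = below (head? r x) (room x r) (room x h) h r

    tail : Word → Word
    tail [] = []
    tail (_ ∷ x) = x

    move : Bool → ℕ → S → Word → Word
    move true _ r x = tail x
    move false zero r x = x
    move false (suc _) r x = r ∷ x

    act : S → Word → Word
    act r x = move (head? r x) (room x r) r x

    data Valid : Word → Set where
      root : Valid []
      push : ∀ {r x n} → Valid x → head? r x ≡ false → room x r ≡ suc n → Valid (r ∷ x)

    act-valid : ∀ r {x} → Valid x → Valid (act r x)
    act-valid r {x} v with head? r x in e | room x r in e'
    act-valid r root | true | _ = root
    act-valid r (push v _ _) | true | _ = v
    ... | false | zero = v
    ... | false | suc n = push v e e'

    act-act : ∀ r {x} → Valid x → act r (act r x) ≡ x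
    act-act r {x} v with head? r x in e | room x r in e'
    act-act r {y ∷ x} (push v h k) | true | _ with r ≟ y
    ... | yes refl rewrite h | k = refl
    act-act r v | false | zero rewrite e | e' = refl
    act-act r {x} v | false | suc n rewrite head?-refl r x = refl

    act-pop : ∀ r x → act r (r ∷ x) ≡ x
    act-pop r x rewrite head?-refl r x = refl

    run : Word → Word → Word
    run [] x = x
    run (s ∷ u) x = run u (act s x)

    run-++ : ∀ u v x → run (u ++ v) x ≡ run v (run u x)
    run-++ [] v x = refl
    run-++ (s ∷ u) v x = run-++ u v (act s x)

    run-valid : ∀ u {x} → Valid x → Valid (run u x)
    run-valid [] v = v
    run-valid (s ∷ u) v = run-valid u (act-valid s v)

    alt-odd-++ : ∀ r r' c n → alt (suc (c + c) + n) r r' ≡ alt (suc (c + c)) r r' ++ alt n r' r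
    alt-odd-++ r r' c n = cong (r ∷_) (alt-even-++ r' r c n)

    alt-even-snoc : ∀ r r' c → alt (suc (suc (c + c))) r r' ≡ alt (suc (c + c)) r r' ++ r' ∷ []
    alt-even-snoc r r' c = trans (cong (λ n → alt (suc n) r r') (+-comm 1 (c + c))) (alt-odd-++ r r' c 1)

    -- Go down `n` steps, stay once at the bottom, climb back: `2n + 1` letters.
    excursion : ∀ n {h o} x → o ≢ h → room (h ∷ x) o ≡ n →
                run (alt (suc (n + n)) o h) (h ∷ x) ≡ h ∷ x
    excursion zero {h} {o} x n e rewrite head?-≢ x n | e = refl
    excursion (suc k) {h} {o} x n e = begin
      run (alt (suc (suc k + suc k)) o h) (h ∷ x)
        ≡⟨ cong (λ y → run (alt (suc k + suc k) h o) y) step ⟩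
      run (alt (suc k + suc k) h o) (o ∷ h ∷ x)
        ≡⟨ cong (λ w → run w (o ∷ h ∷ x)) (trans (cong (λ n → alt n h o) (cong suc (+-suc k k))) (alt-even-snoc h o k)) ⟩
      run (alt (suc (k + k)) h o ++ o ∷ []) (o ∷ h ∷ x)
        ≡⟨ run-++ (alt (suc (k + k)) h o) (o ∷ []) (o ∷ h ∷ x) ⟩
      act o (run (alt (suc (k + k)) h o) (o ∷ h ∷ x))
        ≡⟨ cong (act o) (excursion k (h ∷ x) (n ∘ sym) room') ⟩
      act o (o ∷ h ∷ x)
        ≡⟨ act-pop o (h ∷ x) ⟩
      h ∷ x ∎
      where
        open ≡-Reasoning
        step : act o (h ∷ x) ≡ o ∷ h ∷ x
        step rewrite head?-≢ x n | e = refl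
        room' : room (o ∷ h ∷ x) h ≡ k
        room' rewrite head?-refl h x | e = refl

    -- The number of vertices below the top on the side that starts with `r`, computed from the
    -- rooms of `r` and `r'` at the top.
    depth : ℕ → ℕ → S → S → ℕ
    depth zero _ r r' = 0
    depth (suc _) zero r r' = suc (μ r r' ∸ 2)
    depth (suc _) (suc _) r r' = suc (share r r')

    top-excursion : ∀ {r r' y} a b → r ≢ r' → head? r y ≡ false → head? r' y ≡ false →
                    room y r ≡ a → room y r' ≡ b →
                    run (alt (suc (depth a b r r' + depth a b r r')) r r') y ≡ y
    top-excursion {r} zero b n e e' f f' rewrite e | f = refl
    top-excursion {r} {r'} {y} (suc a) b n e e' f f' = go b f'
      where
        step : act r y ≡ r ∷ y
        step rewrite e | f = refl
        descend : ∀ c → room (r ∷ y) r' ≡ c → run (alt (suc (suc c + suc c)) r r') y ≡ y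
        descend c h = begin
          run (alt (suc c + suc c) r' r) (act r y)
            ≡⟨ cong₂ (λ n x → run (alt (suc n) r' r) x) (+-suc c c) step ⟩
          run (alt (suc (suc (c + c))) r' r) (r ∷ y)
            ≡⟨ cong (λ w → run w (r ∷ y)) (alt-even-snoc r' r c) ⟩
          run (alt (suc (c + c)) r' r ++ r ∷ []) (r ∷ y)
            ≡⟨ run-++ (alt (suc (c + c)) r' r) (r ∷ []) (r ∷ y) ⟩
          act r (run (alt (suc (c + c)) r' r) (r ∷ y))
            ≡⟨ cong (act r) (excursion c y (n ∘ sym) h) ⟩
          act r (r ∷ y)
            ≡⟨ act-pop r y ⟩
          y ∎
          where open ≡-Reasoning
        go : ∀ b → room y r' ≡ b →
             run (alt (suc (depth (suc a) b r r' + depth (suc a) b r r')) r r') y ≡ y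
        go zero f' = descend _ (cong₂ (λ t k → below t k (room y r) r r') e' f')
        go (suc b) f' = descend _ (cong₂ (λ t k → below t k (room y r) r r') e' f')

    room≤ : ∀ {h x} r → Valid (h ∷ x) → room (h ∷ x) r ≤ μ h r ∸ 2
    room≤ {h} {x} r (push v e k) with head? r x in f
    room≤ {h} {y ∷ x} r (push v e k) | true with r ≟ y
    ... | yes refl = ≤-trans (m∸n≤m _ 1) (subst (λ n → room (r ∷ x) h ≤ n ∸ 2) (μ-sym r h) (room≤ h v))
    room≤ {h} {x} r (push v e k) | false with room x r
    ... | zero = ≤-refl
    ... | suc _ = share≤ h r

    -- A path with its top in the middle has at least three vertices, so commuting letters must not
    -- both descend from one vertex; this is where avoiding `𝒯` makes the model work.
    m≢2 : ∀ {r r' y n n'} → Valid y → r ≢ r' → head? r y ≡ false → head? r' y ≡ false →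
          room y r ≡ suc n → room y r' ≡ suc n' → m r r' ≢ just 2
    m≢2 {r} {r'} root n e e' f f' with r ≟ s₀ | r' ≟ s₀
    ... | yes refl | yes refl = ⊥-elim (n refl)
    m≢2 root n e e' () f' | no _ | _
    m≢2 root n e e' f () | _ | no _
    m≢2 {r} {r'} {h ∷ x} v@(push _ _ _) n e e' f f' =
        no-commuting-pair (ne e) (ne e') n (big f) (big f')
      where
        ne : ∀ {r} → head? r (h ∷ x) ≡ false → h ≢ r
        ne {r} e refl with () ← trans (sym e) (head?-refl r x)
        three : ∀ n → 1 ≤ n ∸ 2 → 3 ≤ n
        three (suc (suc (suc n))) _ = s≤s (s≤s (s≤s z≤n))
        big : ∀ {r n} → room (h ∷ x) r ≡ suc n → 3 ≤ μ h r
        big {r} f = three _ (≤-trans (subst (1 ≤_) (sym f) (s≤s z≤n)) (room≤ r v))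

    -- Unless both letters fix `y`, the relator makes one excursion on each side of the top, with
    -- `2c + 1` and `2c' + 1` letters; the path has `1 + c + c' ≡ k` vertices, so the `2k` letters
    -- are used up exactly.
    run-relator-top : ∀ {r r' k y} → Valid y → r ≢ r' → m r r' ≡ just k → head? r y ≡ false →
                      head? r' y ≡ false → run (alt (k + k) r r') y ≡ y
    run-relator-top {r} {r'} {k} {y} v n mk e e' = go (room y r) (room y r') refl refl
      where
        fixed : ∀ j {r r'} → room y r ≡ 0 → room y r' ≡ 0 → head? r y ≡ false → head? r' y ≡ false →
                run (alt j r r') y ≡ y
        fixed zero _ _ _ _ = refl
        fixed (suc j) {r} {r'} f f' e e' =
          trans (cong (run (alt j r' r)) (cong₂ (λ t k → move t k r y) e f)) (fixed j f' f e' e)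
        path : ∀ a b → room y r ≡ a → room y r' ≡ b → suc (depth a b r r' + depth b a r' r) ≡ k →
               run (alt (k + k) r r') y ≡ y
        path a b f f' refl = begin
          run (alt (suc (c + c') + suc (c + c')) r r') y
            ≡⟨ cong (λ w → run w y) (trans (cong (λ j → alt j r r') (arith c c')) (alt-odd-++ r r' c _)) ⟩
          run (alt (suc (c + c)) r r' ++ alt (suc (c' + c')) r' r) y
            ≡⟨ run-++ (alt (suc (c + c)) r r') _ y ⟩
          run (alt (suc (c' + c')) r' r) (run (alt (suc (c + c)) r r') y)
            ≡⟨ cong (run (alt (suc (c' + c')) r' r)) (top-excursion {y = y} a b n e e' f f') ⟩
          run (alt (suc (c' + c')) r' r) y
            ≡⟨ top-excursion b a (n ∘ sym) e' e f' f ⟩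
          y ∎
          where
            open ≡-Reasoning
            c c' : ℕ
            c = depth a b r r'
            c' = depth b a r' r
            arith : ∀ c c' → suc (c + c') + suc (c + c') ≡ suc (c + c) + suc (c' + c')
            arith = solve-∀
        2≤k : 2 ≤ k
        2≤k = m-off r r' n k mk
        go : ∀ a b → room y r ≡ a → room y r' ≡ b → run (alt (k + k) r r') y ≡ y
        go zero zero f f' = fixed (k + k) f f' e e'
        go (suc a) zero f f' = path (suc a) zero f f' (trans (cong suc (+-identityʳ _))
          (trans (cong (λ j → 2 + (j ∸ 2)) (μ-just mk)) (m+[n∸m]≡n 2≤k)))
        go zero (suc b) f f' = path zero (suc b) f f'
          (trans (cong (λ j → 2 + (j ∸ 2)) (trans (μ-sym r' r) (μ-just mk))) (m+[n∸m]≡n 2≤k))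
        go (suc a) (suc b) f f' = path (suc a) (suc b) f f'
          (trans (cong (suc ∘ suc) (+-suc _ _)) (trans (cong (3 +_) (share-sum n))
            (trans (cong (λ j → 3 + (j ∸ 3)) (μ-just mk))
              (m+[n∸m]≡n (≤∧≢⇒< 2≤k λ { refl → m≢2 v n e e' f f' mk })))))

    -- Reduction to the top of the path: below it, the action of the relator is conjugate, by the
    -- last letter pushed, to its action one step higher.
    run-relator : ∀ {r r' k x} → Valid x → r ≢ r' → m r r' ≡ just k → run (alt (k + k) r r') x ≡ x
    run-relator root n mk = run-relator-top root n mk refl refl
    run-relator {r} {r'} {k} {h ∷ y} v@(push w e f) n mk with h ≟ r | h ≟ r'
    ... | no p | no q = run-relator-top v n mk (head?-≢ y (p ∘ sym)) (head?-≢ y (q ∘ sym))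
    ... | _ | yes refl = begin
        run (alt (k + k) r h) (h ∷ y)       ≡⟨ cong (run (alt (k + k) r h)) pushed ⟨
        run (alt (suc (k + k)) h r) y       ≡⟨ cong (λ w → run w y) (trans (cong (λ n → alt n h r) (+-comm 1 (k + k))) (alt-even-++ h r k 1)) ⟩
        run (alt (k + k) h r ++ h ∷ []) y   ≡⟨ run-++ (alt (k + k) h r) _ y ⟩
        act h (run (alt (k + k) h r) y)     ≡⟨ cong (act h) (run-relator w (n ∘ sym) (trans (m-sym h r) mk)) ⟩
        act h y                             ≡⟨ pushed ⟩
        h ∷ y ∎
      where
        open ≡-Reasoning
        pushed : act h y ≡ h ∷ y
        pushed rewrite e | f = refl
    ... | yes refl | no q = back k (run-relator w (n ∘ sym) (trans (m-sym r' h) mk))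
      where
        open ≡-Reasoning
        pushed : act h y ≡ h ∷ y
        pushed rewrite e | f = refl
        back : ∀ k → run (alt (k + k) r' h) y ≡ y → run (alt (k + k) h r') (h ∷ y) ≡ h ∷ y
        back zero _ = refl
        back (suc k) p = begin
          run (alt (k + suc k) r' h) (act h (h ∷ y))
            ≡⟨ cong₂ (λ n x → run (alt n r' h) x) (+-suc k k) (act-pop h y) ⟩
          run (alt (suc (k + k)) r' h) y
            ≡⟨ act-act h (run-valid (alt (suc (k + k)) r' h) w) ⟨
          act h (act h (run (alt (suc (k + k)) r' h) y))
            ≡⟨ cong (act h) (trans (sym (run-++ (alt (suc (k + k)) r' h) (h ∷ []) y))
                 (trans (cong (λ w → run w y) (trans (sym (alt-even-snoc r' h k)) (cong (λ n → alt (suc n) r' h) (sym (+-suc k k))))) p)) ⟩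
          act h y
            ≡⟨ pushed ⟩
          h ∷ y ∎

    run-cong : ∀ {u v} → u ≈ v → ∀ {x} → Valid x → run u x ≡ run v x
    run-cong ≈-refl v = refl
    run-cong (≈-sym p) v = sym (run-cong p v)
    run-cong (≈-trans p q) v = trans (run-cong p v) (run-cong q v)
    run-cong (≈-rel u _ w (rel s t k e)) {x} v = begin
      run (u ++ altPow s t k ++ w) x            ≡⟨ run-++ u _ x ⟩
      run (altPow s t k ++ w) (run u x)         ≡⟨ run-++ (altPow s t k) w _ ⟩
      run w (run (altPow s t k) (run u x))      ≡⟨ cong (run w) (trivial (run-valid u v)) ⟩
      run w (run u x)                           ≡⟨ run-++ u w x ⟨
      run (u ++ w) x ∎
      where
        open ≡-Reasoning
        trivial : ∀ {y} → Valid y → run (altPow s t k) y ≡ y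
        trivial {y} v with s ≟ t
        ... | no n = trans (cong (λ w → run w y) (altPow≡alt s t k)) (run-relator v n e)
        ... | yes refl with refl ← just-injective (trans (sym e) (m-diag s)) = act-act s v

    run-descend : ∀ j {h o} x → o ≢ h → j ≤ room (h ∷ x) o →
                  length (run (alt j o h) (h ∷ x)) ≡ j + suc (length x)
    run-descend zero x n le = refl
    run-descend (suc j) {h} {o} x n le = go (room (h ∷ x) o) refl le
      where
        go : ∀ k → room (h ∷ x) o ≡ k → suc j ≤ k →
             length (run (alt (suc j) o h) (h ∷ x)) ≡ suc j + suc (length x)
        go (suc k) e le = trans (cong (length ∘ run (alt j h o)) step)
            (trans (run-descend j (h ∷ x) (n ∘ sym) (subst (j ≤_) (sym room') (s≤s⁻¹ le))) (+-suc j _))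
          where
            step : act o (h ∷ x) ≡ o ∷ h ∷ x
            step rewrite head?-≢ x n | e = refl
            room' : room (o ∷ h ∷ x) h ≡ k
            room' rewrite head?-refl h x | e = refl

    run-root : ∀ j {t} → t ≢ s₀ → j ≤ μ s₀ t ∸ 1 → length (run (alt j s₀ t) []) ≡ j
    run-root zero _ _ = refl
    run-root (suc j) {t} n le = trans (cong (length ∘ run (alt j t s₀)) step)
        (trans (run-descend j [] n (subst (j ≤_) (sym room') (pred-≤ (μ s₀ t) le))) (+-comm j 1))
      where
        pred-≤ : ∀ n → suc j ≤ n ∸ 1 → j ≤ n ∸ 2
        pred-≤ (suc (suc n)) p = s≤s⁻¹ p
        step : act s₀ [] ≡ s₀ ∷ []
        step rewrite head?-refl s₀ [] = refl
        room' : room (s₀ ∷ []) t ≡ μ s₀ t ∸ 2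
        room' rewrite head?-≢ [] n = refl

    -- From the root the word starting with `s₀` reaches depth `j + 1`, whereas the other wastes its
    -- first letter on the root.
    alt-≉ : ∀ j {t} → t ≢ s₀ → suc j ≤ μ s₀ t ∸ 1 → ¬ (alt (suc j) s₀ t ≈ alt (suc j) t s₀)
    alt-≉ j {t} n le e = 1+n≢n (trans (sym (run-root (suc j) n le))
        (trans (cong length (run-cong e root)) (trans (cong (length ∘ run (alt j s₀ t)) step)
          (run-root j n (≤-trans (n≤1+n j) le)))))
      where
        step : act t [] ≡ []
        step rewrite head?-≢ [] n = refl

  Below : ℕ → S → S → Set
  Below n s t = ∀ k → m s t ≡ just k → n ≤ k

  alt-exact : ∀ {s t} j → s ≢ t → Below (suc (suc j)) s t → ¬ (alt (suc j) s t ≈ alt (suc j) t s)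
  alt-exact {s} {t} j n lt with m s t in e
  ... | just k = alt-≉ j (n ∘ sym) (subst (λ z → suc j ≤ z ∸ 1) (sym (μ-just e)) (pred-≤ (lt k refl)))
    where
      open Model s t 2
      pred-≤ : ∀ {k} → suc (suc j) ≤ k → suc j ≤ k ∸ 1
      pred-≤ (s≤s p) = p
  -- For an infinite edge, `K = j + 2` is the least path length that separates the two words.
  ... | nothing = alt-≉ j (n ∘ sym) (subst (λ z → suc j ≤ z ∸ 1) (sym (μ-special e)) ≤-refl)
    where open Model s t (suc (suc j))

-- Decidability of equality in W

module WordProblem (M : CoxeterMatrix) (no𝒯 : ¬ Coxeter.Contains𝒯 M) where
  open CoxeterMatrix M
  open Coxeter M
  open Words M
  open Tree M no𝒯

  ++-swap : ∀ {u v} x → u ++ x ∷ [] ≈ v → u ≈ v ++ x ∷ []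
  ++-swap {u} {v} x e = ++-cancelʳ (x ∷ []) (≈-trans e (≈-sym (≈-trans (≡⇒≈ (++-assoc v _ _))
    (≈-trans (++-congˡ v (ss≈ x [])) (≡⇒≈ (++-identityʳ v))))))

  alt-snoc : ∀ i s t → Σ S λ x → (x ≡ s ⊎ x ≡ t) × alt (suc i) s t ≡ alt i s t ++ x ∷ []
  alt-snoc zero s t = s , inj₁ refl , refl
  alt-snoc (suc i) s t with alt-snoc i t s
  ... | x , inj₁ p , e = x , inj₂ p , cong (s ∷_) e
  ... | x , inj₂ p , e = x , inj₁ p , cong (s ∷_) e

  alt-letters : ∀ n s t → All (λ x → x ≡ s ⊎ x ≡ t) (alt n s t)
  alt-letters zero s t = []
  alt-letters (suc n) s t = inj₁ refl ∷ All.map (λ { (inj₁ p) → inj₂ p ; (inj₂ p) → inj₁ p }) (alt-letters n t s)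

  Del-alt : ∀ n {s t d} → Del (alt n s t) d →
    Σ ℕ λ i → Σ Word λ z → suc i ≤ n × alt n s t ≡ alt (suc i) s t ++ z × d ≡ alt i s t ++ z
  Del-alt (suc n) here = 0 , _ , s≤s z≤n , refl , refl
  Del-alt (suc n) {s} (there δ) with Del-alt n δ
  ... | i , z , le , p , q = suc i , z , s≤s le , cong (s ∷_) p , cong (s ∷_) q

  Below-sym : ∀ {n s t} → Below n s t → Below n t s
  Below-sym {n} {s} {t} b k e = b k (trans (m-sym s t) e)

  Below-≤ : ∀ {n n' s t} → n' ≤ n → Below n s t → Below n' s t
  Below-≤ le b k e = ≤-trans le (b k e)

  -- An exchange would amount to a braid relation shorter than `m s t`, which `alt-exact` excludes.
  alt-reduced : ∀ n {s t} → s ≢ t → Below n s t → Reduced (alt n s t)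
  alt-reduced zero _ _ _ _ = z≤n
  alt-reduced (suc n) {s} {t} st b =
    weak-exchange s (alt-reduced n (st ∘ sym) (Below-sym (Below-≤ (n≤1+n n) b))) contra
    where
      contra : ∀ {d} → Del (alt n t s) d → ¬ (s ∷ alt n t s ≈ d)
      contra δ e with Del-alt n δ
      ... | i , z , le , p , refl with alt-snoc i t s
      ...   | x , _ , q = alt-exact i st (Below-≤ (s≤s le) b) (≈-trans
                (++-swap x (≈-trans (≡⇒≈ (cong (s ∷_) (sym q)))
                  (++-cancelʳ z (≈-trans (≡⇒≈ (cong (s ∷_) (sym p))) e)))) (≡⇒≈ (sym q)))

  alt-split : ∀ {i n} s t → i ≤ n → Σ Word λ z → alt n s t ≡ alt i s t ++ z
  alt-split s t z≤n = _ , refl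
  alt-split s t (s≤s le) with alt-split t s le
  ... | z , e = z , cong (s ∷_) e

  alt-bounded : ∀ n {s t} → s ≢ t → Reduced (alt n s t) → Below n s t
  alt-bounded n {s} {t} st r k e = ≮⇒≥ (contra k e (m-off s t st k e))
    where
      contra : ∀ k → m s t ≡ just k → 2 ≤ k → ¬ (k < n)
      contra (suc k) e _ lt with alt-split s t lt
      ... | z , p = 1+n≰n (≤-trans (n≤1+n _) (subst₂ _≤_ (length-alt (2 + k) s t) (length-alt k t s)
              (Reduced-prefix (alt (2 + k) s t) (subst Reduced p r) (alt k t s)
                (≈-sym (≈-trans (∷-cong s (≈-sym (alt-braid s t _ e))) (ss≈ s _))))))

  dihedral-reduced : ∀ n {s t q} → s ≢ t → Below n s t → Reduced q → Reduced (s ∷ q) → Reduced (t ∷ q) →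
                     Reduced (alt n s t ++ q)
  dihedral-reduced n {s} {t} {q} st b rq rs rt =
    Cosets.additive (λ x → x ≡ s ⊎ x ≡ t) rq (λ { (inj₁ refl) → rs ; (inj₂ refl) → rt })
      (alt n s t) (alt-letters n s t) (alt-reduced n st b)

  Desc : S → Word → Set
  Desc z p = Σ Word λ d → Del p d × p ≈ z ∷ d

  Desc-reduced : ∀ {z p} → Reduced p → ((d , _) : Desc z p) → Reduced d
  Desc-reduced r (d , δ , e) = Reduced-tail (Reduced-cong r (≈-sym e) (sym (Del-length δ)))

  ¬Desc⇒reduced : ∀ {z p} → Reduced p → ¬ Desc z p → Reduced (z ∷ p)
  ¬Desc⇒reduced {z} r h = weak-exchange z r λ δ e → h (_ , δ , ∷-swap z e)

  record Strip (a b : S) (p : Word) : Set where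
    constructor strip
    field
      count : ℕ
      core : Word
      split : p ≈ alt count a b ++ core
      lengths : length p ≡ count + length core
      core-reduced : Reduced core
      core-a : Reduced (a ∷ core)
      core-b : Reduced (b ∷ core)

  strip-extend : ∀ {a b p d} → Reduced p → p ≈ a ∷ d → length p ≡ suc (length d) →
                 Strip a b d ⊎ Strip b a d → Strip a b p
  strip-extend {a} r e l (inj₂ (strip n q f k r₀ r₁ r₂)) =
    strip (suc n) q (≈-trans e (∷-cong a f)) (trans l (cong suc k)) r₀ r₂ r₁
  strip-extend {a} r e l (inj₁ (strip zero q f k r₀ r₁ r₂)) =
    strip 1 q (≈-trans e (∷-cong a f)) (trans l (cong suc k)) r₀ r₁ r₂
  strip-extend {a} {b} {p} {d} r e l (inj₁ (strip (suc n) q f k _ _ _)) = ⊥-elim (1+n≰n (≤-trans (n≤1+n _)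
    (≤-trans (subst (_≤ length (alt n b a ++ q)) (trans l (cong suc k)) (r (alt n b a ++ q) (≈-sym (≈-trans e (≈-trans (∷-cong a f) (ss≈ a _))))))
       (≤-reflexive (trans (length-++ (alt n b a)) (cong (_+ length q) (length-alt n b a)))))))

  -- The decision of descents is an argument bounded by `n`, because during the induction equality
  -- is decided only up to that length.
  stripping : ∀ a b n → (∀ z p → length p ≤ n → Reduced p → Dec (Desc z p)) →
              ∀ p → length p ≤ n → Reduced p → Strip a b p ⊎ Strip b a p
  stripping a b n desc? p le r = go n p le r ≤-refl
    where
      go : ∀ k p → length p ≤ k → Reduced p → k ≤ n → Strip a b p ⊎ Strip b a p
      go k p le r kn with desc? a p (≤-trans le kn) r | desc? b p (≤-trans le kn) r
      ... | no h | no h' = inj₁ (strip 0 p ≈-refl refl r (¬Desc⇒reduced r h) (¬Desc⇒reduced r h'))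
      go zero [] le r kn | yes (d , () , e) | _
      go zero [] le r kn | _ | yes (d , () , e)
      go (suc k) p le r kn | yes D@(d , δ , e) | _ = inj₁ (strip-extend r e (Del-length δ)
        (go k d (s≤s⁻¹ (subst (_≤ suc k) (Del-length δ) le)) (Desc-reduced r D) (≤-trans (n≤1+n k) kn)))
      go (suc k) p le r kn | no _ | yes D@(d , δ , e) = inj₂ (strip-extend r e (Del-length δ)
        (swap (go k d (s≤s⁻¹ (subst (_≤ suc k) (Del-length δ) le)) (Desc-reduced r D) (≤-trans (n≤1+n k) kn))))
        where
          swap : ∀ {A B : Set} → A ⊎ B → B ⊎ A
          swap (inj₁ x) = inj₂ x
          swap (inj₂ x) = inj₁ x

  del-search : ∀ {Q : Word → Set} u → (∀ {d} → Del u d → Dec (Q d)) → Dec (Σ Word λ d → Del u d × Q d)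
  del-search [] Q? = no λ { (_ , () , _) }
  del-search {Q} (x ∷ u) Q? with Q? here | del-search {Q ∘ (x ∷_)} u (Q? ∘ there)
  ... | yes q | _ = yes (_ , here , q)
  ... | no _ | yes (d , δ , q) = yes (_ , there δ , q)
  ... | no h | no h' = no λ { (_ , here , q) → h q ; (_ , there δ , q) → h' (_ , δ , q) }

  Normal : Word → Set
  Normal u = Σ Word λ v → v ≈ u × Reduced v × length v ≤ length u

  record Decided (n : ℕ) : Set where
    field
      eq : ∀ u v → length u ≤ n → length v ≤ n → Dec (u ≈ v)
      normal : ∀ u → length u ≤ n → Normal u

    desc : ∀ z p → length p ≤ n → Reduced p → Dec (Desc z p)
    desc z p le r = del-search p λ {d} δ → eq p (z ∷ d) le (subst (_≤ n) (Del-length δ) le)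

  module Extend (n : ℕ) (D : Decided n) where
    open Decided D

    normal⁺ : ∀ u → length u ≤ suc n → Normal u
    normal⁺ [] _ = [] , ≈-refl , (λ _ _ → z≤n) , z≤n
    normal⁺ (s ∷ u) le with normal u (s≤s⁻¹ le)
    ... | v , e , r , l with desc s v (≤-trans l (s≤s⁻¹ le)) r
    ...   | no h = s ∷ v , ∷-cong s e , ¬Desc⇒reduced r h , s≤s l
    ...   | yes D@(d , δ , f) = d , ≈-trans (≈-sym (≈-trans (∷-cong s f) (ss≈ s d))) (∷-cong s e) ,
              Desc-reduced r D , ≤-trans (n≤1+n _) (≤-trans (≤-reflexive (sym (Del-length δ))) (m≤n⇒m≤1+n l))

    -- Strip from `p` its part in the dihedral group of `y` and `s`, of length `j + 1`. If that is
    -- one less than `m s y`, a braid carries `s` through it and the same kind of question remains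
    -- for the shorter `q`. If it is less still, `y s p` is reduced, whereas the equality would give
    -- it the shorter word `p' x`.
    conjugate? : ∀ s x p → length p ≡ n → Reduced p → Reduced (s ∷ p) → Dec (s ∷ p ≈ p ++ x ∷ [])
    conjugate? s x [] _ _ _ with s ≟ x
    ... | yes refl = yes ≈-refl
    ... | no h = no (alt-exact 0 h (m-off s x h))
    conjugate? s x p@(y ∷ p') l r rs with y ≟ s
    ... | yes refl = ⊥-elim (1+n≰n (≤-trans (n≤1+n _) (rs p' (≈-sym (ss≈ s p')))))
    ... | no ys with stripping y s n desc p (≤-reflexive l) r
    ...   | inj₁ (strip zero q e k r₀ r₁ r₂) = ⊥-elim (no-head r₁ e k)
      where
        no-head : ∀ {q} → Reduced (y ∷ q) → p ≈ q → length p ≡ length q → ⊥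
        no-head ry e k = 1+n≰n (≤-trans (n≤1+n _) (subst (λ i → suc i ≤ length p') (sym k)
          (ry p' (≈-sym (≈-trans (∷-cong y (≈-sym e)) (ss≈ y p'))))))
    ...   | inj₂ (strip zero q e k r₀ r₁ r₂) = ⊥-elim (1+n≰n (≤-trans (n≤1+n _) (subst (λ i → suc i ≤ length p') (sym k)
          (r₂ p' (≈-sym (≈-trans (∷-cong y (≈-sym e)) (ss≈ y p')))))))
    ...   | inj₂ (strip (suc j) q e k r₀ r₁ r₂) = ⊥-elim (1+n≰n (≤-trans (n≤1+n _) (subst₂ (λ a b → suc a ≤ b) k
          (trans (length-++ (alt j y s)) (cong (_+ length q) (length-alt j y s)))
          (rs (alt j y s ++ q) (≈-sym (≈-trans (∷-cong s e) (ss≈ s _)))))))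
    ...   | inj₁ (strip (suc j) q e k r₀ r₁ r₂) = decide (Maybeₚ.≡-dec Data.Nat._≟_ (m s y) (just (suc (suc j))))
      where
        px≈ : p ++ x ∷ [] ≈ alt (suc j) y s ++ q ++ x ∷ []
        px≈ = ≈-trans (++-congʳ (x ∷ []) e) (≡⇒≈ (++-assoc (alt (suc j) y s) q _))
        too-long : Below (suc (suc (suc j))) s y → ¬ (s ∷ p ≈ p ++ x ∷ [])
        too-long b f = 1+n≰n (≤-trans (n≤1+n _) (subst₂ _≤_ total
            (trans (length-++ p') (+-comm (length p') 1))
            (dihedral-reduced (suc (suc (suc j))) ys (Below-sym b) r₀ r₁ r₂ (p' ++ x ∷ []) (begin
              p' ++ x ∷ []                            ≈⟨ ss≈ y _ ⟨
              y ∷ y ∷ p' ++ x ∷ []                    ≈⟨ ∷-cong y f ⟨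
              y ∷ s ∷ p                               ≈⟨ ∷-cong y (∷-cong s e) ⟩
              y ∷ s ∷ alt (suc j) y s ++ q ∎))))
          where
            open ≈R
            total : length (alt (suc (suc (suc j))) y s ++ q) ≡ suc (suc (suc (length p')))
            total = trans (length-++ (alt (suc (suc (suc j))) y s))
              (trans (cong (_+ length q) (length-alt (suc (suc (suc j))) y s)) (cong (suc ∘ suc) (sym k)))
        decide : Dec (m s y ≡ just (suc (suc j))) → Dec (s ∷ p ≈ p ++ x ∷ [])
        decide (yes f) with alt-snoc (suc j) y s
        ... | z , _ , g = map′ (λ h → ≈-trans sp≈ (≈-trans (++-congˡ (alt (suc j) y s) h) (≈-sym px≈)))
                 (λ h → ++-cancelˡ (alt (suc j) y s) (≈-trans (≈-sym sp≈) (≈-trans h px≈)))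
                 (eq (z ∷ q) (q ++ x ∷ []) short
                   (subst (_≤ n) (sym (trans (length-++ q) (+-comm (length q) 1))) short))
          where
            short : suc (length q) ≤ n
            short = subst (suc (length q) ≤_) (trans (sym k) l) (s≤s (m≤n+m _ j))
            sp≈ : s ∷ p ≈ alt (suc j) y s ++ z ∷ q
            sp≈ = begin
              s ∷ p                            ≈⟨ ∷-cong s e ⟩
              alt (suc (suc j)) s y ++ q       ≈⟨ ++-congʳ q (alt-braid s y _ f) ⟩
              alt (suc (suc j)) y s ++ q       ≡⟨ cong (_++ q) g ⟩
              (alt (suc j) y s ++ z ∷ []) ++ q ≡⟨ ++-assoc (alt (suc j) y s) _ _ ⟩
              alt (suc j) y s ++ z ∷ q ∎
              where open ≈R
        decide (no f) = no (too-long λ i g → ≤∧≢⇒< (bound i g) λ { refl → f g })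
          where
            bound : Below (suc (suc j)) s y
            bound = alt-bounded (suc (suc j)) (ys ∘ sym) (Reduced-prefix (alt (suc (suc j)) s y)
              (Reduced-cong rs (≈-sym (∷-cong s e)) (cong suc (trans (length-++ (alt (suc j) y s))
                (trans (cong (_+ length q) (length-alt (suc j) y s)) (sym k))))))

    eq⁺ : ∀ u v → length u ≤ suc n → length v ≤ suc n → Dec (u ≈ v)
    eq⁺ u v lu lv with normal⁺ u lu | normal⁺ v lv
    ... | u' , eu , ru , lu' | v' , ev , rv , lv' = map′
          (λ e → ≈-trans (≈-sym eu) (≈-trans e ev)) (λ e → ≈-trans eu (≈-trans e (≈-sym ev)))
          (compare u' v' ru rv (≤-trans lu' lu) (≤-trans lv' lv))
      where
        compare : ∀ u v → Reduced u → Reduced v → length u ≤ suc n → length v ≤ suc n → Dec (u ≈ v)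
        compare u v ru rv lu lv with length u Data.Nat.≟ length v | length u ≤? n
        ... | no h | _ = no λ e → h (≤-antisym (ru v (≈-sym e)) (rv u e))
        ... | yes h | yes le = eq u v le (subst (_≤ n) h le)
        compare [] v ru rv lu lv | yes h | no le = ⊥-elim (le z≤n)
        compare (s ∷ u) v ru rv lu lv | yes h | no le with initLast v
        compare (s ∷ u) .[] ru rv lu lv | yes () | no le | []
        compare (s ∷ u) .(p ∷ʳ x) ru rv lu lv | yes h | no le | p ∷ʳ′ x = top
          where
            lp : length p ≡ n
            lp = suc-injective (trans (sym (trans (length-++ p) (+-comm (length p) 1)))
                   (≤-antisym lv (subst (suc n ≤_) h (≰⇒> le))))
            ln : length u ≡ n
            ln = ≤-antisym (s≤s⁻¹ lu) (s≤s⁻¹ (≰⇒> le))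
            rp : Reduced p
            rp = Reduced-prefix p rv
            -- A descent `s` of `p` can be cancelled. Otherwise, when `u ≉ p`, equality would make
            -- `s p x` reduced by exchange, yet equal to the shorter `u`; and when `u ≈ p`, it
            -- remains to compare `s p` with `p x`.
            top : Dec (s ∷ u ≈ p ++ x ∷ [])
            top with desc s p (≤-reflexive lp) rp
            ... | yes (d , δ , e) = map′
                  (λ f → ≈-sym (≈-trans (++-congʳ (x ∷ []) e) (∷-cong s (≈-sym f))))
                  (λ f → ∷-cancel s (≈-trans f (++-congʳ (x ∷ []) e)))
                  (eq u (d ++ x ∷ []) (≤-reflexive ln) (≤-reflexive (trans (length-++ d) (trans (+-comm (length d) 1) (trans (sym (Del-length δ)) lp)))))
            ... | no ¬d with eq u p (≤-reflexive ln) (≤-reflexive lp)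
            ...   | yes e = map′ (≈-trans (∷-cong s e)) (≈-trans (∷-cong s (≈-sym e)))
                              (conjugate? s x p lp rp (¬Desc⇒reduced rp ¬d))
            ...   | no ¬e = no λ f → 1+n≰n (≤-trans (n≤1+n _) (subst₂ (λ a b → suc a ≤ b) (trans (length-++ p) (trans (+-comm (length p) 1) (cong suc lp))) ln
                      (weak-exchange s rv (λ δ g → cases f g (Del-++⁻ p δ)) u (∷-swap s f))))
              where
                cases : ∀ {d} → s ∷ u ≈ p ++ x ∷ [] → s ∷ p ++ x ∷ [] ≈ d →
                  (Σ Word λ d' → Del p d' × d ≡ d' ++ x ∷ []) ⊎ (Σ Word λ d' → Del (x ∷ []) d' × d ≡ p ++ d') → ⊥
                cases f g (inj₁ (d' , δ , refl)) = ¬d (d' , δ , ∷-swap s (++-cancelʳ (x ∷ []) g))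
                cases f g (inj₂ (.[] , here , refl)) = ¬e (≈-trans (∷-swap s f)
                  (≈-trans g (≡⇒≈ (++-identityʳ p))))

  decided : ∀ n → Decided n
  decided zero = record
    { eq = λ { [] [] _ _ → yes ≈-refl }
    ; normal = λ { [] _ → [] , ≈-refl , (λ _ _ → z≤n) , z≤n } }
  decided (suc n) = record { eq = Extend.eq⁺ n (decided n) ; normal = Extend.normal⁺ n (decided n) }

  infix 4 _≈?_
  abstract
    _≈?_ : ∀ u v → Dec (u ≈ v)
    u ≈? v = Decided.eq (decided (length u + length v)) u v (m≤m+n _ _) (m≤n+m _ _)

    normal : ∀ u → Normal u
    normal u = Decided.normal (decided (length u)) u ≤-refl

  ℓ : Word → ℕ
  ℓ u = length (proj₁ (normal u))

-- Length, descents and Bruhat order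

module Bruhat (M : CoxeterMatrix) (no𝒯 : ¬ Coxeter.Contains𝒯 M) where
  open CoxeterMatrix M
  open Coxeter M
  open Words M
  open Tree M no𝒯
  open WordProblem M no𝒯

  nf : Word → Word
  nf u = proj₁ (normal u)

  nf≈ : ∀ u → nf u ≈ u
  nf≈ u = proj₁ (proj₂ (normal u))

  nf-reduced : ∀ u → Reduced (nf u)
  nf-reduced u = proj₁ (proj₂ (proj₂ (normal u)))

  ℓ≤length : ∀ u → ℓ u ≤ length u
  ℓ≤length u = proj₂ (proj₂ (proj₂ (normal u)))

  ℓ-reduced : ∀ {u} → Reduced u → ℓ u ≡ length u
  ℓ-reduced {u} r = ≤-antisym (ℓ≤length u) (r (nf u) (nf≈ u))

  ℓ-cong : ∀ {u v} → u ≈ v → ℓ u ≡ ℓ v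
  ℓ-cong {u} {v} e = ≤-antisym (nf-reduced u (nf v) (≈-trans (nf≈ v) (≈-trans (≈-sym e) (≈-sym (nf≈ u)))))
    (nf-reduced v (nf u) (≈-trans (nf≈ u) (≈-trans e (≈-sym (nf≈ v)))))

  ℓ⇒reduced : ∀ {u} → ℓ u ≡ length u → Reduced u
  ℓ⇒reduced {u} l v e = subst (_≤ length v) (trans (ℓ-cong e) l) (ℓ≤length v)

  ℓ-++≤ : ∀ u v → ℓ (u ++ v) ≤ ℓ u + ℓ v
  ℓ-++≤ u v = subst (_≤ ℓ u + ℓ v) (ℓ-cong (≈-trans (++-congʳ (nf v) (nf≈ u)) (++-congˡ u (nf≈ v))))
    (subst (ℓ (nf u ++ nf v) ≤_) (length-++ (nf u)) (ℓ≤length (nf u ++ nf v)))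

  ℓ-reverse≤ : ∀ u → ℓ (reverse u) ≤ ℓ u
  ℓ-reverse≤ u = subst₂ _≤_ (ℓ-cong (reverse-cong (nf≈ u))) (length-reverse (nf u)) (ℓ≤length (reverse (nf u)))

  ℓ-reverse : ∀ u → ℓ (reverse u) ≡ ℓ u
  ℓ-reverse u = ≤-antisym (ℓ-reverse≤ u)
    (subst (λ z → ℓ z ≤ ℓ (reverse u)) (reverse-involutive u) (ℓ-reverse≤ (reverse u)))

  Reduced-reverse : ∀ {u} → Reduced u → Reduced (reverse u)
  Reduced-reverse {u} r = ℓ⇒reduced (trans (ℓ-reverse u) (trans (ℓ-reduced r) (sym (length-reverse u))))

  desc? : ∀ z p → Reduced p → Dec (Desc z p)
  desc? z p r = del-search p λ {d} _ → p ≈? (z ∷ d)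

  Dsc : S → Word → Set
  Dsc a g = ℓ (a ∷ g) < ℓ g

  Dsc? : ∀ a g → Dec (Dsc a g)
  Dsc? a g = ℓ (a ∷ g) <? ℓ g

  ℓ-∷ : ∀ a g → ℓ (a ∷ g) ≡ suc (ℓ g) ⊎ ℓ g ≡ suc (ℓ (a ∷ g))
  ℓ-∷ a g with desc? a (nf g) (nf-reduced g)
  ... | no h = inj₁ (trans (ℓ-cong (∷-cong a (≈-sym (nf≈ g)))) (ℓ-reduced (¬Desc⇒reduced (nf-reduced g) h)))
  ... | yes D@(d , δ , e) = inj₂ (trans (Del-length δ) (cong suc (sym (trans
          (ℓ-cong (≈-trans (∷-cong a (≈-trans (≈-sym (nf≈ g)) e)) (ss≈ a d))) (ℓ-reduced (Desc-reduced (nf-reduced g) D))))))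

  ℓ-asc : ∀ {a g} → ¬ Dsc a g → ℓ (a ∷ g) ≡ suc (ℓ g)
  ℓ-asc {a} {g} h with ℓ-∷ a g
  ... | inj₁ e = e
  ... | inj₂ e = ⊥-elim (h (≤-reflexive (sym e)))

  ℓ-dsc : ∀ {a g} → Dsc a g → ℓ g ≡ suc (ℓ (a ∷ g))
  ℓ-dsc {a} {g} h with ℓ-∷ a g
  ... | inj₁ e = ⊥-elim (1+n≰n (≤-trans (n≤1+n _) (subst (_< ℓ g) e h)))
  ... | inj₂ e = e

  ℓ-∷-≤ : ∀ a g → ℓ (a ∷ g) ≤ suc (ℓ g)
  ℓ-∷-≤ a g = [ ≤-reflexive , (λ e → ≤-trans (n≤1+n _) (≤-trans (≤-reflexive (sym e)) (n≤1+n _))) ]′ (ℓ-∷ a g)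

  Dsc-cong : ∀ {a g h} → g ≈ h → Dsc a g → Dsc a h
  Dsc-cong {a} e = subst₂ _<_ (ℓ-cong (∷-cong a e)) (ℓ-cong e)

  asc⇒Dsc : ∀ {a g} → ¬ Dsc a g → Dsc a (a ∷ g)
  asc⇒Dsc {a} {g} h = subst₂ _<_ (sym (ℓ-cong (ss≈ a g))) (sym (ℓ-asc h)) ≤-refl

  Dsc⇒asc : ∀ {a g} → Dsc a g → ¬ Dsc a (a ∷ g)
  Dsc⇒asc {a} {g} h k = <-irrefl refl (<-trans h (subst (_< ℓ (a ∷ g)) (ℓ-cong (ss≈ a g)) k))

  reduced⇒asc : ∀ {a g} → Reduced (a ∷ g) → ¬ Dsc a g
  reduced⇒asc {a} {g} r h = 1+n≰n (≤-trans (n≤1+n _) (≤-trans (s≤s (≤-reflexive (sym (ℓ-reduced r))))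
    (≤-trans h (ℓ≤length g))))

  asc⇒reduced : ∀ {a g} → Reduced g → ¬ Dsc a g → Reduced (a ∷ g)
  asc⇒reduced r h = ℓ⇒reduced (trans (ℓ-asc h) (cong suc (ℓ-reduced r)))

  subreduce : ∀ u → Σ Word λ v → v ⊆ u × v ≈ u × Reduced v
  subreduce [] = [] , [] , ≈-refl , λ _ _ → z≤n
  subreduce (x ∷ u) with subreduce u
  ... | v , sub , e , r with desc? x v r
  ...   | no h = x ∷ v , refl ∷ sub , ∷-cong x e , ¬Desc⇒reduced r h
  ...   | yes D@(d , δ , f) = d , Sub._∷ʳ_ x (⊆-trans (Del-⊆ δ) sub) ,
          ≈-trans (≈-sym (≈-trans (∷-cong x f) (ss≈ x d))) (∷-cong x e) , Desc-reduced r D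

  All-⊆ : ∀ {P : S → Set} {u v} → u ⊆ v → All P v → All P u
  All-⊆ [] [] = []
  All-⊆ (x Sub.∷ʳ s) (p ∷ ps) = All-⊆ s ps
  All-⊆ (refl ∷ s) (p ∷ ps) = p ∷ All-⊆ s ps

  ℓ-coset : ∀ (I : S → Set) {q} → (∀ {j} → I j → ¬ Dsc j q) → ∀ x → All I x → ℓ (x ++ q) ≡ ℓ x + ℓ q
  ℓ-coset I {q} h x xs with subreduce x
  ... | y , sub , e , r = begin
      ℓ (x ++ q)                ≡⟨ ℓ-cong (≈-sym (≈-trans (++-congʳ (nf q) e) (++-congˡ x (nf≈ q)))) ⟩
      ℓ (y ++ nf q)             ≡⟨ ℓ-reduced (Cosets.additive I (nf-reduced q)
                                    (λ {j} i → asc⇒reduced (nf-reduced q) (h i ∘ Dsc-cong (nf≈ q))) y (All-⊆ sub xs) r) ⟩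
      length (y ++ nf q)        ≡⟨ length-++ y ⟩
      length y + ℓ q            ≡⟨ cong (_+ ℓ q) (trans (sym (ℓ-reduced r)) (ℓ-cong e)) ⟩
      ℓ x + ℓ q ∎
    where open ≡-Reasoning

  ℓ-alt : ∀ n {a b q} → a ≢ b → Below n a b → ¬ Dsc a q → ¬ Dsc b q → ℓ (alt n a b ++ q) ≡ n + ℓ q
  ℓ-alt n {a} {b} {q} ab bd ha hb = trans
    (ℓ-coset (λ x → x ≡ a ⊎ x ≡ b) (λ { (inj₁ refl) → ha ; (inj₂ refl) → hb }) (alt n a b) (alt-letters n a b))
    (cong (_+ ℓ q) (trans (ℓ-reduced (alt-reduced n ab bd)) (length-alt n a b)))

  record Dihedral (a b : S) (x : Word) : Set where
    constructor dih
    field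
      count : ℕ
      core : Word
      split : x ≈ alt count a b ++ core
      lengths : ℓ x ≡ count + ℓ core
      bounded : Below count a b
      core-a : ¬ Dsc a core
      core-b : ¬ Dsc b core

  dihedral : ∀ {a b} → a ≢ b → ∀ x → Dihedral a b x ⊎ Dihedral b a x
  dihedral {a} {b} ab x with stripping a b (length (nf x)) (λ z p _ → desc? z p) (nf x) ≤-refl (nf-reduced x)
  ... | s = Sum.map (convert ab) (convert (ab ∘ sym)) s
    where
      convert : ∀ {a b} → a ≢ b → Strip a b (nf x) → Dihedral a b x
      convert {a} {b} ab (strip n q e k r₀ r₁ r₂) = dih n q (≈-trans (≈-sym (nf≈ x)) e)
        (trans k (cong (n +_) (sym (ℓ-reduced r₀))))
        (alt-bounded n ab (Reduced-prefix (alt n a b) (Reduced-cong (nf-reduced x) (≈-sym e)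
           (trans (length-++ (alt n a b)) (trans (cong (_+ length q) (length-alt n a b)) (sym k))))))
        (reduced⇒asc r₁) (reduced⇒asc r₂)

  not-longest : ∀ {a b x} → a ≢ b → (d : Dihedral a b x) → Below (suc (Dihedral.count d)) a b → ¬ Dsc b x
  not-longest {a} {b} {x} ab (dih n q e l bd ha hb) bd' h = <-irrefl refl (<-trans h (subst₂ _<_ (sym l)
    (sym (trans (ℓ-cong (∷-cong b e)) (ℓ-alt (suc n) (ab ∘ sym) (Below-sym bd') hb ha))) ≤-refl))

  record Longest (a b : S) (x : Word) : Set where
    constructor longest
    field
      order : ℕ
      m≡ : m a b ≡ just order
      core : Word
      split : x ≈ alt order a b ++ core
      lengths : ℓ x ≡ order + ℓ core
      core-a : ¬ Dsc a core
      core-b : ¬ Dsc b core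

  Longest-sym : ∀ {a b x} → Longest a b x → Longest b a x
  Longest-sym {a} {b} (longest k e y p l ha hb) =
    longest k (trans (m-sym b a) e) y (≈-trans p (++-congʳ y (alt-braid a b k e))) l hb ha

  -- An alternating part shorter than `m a b` is lengthened by the letter with which it does not
  -- begin. So two descents force the longest element, and a finite order.
  two-descents : ∀ {a b x} → a ≢ b → Dsc a x → Dsc b x → Longest a b x
  two-descents {a} {b} {x} ab da db = [ (λ d → go ab d db) , (λ d → Longest-sym (go (ab ∘ sym) d da)) ]′ (dihedral ab x)
    where
      go : ∀ {a b} → a ≢ b → Dihedral a b x → Dsc b x → Longest a b x
      go {a} {b} ab d@(dih n q e l bd ha hb) h = by (m a b) refl
        where
          by : ∀ o → m a b ≡ o → Longest a b x
          by nothing eq = ⊥-elim (not-longest ab d (λ k e → case trans (sym eq) e of λ ()) h)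
          by (just k) eq with k Data.Nat.≟ n
          ... | yes refl = longest k eq q e l ha hb
          ... | no k≢n = ⊥-elim (not-longest ab d (λ k' e' →
                ≤∧≢⇒< (bd k' e') (λ { refl → k≢n (just-injective (trans (sym eq) e')) })) h)

  -- Strong exchange and the subword property

  Par-dec : ∀ t L → Σ Bool (Par t L)
  Par-dec t [] = false , none
  Par-dec t (x ∷ L) with Par-dec t L | x ≈? t
  ... | b , p | yes e = not b , hit e p
  ... | b , p | no e = b , miss e p

  Par-resp : ∀ {t t' L b} → t ≈ t' → Par t L b → Par t' L b
  Par-resp e none = none
  Par-resp e (hit h p) = hit (≈-trans h e) (Par-resp e p)
  Par-resp e (miss h p) = miss (λ q → h (≈-trans q (≈-sym e))) (Par-resp e p)

  -- Passing from `t'` to its conjugate `t` by `a` brings in the letter `a` twice, once on each side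
  -- of `t'`; as `a ≈ t` iff `a ≈ t'`, the two contributions cancel.
  Par-flip : ∀ x s u {b b'} → Par (conjs x (s ∷ [])) (invs (conjs x (s ∷ []) ++ u)) b →
             Par (conjs x (s ∷ [])) (invs u) b' → b ≡ not b'
  Par-flip [] s u p q = Par-∷ s u p q
  Par-flip (a ∷ x) s u {b} {b'} p q = cases (subst (λ w → Par t (invs w) b) (cong (a ∷_) (++-assoc t' (a ∷ []) u)) p)
      (Par-dec t' (invs (a ∷ u)))
    where
      t t' : Word
      t' = conjs x (s ∷ [])
      t = conj a t'
      ih : ∀ {c c'} → Par t (map (conj a) (invs (t' ++ a ∷ u))) c → Par t' (invs (a ∷ u)) c' → c ≡ not c'
      ih r r' = Par-flip x s (a ∷ u) (Par-resp (conj-conj a t') (Par-map⁻ a _ r)) r'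
      eq : ∀ {c} → Par t' (map (conj a) (invs u)) c → c ≡ b'
      eq r = Par-unique ≈-refl (PW.refl ≈-refl) (Par-map⁻ a _ r) q
      up : a ∷ [] ≈ t' → a ∷ [] ≈ t
      up e = ≈-trans (≈-sym (ss≈ a (a ∷ []))) (conj-cong a e)
      down : a ∷ [] ≈ t → a ∷ [] ≈ t'
      down e = ≈-trans (≈-sym (ss≈ a (a ∷ []))) (≈-trans (conj-cong a e) (conj-conj a t'))
      cases : ∀ {b} → Par t (invs (a ∷ t' ++ a ∷ u)) b → Σ Bool (Par t' (invs (a ∷ u))) → b ≡ not b'
      cases (hit h r) (_ , r'@(hit h' w)) = cong not (trans (ih r r') (trans (not-involutive _) (eq w)))
      cases (miss h r) (_ , r'@(miss h' w)) = trans (ih r r') (cong not (eq w))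
      cases (hit h r) (_ , miss h' w) = ⊥-elim (h' (down h))
      cases (miss h r) (_ , hit h' w) = ⊥-elim (h (up h'))

  refl-refl : ∀ x s u → conjs x (s ∷ []) ++ conjs x (s ∷ []) ++ u ≈ u
  refl-refl [] s u = ss≈ s u
  refl-refl (a ∷ x) s u = begin
    (a ∷ t ++ a ∷ []) ++ (a ∷ t ++ a ∷ []) ++ u  ≡⟨ cong (a ∷_) (++-assoc t _ _) ⟩
    a ∷ t ++ a ∷ a ∷ (t ++ a ∷ []) ++ u          ≈⟨ ∷-cong a (++-congˡ t (ss≈ a _)) ⟩
    a ∷ t ++ (t ++ a ∷ []) ++ u                  ≡⟨ cong (λ z → a ∷ t ++ z) (++-assoc t _ _) ⟩
    a ∷ t ++ t ++ a ∷ u                          ≈⟨ ∷-cong a (refl-refl x s (a ∷ u)) ⟩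
    a ∷ a ∷ u                                    ≈⟨ ss≈ a u ⟩
    u ∎
    where
      open ≈R
      t : Word
      t = conjs x (s ∷ [])

  -- If the reflection is even in `u`, it is odd in a reduced word of its product with `u`; deleting
  -- a letter there gives back `u`, so the product is longer.
  strong-exchange : ∀ x s u → (Σ Word λ d → Del u d × reflWord x s ++ u ≈ d) ⊎ ℓ u < ℓ (reflWord x s ++ u)
  strong-exchange x s u = subst (λ t → (Σ Word λ d → Del u d × t ++ u ≈ d) ⊎ ℓ u < ℓ (t ++ u))
      (conjs≡ x (s ∷ [])) (cases (Par-dec t (invs u)) (Par-dec t (invs (t ++ u))) (Par-dec t (invs (nf (t ++ u)))))
    where
      t : Word
      t = conjs x (s ∷ [])
      cases : Σ Bool (Par t (invs u)) → Σ Bool (Par t (invs (t ++ u))) → Σ Bool (Par t (invs (nf (t ++ u)))) →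
              (Σ Word λ d → Del u d × t ++ u ≈ d) ⊎ ℓ u < ℓ (t ++ u)
      cases (true , p) _ _ = inj₁ (invs⇒Del u (Par-true p refl))
      cases (false , p) (_ , q) (_ , r) with invs⇒Del (nf (t ++ u))
        (Par-true r (trans (Par-cong (nf≈ (t ++ u)) r q) (Par-flip x s u q p)))
      ... | d , δ , e = inj₂ (subst₂ _<_ (ℓ-cong d≈u) (sym (Del-length δ)) (s≤s (ℓ≤length d)))
        where
          d≈u : d ≈ u
          d≈u = ≈-trans (≈-sym e) (≈-trans (++-congˡ t (nf≈ (t ++ u))) (refl-refl x s u))

  exchange : ∀ {a u} → Dsc a u → Σ Word λ d → Del u d × a ∷ u ≈ d
  exchange {a} {u} h with strong-exchange [] a u
  ... | inj₁ r = r
  ... | inj₂ lt = ⊥-elim (<-irrefl refl (<-trans h lt))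

  -- A generator outside a set I of generators is the minimal representative of its W_I-coset.
  Dsc⇒∈ : ∀ {j g} → Dsc j g → j ∈ g
  Dsc⇒∈ {j} {g} h with Any.any? (j ≟_) g | exchange h
  ... | yes p | _ = p
  ... | no j∉g | d , δ , e = ⊥-elim (0≢1+n (begin
        0                     ≡⟨ ℓ-reduced {[]} (λ _ _ → z≤n) ⟨
        ℓ []                  ≡⟨ ℓ-cong x≈ ⟨
        ℓ (x ++ j ∷ [])       ≡⟨ ℓ-coset (_∈ g) asc x xs ⟩
        ℓ x + ℓ (j ∷ [])      ≡⟨ cong (ℓ x +_) ℓj ⟩
        ℓ x + 1               ≡⟨ +-comm (ℓ x) 1 ⟩
        suc (ℓ x) ∎))
    where
      open ≡-Reasoning
      x : Word
      x = reverse (d ++ reverse g)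
      xs : All (_∈ g) x
      xs = All-reverse (Allₚ.++⁺ (All-⊆ (Del-⊆ δ) (All.tabulate id)) (All-reverse (All.tabulate id)))
      asc : ∀ {i} → i ∈ g → ¬ Dsc i (j ∷ [])
      asc {i} i∈g = reduced⇒asc (alt-reduced 2 i≢j (m-off i j i≢j))
        where
          i≢j : i ≢ j
          i≢j refl = j∉g i∈g
      ℓj : ℓ (j ∷ []) ≡ 1
      ℓj = trans (ℓ-asc (λ p → case ≤-trans p (ℓ≤length []) of λ ())) (cong suc (ℓ-reduced {[]} (λ _ _ → z≤n)))
      j≈ : j ∷ [] ≈ d ++ reverse g
      j≈ = ++-cancelʳ g (≈-trans e (≈-sym (≈-trans (≡⇒≈ (++-assoc d (reverse g) g))
        (≈-trans (++-congˡ d (≈-trans (≡⇒≈ (cong (reverse g ++_) (sym (++-identityʳ g)))) (rev-cancel g []))) (≡⇒≈ (++-identityʳ d))))))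
      x≈ : x ++ j ∷ [] ≈ []
      x≈ = ≈-trans (++-congˡ x j≈) (≈-trans (≡⇒≈ (cong (x ++_) (sym (++-identityʳ _)))) (rev-cancel (d ++ reverse g) []))

  reduced-support : ∀ {w x} → Reduced w → w ≈ x → All (_∈ x) w
  reduced-support {[]} r e = []
  reduced-support {a ∷ w} {x} r e = a∈x ∷ All.map (λ { (here refl) → a∈x ; (there p) → p }) (reduced-support (Reduced-tail r) (∷-swap a e))
    where
      a∈x : a ∈ x
      a∈x = Dsc⇒∈ (Dsc-cong e (asc⇒Dsc (reduced⇒asc r)))

  Len-ℓ : ∀ x → Len x (ℓ x)
  Len-ℓ x = nf x , nf≈ x , nf-reduced x , refl

  Len⇒ℓ : ∀ {x k} → Len x k → ℓ x ≡ k
  Len⇒ℓ (u , e , r , l) = trans (sym (ℓ-cong e)) (trans (ℓ-reduced r) l)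

  step : ∀ {y z} u s → z ≈ y ++ reflWord u s → ℓ y < ℓ z → BruhatStep y z
  step {y} {z} u s e lt = u , s , e , ℓ y , ℓ z , Len-ℓ y , Len-ℓ z , lt

  step-ℓ : ∀ {y z} → BruhatStep y z → ℓ y < ℓ z
  step-ℓ (_ , _ , _ , _ , _ , l , l' , lt) = subst₂ _<_ (sym (Len⇒ℓ l)) (sym (Len⇒ℓ l')) lt

  step-respʳ : ∀ {y z z'} → z ≈ z' → BruhatStep y z → BruhatStep y z'
  step-respʳ f s@(u , x , e , _) = step u x (≈-trans (≈-sym f) e) (subst (_ <_) (ℓ-cong f) (step-ℓ s))

  ≤B-respʳ : ∀ {x w w'} → w ≈ w' → x ≤B w → x ≤B w'
  ≤B-respʳ f (≤B-refl e) = ≤B-refl (≈-trans e f)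
  ≤B-respʳ f (≤B-step p s) = ≤B-step p (step-respʳ f s)

  ≤B-trans : ∀ {x y z} → x ≤B y → y ≤B z → x ≤B z
  ≤B-trans p (≤B-refl e) = ≤B-respʳ e p
  ≤B-trans p (≤B-step q s) = ≤B-step (≤B-trans p q) s

  -- A reflection `r` on the right of `w` equals the reflection `w r w⁻¹` on the left, to which
  -- strong exchange applies.
  step⇒Del : ∀ {y z w} → BruhatStep y z → w ≈ z → Σ Word λ d → Del w d × y ≈ d
  step⇒Del {y} {z} {w} st@(u , s , e , _) f = cases (strong-exchange (w ++ u) s w)
    where
      tw≈y : reflWord (w ++ u) s ++ w ≈ y
      tw≈y = begin
        ((w ++ u) ++ s ∷ reverse (w ++ u)) ++ w      ≡⟨ cong (λ z → ((w ++ u) ++ s ∷ z) ++ w) (reverse-++ w u) ⟩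
        ((w ++ u) ++ s ∷ reverse u ++ reverse w) ++ w ≡⟨ cong (_++ w) (++-assoc w u _) ⟩
        (w ++ u ++ s ∷ reverse u ++ reverse w) ++ w  ≡⟨ cong (λ z → (w ++ z) ++ w) (sym (++-assoc u (s ∷ reverse u) (reverse w))) ⟩
        (w ++ reflWord u s ++ reverse w) ++ w        ≡⟨ ++-assoc w _ w ⟩
        w ++ (reflWord u s ++ reverse w) ++ w        ≡⟨ cong (w ++_) (++-assoc (reflWord u s) _ w) ⟩
        w ++ reflWord u s ++ reverse w ++ w          ≡⟨ cong (λ z → w ++ reflWord u s ++ reverse w ++ z) (sym (++-identityʳ w)) ⟩
        w ++ reflWord u s ++ reverse w ++ w ++ []    ≈⟨ ++-congˡ w (++-congˡ (reflWord u s) (rev-cancel w [])) ⟩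
        w ++ reflWord u s ++ []                      ≈⟨ ++-congʳ _ (≈-trans f e) ⟩
        (y ++ reflWord u s) ++ reflWord u s ++ []    ≡⟨ ++-assoc y _ _ ⟩
        y ++ reflWord u s ++ reflWord u s ++ []      ≡⟨ cong (λ t → y ++ t ++ t ++ []) (sym (conjs≡ u (s ∷ []))) ⟩
        y ++ conjs u (s ∷ []) ++ conjs u (s ∷ []) ++ [] ≈⟨ ++-congˡ y (refl-refl u s []) ⟩
        y ++ []                                      ≡⟨ ++-identityʳ y ⟩
        y ∎
        where open ≈R
      cases : (Σ Word λ d → Del w d × reflWord (w ++ u) s ++ w ≈ d) ⊎ ℓ w < ℓ (reflWord (w ++ u) s ++ w) →
              Σ Word λ d → Del w d × y ≈ d
      cases (inj₁ (d , δ , g)) = d , δ , ≈-trans (≈-sym tw≈y) g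
      cases (inj₂ lt) = ⊥-elim (<-irrefl refl (<-trans (subst (ℓ w <_) (ℓ-cong tw≈y) lt)
        (subst (ℓ y <_) (sym (ℓ-cong f)) (step-ℓ st))))

  ≤B⇒⊆ : ∀ {x w w'} → x ≤B w → Reduced w' → w' ≈ w → Σ Word λ z → z ⊆ w' × x ≈ z
  ≤B⇒⊆ {w' = w'} (≤B-refl e) r f = w' , ⊆-refl , ≈-trans e (≈-sym f)
  ≤B⇒⊆ (≤B-step p s) r f with step⇒Del s f
  ... | d , δ , e with subreduce d
  ...   | v , sub , g , rv with ≤B⇒⊆ p rv (≈-trans g (≈-sym e))
  ...     | z , sub' , h = z , ⊆-trans sub' (⊆-trans sub (Del-⊆ δ)) , h

  asc⇒≤B : ∀ {s w} → ¬ Dsc s w → w ≤B s ∷ w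
  asc⇒≤B {s} {w} h = ≤B-step (≤B-refl ≈-refl) (step (reverse w) s (begin
      s ∷ w                                  ≈⟨ cancel-rev w (s ∷ w) ⟨
      w ++ reverse w ++ s ∷ w                ≡⟨ cong (λ z → w ++ reverse w ++ s ∷ z) (sym (reverse-involutive w)) ⟩
      w ++ reflWord (reverse w) s ∎) (≤-reflexive (sym (ℓ-asc h))))
    where open ≈R

  -- Along a Bruhat step from `y` to `z`, either `s y` is again shorter than `s z`, or the step is
  -- left multiplication by `s` and `s y ≈ z`.
  lift : ∀ {x y} s → x ≤B y → s ∷ x ≤B s ∷ y ⊎ s ∷ x ≤B y
  lift s (≤B-refl e) = inj₁ (≤B-refl (∷-cong s e))
  lift s (≤B-step {y = y} {z = z} p st@(u , r , e , _)) with lift s p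
  ... | inj₂ q = inj₂ (≤B-step q st)
  ... | inj₁ q with ℓ (s ∷ y) <? ℓ (s ∷ z)
  ...   | yes lt = inj₁ (≤B-step q (step u r (∷-cong s e) lt))
  ...   | no ge = inj₂ (≤B-respʳ sy≈z q)
    where
      sy≈z : s ∷ y ≈ z
      sy≈z with step⇒Del {w = s ∷ nf (s ∷ z)} st (≈-trans (∷-cong s (nf≈ (s ∷ z))) (ss≈ s z))
      ... | _ , here , f = ≈-trans (∷-cong s (≈-trans f (nf≈ (s ∷ z)))) (ss≈ s z)
      ... | _ , there {d = d} δ , f = ⊥-elim (ge (subst₂ _<_ (ℓ-cong (≈-sym (≈-trans (∷-cong s f) (ss≈ s d))))
              (sym (Del-length δ)) (s≤s (ℓ≤length d))))

  ⊆⇒≤B : ∀ {z w} → z ⊆ w → Reduced w → z ≤B w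
  ⊆⇒≤B [] r = ≤B-refl ≈-refl
  ⊆⇒≤B (y Sub.∷ʳ p) r = ≤B-trans (⊆⇒≤B p (Reduced-tail r)) (asc⇒≤B (reduced⇒asc r))
  ⊆⇒≤B {s ∷ z} (refl ∷ p) r with lift s (⊆⇒≤B p (Reduced-tail r))
  ... | inj₁ q = q
  ... | inj₂ q = ≤B-trans q (asc⇒≤B (reduced⇒asc r))

  Dsc-≤B : ∀ {s x u} → Dsc s u → x ≤B u → s ∷ x ≤B u
  Dsc-≤B {s} {x} {u} h p with lift s p
  ... | inj₂ q = q
  ... | inj₁ q = ≤B-trans q (≤B-respʳ (ss≈ s u) (asc⇒≤B (Dsc⇒asc h)))

-- Letters, coatoms and rigidity

module Coatoms (M : CoxeterMatrix) (no𝒯 : ¬ Coxeter.Contains𝒯 M) where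
  open CoxeterMatrix M
  open Coxeter M
  open Words M
  open WordProblem M no𝒯
  open Bruhat M no𝒯

  module _ {A B : Set} where
    remove : ∀ {P : B → Set} {ys} → Any P ys → List B
    remove {ys = y ∷ ys} (here _) = ys
    remove {ys = y ∷ ys} (there p) = y ∷ remove p

    length-remove : ∀ {P : B → Set} {ys} (p : Any P ys) → length ys ≡ suc (length (remove p))
    length-remove (here _) = refl
    length-remove (there p) = cong suc (length-remove p)

    remove-keep : ∀ {P Q : B → Set} {ys} (p : Any P ys) → (∀ y → P y → Q y → ⊥) → Any Q ys → Any Q (remove p)
    remove-keep (here p) h (here q) = ⊥-elim (h _ p q)
    remove-keep (here p) h (there q) = q
    remove-keep (there p) h (here q) = here q
    remove-keep (there p) h (there q) = there (remove-keep p h q)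

    pigeonhole : ∀ (R : A → B → Set) xs ys → AllPairs (λ x x' → ∀ y → R x y → R x' y → ⊥) xs →
                 All (λ x → Any (R x) ys) xs → length xs ≤ length ys
    pigeonhole R [] ys _ _ = z≤n
    pigeonhole R (x ∷ xs) ys (n ∷ ns) (p ∷ ps) = ≤-trans
      (s≤s (pigeonhole R xs (remove p) ns (All.map (λ (h , q) → remove-keep p h q) (All.zip (n , ps)))))
      (≤-reflexive (sym (length-remove p)))

  Distinct : List Word → Set
  Distinct = AllPairs (λ a b → ¬ (a ≈ b))

  cover-length : ∀ {xs ys} → Distinct xs → All (λ x → Any (x ≈_) ys) xs → length xs ≤ length ys
  cover-length d c = pigeonhole _≈_ _ _ (AllPairs.map (λ n y p q → n (≈-trans p (≈-sym q))) d) c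

  supp : Word → ℕ
  supp w = length (deduplicate _≟_ w)

  supp-≤ : ∀ {w} L → All (_∈ L) w → supp w ≤ length L
  supp-≤ {w} L h = pigeonhole _≡_ _ L (AllPairs.map (λ n y p q → n (trans p (sym q))) (deduplicate-! _≟_ w))
    (All.tabulate λ p → All.lookup h (∈-deduplicate⁻ _≟_ w p))

  -- Minimal coset representatives

  -- Membership in `W^J`, with `J` the set of letters other than `s`: such `v` are the shortest
  -- elements of their cosets `v W_J`.
  MinR : S → Word → Set
  MinR s v = ∀ j → j ≢ s → ℓ v < ℓ (v ++ j ∷ [])

  reverse-∷ʳ : ∀ (v : Word) j → reverse (v ++ j ∷ []) ≡ j ∷ reverse v
  reverse-∷ʳ v j = reverse-++ v (j ∷ [])

  ℓ-∷ʳ : ∀ v j → ℓ (v ++ j ∷ []) ≡ ℓ (j ∷ reverse v)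
  ℓ-∷ʳ v j = trans (sym (ℓ-reverse (v ++ j ∷ []))) (cong ℓ (reverse-∷ʳ v j))

  ℓ-∷ʳ-≯ : ∀ v j → ¬ (ℓ v < ℓ (v ++ j ∷ [])) → ℓ (v ++ j ∷ []) < ℓ v
  ℓ-∷ʳ-≯ v j h with ℓ-∷ j (reverse v)
  ... | inj₁ e = ⊥-elim (h (≤-reflexive (sym (trans (ℓ-∷ʳ v j) (trans e (cong suc (ℓ-reverse v)))))))
  ... | inj₂ e = ≤-reflexive (trans (cong suc (ℓ-∷ʳ v j)) (trans (sym e) (ℓ-reverse v)))

  MinR-cong : ∀ {s v v'} → v ≈ v' → MinR s v → MinR s v'
  MinR-cong e h j n = subst₂ _<_ (ℓ-cong e) (ℓ-cong (++-congʳ (j ∷ []) e)) (h j n)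

  MinR-++ : ∀ {s v x} → MinR s v → All (_≢ s) x → ℓ (v ++ x) ≡ ℓ v + ℓ x
  MinR-++ {s} {v} {x} h xs = begin
    ℓ (v ++ x)                     ≡⟨ ℓ-reverse (v ++ x) ⟨
    ℓ (reverse (v ++ x))           ≡⟨ cong ℓ (reverse-++ v x) ⟩
    ℓ (reverse x ++ reverse v)     ≡⟨ ℓ-coset (_≢ s) (λ {j} n d → <-irrefl refl (<-trans (h j n)
                                        (subst₂ _<_ (sym (ℓ-∷ʳ v j)) (ℓ-reverse v) d))) (reverse x) (All-reverse xs) ⟩
    ℓ (reverse x) + ℓ (reverse v)  ≡⟨ cong₂ _+_ (ℓ-reverse x) (ℓ-reverse v) ⟩
    ℓ x + ℓ v                      ≡⟨ +-comm (ℓ x) (ℓ v) ⟩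
    ℓ v + ℓ x ∎
    where open ≡-Reasoning

  MinR-tail : ∀ {s a v} → MinR s (a ∷ v) → ¬ Dsc a v → MinR s v
  MinR-tail {s} {a} {v} h na j n = s≤s⁻¹ (≤-trans (s≤s (≤-trans (≤-reflexive (sym (ℓ-asc na))) ≤-refl))
    (≤-trans (h j n) (ℓ-∷-≤ a (v ++ j ∷ []))))

  exchangeʳ : ∀ {u j} → ℓ (u ++ j ∷ []) < ℓ u → Σ Word λ d → Del u d × u ++ j ∷ [] ≈ d
  exchangeʳ {u} {j} h = step⇒Del (step [] j (≈-sym (≈-trans (≡⇒≈ (++-assoc u _ _))
    (≈-trans (++-congˡ u (ss≈ j [])) (≡⇒≈ (++-identityʳ u))))) h) ≈-refl

  right-descent? : ∀ s g → Dec (Σ S λ j → j ≢ s × ℓ (g ++ j ∷ []) < ℓ g)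
  right-descent? s g = any? λ j → ¬? (j ≟ s) ×-dec (ℓ (g ++ j ∷ []) <? ℓ g)

  no-right-descent⇒MinR : ∀ {s g} → ¬ (Σ S λ j → j ≢ s × ℓ (g ++ j ∷ []) < ℓ g) → MinR s g
  no-right-descent⇒MinR {s} {g} h j n with ℓ g <? ℓ (g ++ j ∷ [])
  ... | yes p = p
  ... | no p = ⊥-elim (h (j , n , ℓ-∷ʳ-≯ g j p))

  -- Deodhar's lemma. A right descent `j` of `a v` deletes a letter; deleting one from `v` would
  -- make `v j` shorter than `v`, so it deletes `a` and `a v j ≈ v`.
  deodhar : ∀ {s v} a → MinR s v → ¬ Dsc a v → MinR s (a ∷ v) ⊎ (Σ S λ j → j ≢ s × a ∷ v ≈ v ++ j ∷ [])
  deodhar {s} {v} a h na with right-descent? s (a ∷ nf v)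
  ... | no p = inj₁ (MinR-cong (∷-cong a (nf≈ v)) (no-right-descent⇒MinR p))
  ... | yes (j , n , lt) with exchangeʳ lt
  ...   | _ , here , e = inj₂ (j , n , ++-swap j (≈-trans (∷-cong a (++-congʳ _ (≈-sym (nf≈ v)))) (≈-trans e (nf≈ v))))
  ...   | _ , there {d = d} δ , e = ⊥-elim (<-irrefl refl (<-trans (h j n)
            (subst₂ _<_ (ℓ-cong (≈-trans (≈-sym (∷-cancel a e)) (++-congʳ (j ∷ []) (nf≈ v)))) (sym (Del-length δ)) (s≤s (ℓ≤length d)))))

  ℓ≡0 : ∀ {u} → ℓ u ≡ 0 → u ≈ []
  ℓ≡0 {u} e = go (nf u) e (nf≈ u)
    where
      go : ∀ x → length x ≡ 0 → x ≈ u → u ≈ []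
      go [] _ p = ≈-sym p

  -- Each of `v`, `v'` is the other times an element of `W_J`, with lengths adding in both
  -- directions, so that element is trivial.
  MinR-unique : ∀ {s v v' x x'} → MinR s v → MinR s v' → All (_≢ s) x → All (_≢ s) x' →
                v ++ x ≈ v' ++ x' → v ≈ v' × x ≈ x'
  MinR-unique {s} {v} {v'} {x} {x'} h h' xs xs' e = v≈v' , ++-cancelˡ v' (≈-trans (++-congʳ x (≈-sym v≈v')) e)
    where
      move : ∀ {v v' x x'} → v ++ x ≈ v' ++ x' → v ≈ v' ++ x' ++ reverse x
      move {v} {v'} {x} {x'} e = ++-cancelʳ x (≈-trans e (≈-sym (begin
        (v' ++ x' ++ reverse x) ++ x         ≡⟨ trans (++-assoc v' _ _) (cong (v' ++_) (++-assoc x' _ _)) ⟩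
        v' ++ x' ++ reverse x ++ x           ≡⟨ cong (λ z → v' ++ x' ++ reverse x ++ z) (sym (++-identityʳ x)) ⟩
        v' ++ x' ++ reverse x ++ x ++ []     ≈⟨ ++-congˡ v' (++-congˡ x' (rev-cancel x [])) ⟩
        v' ++ x' ++ []                       ≡⟨ cong (v' ++_) (++-identityʳ x') ⟩
        v' ++ x' ∎)))
        where open ≈R
      d d' : Word
      d = x' ++ reverse x
      d' = x ++ reverse x'
      l : ℓ v ≡ ℓ v' + ℓ d
      l = trans (ℓ-cong (move {v} {v'} {x} {x'} e)) (MinR-++ h' (Allₚ.++⁺ xs' (All-reverse xs)))
      l' : ℓ v' ≡ ℓ v + ℓ d'
      l' = trans (ℓ-cong (move {v'} {v} {x'} {x} (≈-sym e))) (MinR-++ h (Allₚ.++⁺ xs (All-reverse xs')))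
      zero-sum : ∀ a b c d → a ≡ b + c → b ≡ a + d → c ≡ 0
      zero-sum a b c d p q = +-cancelˡ-≡ b c 0 (trans (sym p) (trans (≤-antisym
        (≤-trans (m≤m+n a d) (≤-reflexive (sym q))) (≤-trans (m≤m+n b c) (≤-reflexive (sym p)))) (sym (+-identityʳ b))))
      v≈v' : v ≈ v'
      v≈v' = ≈-trans (move {v} {v'} {x} {x'} e) (≈-trans (++-congˡ v' (ℓ≡0 {d} (zero-sum _ _ _ _ l l'))) (≡⇒≈ (++-identityʳ v')))

  -- Parabolic decomposition

  factor : ∀ s g → Reduced g → Σ Word λ v → Σ Word λ y →
           g ≈ v ++ y × MinR s v × All (_≢ s) y × length g ≡ length v + length y
  factor s g r = go (length g) g r ≤-refl
    where
      go : ∀ n g → Reduced g → length g ≤ n → Σ Word λ v → Σ Word λ y →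
           g ≈ v ++ y × MinR s v × All (_≢ s) y × length g ≡ length v + length y
      go n g r le with right-descent? s g
      ... | no h = g , [] , ≡⇒≈ (sym (++-identityʳ g)) , no-right-descent⇒MinR h , [] , sym (+-identityʳ _)
      ... | yes (j , j≢s , lt) with exchangeʳ lt
      go zero [] r le | yes (j , j≢s , lt) | _ , () , _
      go (suc n) g r le | yes (j , j≢s , lt) | d , δ , e
        with go n d (Reduced-prefix d (Reduced-cong r (≈-sym (++-swap j e)) (trans (length-++ d) (trans (+-comm (length d) 1) (sym (Del-length δ))))))
                (s≤s⁻¹ (subst (_≤ suc n) (Del-length δ) le))
      ... | v , y , f , mv , ys , l = v , y ++ j ∷ [] ,
            ≈-trans (++-swap j e) (≈-trans (++-congʳ (j ∷ []) f) (≡⇒≈ (++-assoc v y _))) , mv , Allₚ.++⁺ ys (j≢s ∷ []) ,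
            trans (Del-length δ) (trans (cong suc l) (trans (sym (+-suc (length v) (length y)))
              (cong (length v +_) (sym (trans (length-++ y) (+-comm (length y) 1))))))

  last-letters : ∀ a w → Σ Word λ w₁ → Σ S λ s → Σ Word λ w₂ →
                 a ∷ w ≡ w₁ ++ s ∷ w₂ × All (_≢ s) w₂ × All (_∈ s ∷ w₂) (a ∷ w)
  last-letters a w with Any.any? (a ≟_) w
  ... | no h = [] , a , w , refl , All.tabulate (λ p e → h (Any.map (λ { refl → sym e }) p)) , here refl ∷ All.tabulate there
  last-letters a (b ∷ w) | yes p with last-letters b w
  ... | w₁ , s , w₂ , e , n , c = a ∷ w₁ , s , w₂ , cong (a ∷_) e , n , All.lookup c p ∷ c

  record Decomposition (w : Word) : Set where
    field
      s first : S
      rest u : Word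
      w≈ : w ≈ first ∷ rest ++ u
      lengths : length w ≡ length (first ∷ rest ++ u)
      min : MinR s (first ∷ rest)
      u≢s : All (_≢ s) u
      letters : All (_∈ s ∷ u) w

  decompose : ∀ {w} → w ≢ [] → Reduced w → Decomposition w
  decompose {[]} n r = ⊥-elim (n refl)
  decompose {a ∷ w} _ r with last-letters a w
  ... | w₁ , s , w₂ , e , n , c with factor s (w₁ ++ s ∷ []) (Reduced-prefix (w₁ ++ s ∷ []) (subst Reduced (trans e (sym (++-assoc w₁ _ _))) r))
  -- The minimal part cannot be empty: `s` occurs in the reduced word, but neither in `y` nor in
  -- `w₂`.
  ...   | [] , y , f , mv , ys , l = ⊥-elim (lookup-≢ (All.lookup (reduced-support {x = y ++ w₂} r
              (≈-trans (≡⇒≈ (trans e (sym (++-assoc w₁ (s ∷ []) w₂)))) (++-congʳ w₂ f))) (subst (s ∈_) (sym e) (∈-++⁺ʳ w₁ (here refl)))))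
    where
      lookup-≢ : s ∈ y ++ w₂ → ⊥
      lookup-≢ p = All.lookup (Allₚ.++⁺ ys n) p refl
  ...   | x ∷ v , y , f , mv , ys , l = record
    { s = s ; first = x ; rest = v ; u = y ++ w₂
    ; w≈ = ≈-trans (≡⇒≈ (trans e (sym (++-assoc w₁ (s ∷ []) w₂)))) (≈-trans (++-congʳ w₂ f) (≡⇒≈ (++-assoc (x ∷ v) y w₂)))
    ; lengths = trans (cong length (trans e (sym (++-assoc w₁ (s ∷ []) w₂)))) (trans (length-++ (w₁ ++ s ∷ []))
        (trans (cong (_+ length w₂) (trans l (sym (length-++ (x ∷ v))))) (trans (sym (length-++ (x ∷ v ++ y))) (cong length (++-assoc (x ∷ v) y w₂)))))
    ; min = mv
    ; u≢s = Allₚ.++⁺ ys n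
    ; letters = All.map (λ { (here p) → here p ; (there p) → there (∈-++⁺ʳ y p) }) c
    }

  Coatom : Word → Word → Set
  Coatom w x = x ≤B w × ℓ w ≡ suc (ℓ x)

  Coatom-cong : ∀ {w w' x} → w ≈ w' → Coatom w x → Coatom w' x
  Coatom-cong e (p , l) = ≤B-respʳ e p , trans (sym (ℓ-cong e)) l

  AtMost : ℕ → Word → Set
  AtMost n w = ∀ L → Distinct L → All (Coatom w) L → length L ≤ n

  Del-coatom : ∀ {w d} → Reduced w → Del w d → Reduced d → Coatom w d
  Del-coatom r δ rd = ⊆⇒≤B (Del-⊆ δ) r , trans (ℓ-reduced r) (trans (Del-length δ) (cong suc (sym (ℓ-reduced rd))))

  module Fibre {s v u} (mv : MinR s v) (us : All (_≢ s) u) (r : Reduced (v ++ u)) where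

    private
      ru : Reduced u
      ru = Reduced-suffix v r

    lower-letters : ∀ {c} → c ≤B u → Σ Word λ z → All (_≢ s) z × z ⊆ u × c ≈ z
    lower-letters p with ≤B⇒⊆ p ru ≈-refl
    ... | z , sub , e = z , All-⊆ sub us , sub , e

    fibre-coatom : ∀ {c} → Coatom u c → Coatom (v ++ u) (v ++ c)
    fibre-coatom {c} (p , l) with lower-letters p
    ... | z , zs , sub , e = ≤B-trans (≤B-refl (++-congˡ v e)) (⊆⇒≤B (keep v sub) r) , (begin
        ℓ (v ++ u)        ≡⟨ MinR-++ mv us ⟩
        ℓ v + ℓ u         ≡⟨ cong (ℓ v +_) l ⟩
        ℓ v + suc (ℓ c)   ≡⟨ +-suc (ℓ v) (ℓ c) ⟩
        suc (ℓ v + ℓ c)   ≡⟨ cong (λ n → suc (ℓ v + n)) (ℓ-cong e) ⟩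
        suc (ℓ v + ℓ z)   ≡⟨ cong suc (MinR-++ mv zs) ⟨
        suc (ℓ (v ++ z))  ≡⟨ cong suc (ℓ-cong (++-congˡ v (≈-sym e))) ⟩
        suc (ℓ (v ++ c)) ∎)
      where
        open ≡-Reasoning
        keep : ∀ v {z u : Word} → z ⊆ u → v ++ z ⊆ v ++ u
        keep [] p = p
        keep (x ∷ v) p = refl ∷ keep v p

    -- Cancelling `u` would put `d` into the coset `v W_J`, which has no element shorter than `v`.
    fibre-distinct : ∀ {d c} → ℓ d < ℓ v → Coatom u c → ¬ (d ++ u ≈ v ++ c)
    fibre-distinct {d} {c} lt (p , _) e with lower-letters p
    ... | z , zs , sub , f = <-irrefl refl (<-≤-trans lt (≤-trans (m≤m+n _ _) (≤-reflexive (sym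
          (trans (ℓ-cong d≈) (MinR-++ mv (Allₚ.++⁺ zs (All-reverse us))))))))
      where
        d≈ : d ≈ v ++ z ++ reverse u
        d≈ = ++-cancelʳ u (≈-trans e (≈-trans (++-congˡ v f) (≈-sym (begin
          (v ++ z ++ reverse u) ++ u       ≡⟨ trans (++-assoc v _ _) (cong (v ++_) (++-assoc z _ _)) ⟩
          v ++ z ++ reverse u ++ u         ≡⟨ cong (λ x → v ++ z ++ reverse u ++ x) (sym (++-identityʳ u)) ⟩
          v ++ z ++ reverse u ++ u ++ []   ≈⟨ ++-congˡ v (++-congˡ z (rev-cancel u [])) ⟩
          v ++ z ++ []                     ≡⟨ cong (v ++_) (++-identityʳ z) ⟩
          v ++ z ∎))))
          where open ≈R

    fibre-list : ∀ {L} → Distinct L → Distinct (map (v ++_) L)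
    fibre-list ds = AllPairsₚ.map⁺ (AllPairs.map (λ n e → n (++-cancelˡ v e)) ds)

  support-≤ : ∀ {w} (D : Decomposition w) → supp w ≤ suc (supp (Decomposition.u D))
  support-≤ {w} D = supp-≤ (s ∷ deduplicate _≟_ u)
      (All.map (λ { (here p) → here p ; (there p) → there (∈-deduplicate⁺ _≟_ p) }) letters)
    where open Decomposition D

  -- The coatoms of `u`, multiplied by `v`, pay for the letters of `u`; deleting the first letter of
  -- `v` gives one more, which pays for `s`.
  coatoms : ∀ n w → length w ≤ n → Reduced w → Σ (List Word) λ L → Distinct L × All (Coatom w) L × supp w ≤ length L
  coatoms n [] le r = [] , [] , [] , z≤n
  coatoms (suc n) w@(_ ∷ _) le r = result (coatoms n u (s≤s⁻¹ (≤-trans (subst (suc (length u) ≤_) (sym lengths)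
        (s≤s (≤-trans (m≤n+m _ (length rest)) (≤-reflexive (sym (length-++ rest)))))) le)) (Reduced-suffix (first ∷ rest) r'))
    where
      D : Decomposition w
      D = decompose (λ ()) r
      open Decomposition D
      r' : Reduced (first ∷ rest ++ u)
      r' = Reduced-cong r (≈-sym w≈) (sym lengths)
      open Fibre {v = first ∷ rest} min u≢s r'
      result : (Σ (List Word) λ L → Distinct L × All (Coatom u) L × supp u ≤ length L) →
               Σ (List Word) λ L → Distinct L × All (Coatom w) L × supp w ≤ length L
      result (L , ds , cs , le') = (rest ++ u) ∷ map ((first ∷ rest) ++_) L ,
        Allₚ.map⁺ (All.map (λ c → fibre-distinct {d = rest} lt c) cs) ∷ fibre-list ds ,
        Coatom-cong (≈-sym w≈) (Del-coatom r' here (Reduced-tail r')) ∷ Allₚ.map⁺ (All.map (Coatom-cong (≈-sym w≈) ∘ fibre-coatom) cs) ,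
        ≤-trans (support-≤ D) (s≤s (subst (supp u ≤_) (sym (length-map _ L)) le'))
        where
          lt : ℓ rest < ℓ (first ∷ rest)
          lt = ≤-reflexive (sym (ℓ-asc (reduced⇒asc (Reduced-prefix (first ∷ rest) r'))))

  Rigid : Word → Word → Set
  Rigid v u = ∀ {x v' d} → v ≈ x ∷ v' → length v ≡ suc (length v') → Del v' d → ¬ Reduced (x ∷ d ++ u)

  module Tight {w} (r : Reduced w) (h : AtMost (supp w) w) (D : Decomposition w) where
    open Decomposition D

    r' : Reduced (first ∷ rest ++ u)
    r' = Reduced-cong r (≈-sym w≈) (sym lengths)

    open Fibre {v = first ∷ rest} min u≢s r'

    u-tight : AtMost (supp u) u
    u-tight L ds cs = s≤s⁻¹ (≤-trans (s≤s (≤-reflexive (sym (length-map ((first ∷ rest) ++_) L))))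
      (≤-trans (h ((rest ++ u) ∷ map ((first ∷ rest) ++_) L)
          (Allₚ.map⁺ (All.map (λ c → fibre-distinct {d = rest} lt c) cs) ∷ fibre-list ds)
          (Coatom-cong (≈-sym w≈) (Del-coatom r' here (Reduced-tail r')) ∷ Allₚ.map⁺ (All.map (Coatom-cong (≈-sym w≈) ∘ fibre-coatom) cs)))
        (support-≤ D)))
      where
        lt : ℓ rest < ℓ (first ∷ rest)
        lt = ≤-reflexive (sym (ℓ-asc (reduced⇒asc (Reduced-prefix (first ∷ rest) r'))))

    -- The deletion would be a second coatom outside the fibre over `u`, one more than there are
    -- letters to pay for.
    rigid : Rigid (first ∷ rest) u
    rigid {x} {v'} {d} e l δ rd with coatoms (length u) u ≤-refl (Reduced-suffix (first ∷ rest) r')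
    ... | L , ds , cs , le = 1+n≰n (≤-trans (s≤s (s≤s le)) (≤-trans (≤-trans (s≤s (s≤s (≤-reflexive (sym (length-map (v ++_) L)))))
          (h ((v' ++ u) ∷ (x ∷ d ++ u) ∷ map (v ++_) L)
            ((n₀ ∷ Allₚ.map⁺ (All.map (F.fibre-distinct {d = v'} lt) cs)) ∷ Allₚ.map⁺ (All.map (F.fibre-distinct {d = x ∷ d} lt') cs) ∷ F.fibre-list ds)
            (back (Del-coatom rv here (Reduced-tail rv)) ∷ back (Del-coatom rv (there (Del-++ˡ u δ)) rd) ∷ Allₚ.map⁺ (All.map (back ∘ F.fibre-coatom) cs))))
          (support-≤ D)))
      where
        v : Word
        v = x ∷ v'
        rv : Reduced (v ++ u)
        rv = Reduced-cong r' (++-congʳ u (≈-sym e)) (trans (length-++ v) (trans (cong (_+ length u) (sym l)) (sym (length-++ (first ∷ rest)))))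
        module F = Fibre {v = v} (MinR-cong e min) u≢s rv
        back : ∀ {c} → Coatom (v ++ u) c → Coatom w c
        back = Coatom-cong (≈-trans (++-congʳ u (≈-sym e)) (≈-sym w≈))
        ℓv : ℓ v ≡ suc (length v')
        ℓv = ℓ-reduced (Reduced-prefix v rv)
        lt : ℓ v' < ℓ v
        lt = subst (ℓ v' <_) (sym ℓv) (s≤s (ℓ≤length v'))
        lt' : ℓ (x ∷ d) < ℓ v
        lt' = subst (ℓ (x ∷ d) <_) (sym ℓv) (s≤s (subst (ℓ (x ∷ d) ≤_) (sym (Del-length δ)) (ℓ≤length (x ∷ d))))
        n₀ : ¬ (v' ++ u ≈ x ∷ d ++ u)
        n₀ f = 1+n≰n (≤-trans (n≤1+n _) (subst (λ n → suc n ≤ length d) (Del-length δ) (Reduced-prefix v rv d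
          (≈-sym (≈-trans (∷-cong x (++-cancelʳ u f)) (ss≈ x d))))))

-- Descents in triangles of non-commuting letters

module Triangles (M : CoxeterMatrix) (no𝒯 : ¬ Coxeter.Contains𝒯 M) where
  open CoxeterMatrix M
  open Coxeter M
  open Words M
  open Tree M no𝒯 using (Below)
  open WordProblem M no𝒯
  open Bruhat M no𝒯

  NC : S → S → Set
  NC a b = a ≢ b × m a b ≢ just 2

  NC-sym : ∀ {a b} → NC a b → NC b a
  NC-sym {a} {b} (n , h) = n ∘ sym , h ∘ trans (m-sym a b)

  NC-≥3 : ∀ {a b k} → NC a b → m a b ≡ just k → 3 ≤ k
  NC-≥3 {a} {b} {k} (n , h) e = ≤∧≢⇒< (m-off a b n k e) (λ { refl → h e })

  NC-cases : ∀ {a b} → NC a b → m a b ≡ nothing ⊎ (Σ ℕ λ k → m a b ≡ just k × 3 ≤ k)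
  NC-cases {a} {b} nc = go (m a b) refl
    where
      go : ∀ o → m a b ≡ o → m a b ≡ nothing ⊎ (Σ ℕ λ k → m a b ≡ just k × 3 ≤ k)
      go nothing e = inj₁ e
      go (just k) e = inj₂ (k , e , NC-≥3 nc e)

  m≟2 : ∀ a b → Dec (m a b ≡ just 2)
  m≟2 a b = Maybeₚ.≡-dec Data.Nat._≟_ (m a b) (just 2)

  Tri : S → S → S → Set
  Tri a b c = NC a b × NC a c × NC b c

  rot : ∀ {a b c} → Tri a b c → Tri b c a
  rot (ab , ac , bc) = bc , NC-sym ab , NC-sym ac

  flip : ∀ {a b c} → Tri a b c → Tri a c b
  flip (ab , ac , bc) = ac , ab , NC-sym bc

  alt-Dsc : ∀ j {a b y} → a ≢ b → Below (suc j) a b → ¬ Dsc a y → ¬ Dsc b y → Dsc a (alt (suc j) a b ++ y)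
  alt-Dsc j {a} {b} {y} ab bd ha hb = subst₂ _<_
    (sym (trans (ℓ-cong (ss≈ a _)) (ℓ-alt j (ab ∘ sym) (Below-sym (Below-≤ (n≤1+n j) bd)) hb ha)))
    (sym (ℓ-alt (suc j) ab bd ha hb)) ≤-refl

  order-Below : ∀ {a b k j} → m a b ≡ just k → j ≤ k → Below j a b
  order-Below e le k' e' with refl ← just-injective (trans (sym e) e') = le

  -- By `two-descents`, `x` begins with the longest element of the dihedral group. Removing one, two
  -- or three of its letters leaves a nonempty alternating word if the order is at least 2, 3 or 4,
  -- and its first letter is a descent.
  module _ {a b x} (ab : a ≢ b) (da : Dsc a x) (db : Dsc b x) where

    peel₁ : Dsc b (a ∷ x)
    peel₁ = go (two-descents ab da db)
      where
        go : Longest a b x → Dsc b (a ∷ x)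
        go (longest k e y p l ha hb) with m-off a b ab k e
        ... | s≤s (s≤s {n = j} _) = Dsc-cong (≈-sym (≈-trans (∷-cong a p) (ss≈ a _)))
                (alt-Dsc j (ab ∘ sym) (Below-sym (order-Below e (n≤1+n _))) hb ha)

    peel₂ : NC a b → Dsc a (b ∷ a ∷ x)
    peel₂ nc = go (two-descents ab da db)
      where
        go : Longest a b x → Dsc a (b ∷ a ∷ x)
        go (longest k e y p l ha hb) with NC-≥3 nc e
        ... | s≤s (s≤s (s≤s {n = j} _)) = Dsc-cong
                (≈-sym (≈-trans (∷-cong b (≈-trans (∷-cong a p) (ss≈ a _))) (ss≈ b _)))
                (alt-Dsc j ab (order-Below e (≤-trans (n≤1+n _) (n≤1+n _))) ha hb)

    peel₃ : ∀ {k} → m a b ≡ just (4 + k) → Dsc b (a ∷ b ∷ a ∷ x)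
    peel₃ {k} e' = go (two-descents ab da db)
      where
        go : Longest a b x → Dsc b (a ∷ b ∷ a ∷ x)
        go (longest _ e y p l ha hb) with refl ← just-injective (trans (sym e) e') = Dsc-cong
                (≈-sym (≈-trans (∷-cong a (≈-trans (∷-cong b (≈-trans (∷-cong a p) (ss≈ a _))) (ss≈ b _))) (ss≈ a _)))
                (alt-Dsc k (ab ∘ sym) (Below-sym (order-Below e (≤-trans (n≤1+n _) (≤-trans (n≤1+n _) (n≤1+n _))))) hb ha)

  -- If a were a descent of c x, the situation would repeat for c x with the letters rotated, and so
  -- on for ever.
  third-ascent : ∀ {a b c} → Tri a b c → ∀ {x} → Dsc b x → Dsc c x → ¬ Dsc a (c ∷ x)
  third-ascent t {x} = go (suc (ℓ x)) t ≤-refl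
    where
      go : ∀ n {a b c} → Tri a b c → ∀ {x} → ℓ x < n → Dsc b x → Dsc c x → ¬ Dsc a (c ∷ x)
      go (suc n) t@(_ , _ , bc) lt db dc da = go n (rot (rot t)) (<-≤-trans dc (s≤s⁻¹ lt)) da
        (peel₁ (proj₁ (NC-sym bc)) dc db) (peel₂ (proj₁ (NC-sym bc)) dc db (NC-sym bc))

  no-three-descents : ∀ {a b c} → Tri a b c → ∀ {x} → Dsc a x → Dsc b x → ¬ Dsc c x
  no-three-descents t@(_ , ac , _) da db dc = third-ascent t db dc (peel₁ (proj₁ (NC-sym ac)) dc da)

  record Step (p r : S) (G : Word) : Set where
    field
      ascent : ¬ Dsc r G
      grows : ℓ (p ∷ r ∷ G) ≡ 2 + ℓ G
      descent-p : Dsc p (p ∷ r ∷ G)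
      descent-r : Dsc r (p ∷ r ∷ G)

  -- `p r G` is `p r p` in front of `p G`, which neither `p` nor `r` shortens. The descents thus
  -- turn from `p`, `q` to `p`, `r`, and the step can be repeated with another pair.
  spiral-step : ∀ {p q r} → Tri p q r → m p r ≡ just 3 → ∀ {G} → Dsc p G → Dsc q G → Step p r G
  spiral-step {p} {q} {r} t@(_ , (pr , _) , _) e {G} dp dq = record
      { ascent = no-three-descents t dp dq
      ; grows = trans (ℓ-cong G≈) (trans (ℓ-alt 3 pr bd hp hr) (cong (2 +_) (sym (ℓ-dsc dp))))
      ; descent-p = Dsc-cong (≈-sym G≈) (alt-Dsc 2 pr bd hp hr)
      ; descent-r = Dsc-cong (≈-trans (++-congʳ (p ∷ G) (≈-sym (alt-braid p r 3 e))) (≈-sym G≈)) (alt-Dsc 2 (pr ∘ sym) (Below-sym bd) hr hp)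
      }
    where
      bd : Below 3 p r
      bd = order-Below e ≤-refl
      G≈ : p ∷ r ∷ G ≈ alt 3 p r ++ p ∷ G
      G≈ = ∷-cong p (∷-cong r (≈-sym (ss≈ p G)))
      hp : ¬ Dsc p (p ∷ G)
      hp = Dsc⇒asc dp
      hr : ¬ Dsc r (p ∷ G)
      hr = third-ascent (flip (rot (rot t))) dq dp

  -- Alternating words with prescribed last letter `b`: prefixes of `v` grow on the right, and
  -- elements of `W^J` other than the identity end in `s`.
  E : ℕ → S → S → Word
  E zero a b = []
  E (suc n) a b = E n b a ++ b ∷ []

  E≡reverse : ∀ n a b → E n a b ≡ reverse (alt n b a)
  E≡reverse zero a b = refl
  E≡reverse (suc n) a b = trans (cong (_++ b ∷ []) (E≡reverse n b a)) (sym (unfold-reverse b (alt n a b)))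

  length-E : ∀ n a b → length (E n a b) ≡ n
  length-E n a b = trans (cong length (E≡reverse n a b)) (trans (length-reverse (alt n b a)) (length-alt n b a))

  E-letters : ∀ n a b → All (λ x → x ≡ a ⊎ x ≡ b) (E n a b)
  E-letters n a b = subst (All _) (sym (E≡reverse n a b)) (All-reverse (All.map Sum.swap (alt-letters n b a)))

  E-snoc : ∀ n a b z → E (suc n) a b ++ z ≡ E n b a ++ b ∷ z
  E-snoc n a b z = ++-assoc (E n b a) _ z

  E-reduced : ∀ n {a b} → a ≢ b → Below n a b → Reduced (E n a b)
  E-reduced n {a} {b} ab bd = subst Reduced (sym (E≡reverse n a b)) (Reduced-reverse (alt-reduced n (ab ∘ sym) (Below-sym bd)))

  ℓ-E : ∀ n {a b q} → a ≢ b → Below n a b → ¬ Dsc a q → ¬ Dsc b q → ℓ (E n a b ++ q) ≡ n + ℓ q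
  ℓ-E n {a} {b} {q} ab bd ha hb = trans
    (ℓ-coset (λ x → x ≡ a ⊎ x ≡ b) (λ { (inj₁ refl) → ha ; (inj₂ refl) → hb }) (E n a b) (E-letters n a b))
    (cong (_+ ℓ q) (trans (ℓ-reduced (E-reduced n ab bd)) (length-E n a b)))

  ℓ-E-alt : ∀ n k {a b q} → a ≢ b → Below (k + n) a b → ¬ Dsc a q → ¬ Dsc b q → ℓ (E n a b ++ alt k a b ++ q) ≡ k + n + ℓ q
  ℓ-E-alt n zero ab bd ha hb = ℓ-E n ab bd ha hb
  ℓ-E-alt n (suc k) {a} {b} {q} ab bd ha hb = trans (cong ℓ (sym (E-snoc n b a (alt k b a ++ q))))
    (trans (ℓ-E-alt (suc n) k (ab ∘ sym) (Below-sym (subst (λ i → Below i a b) (sym (+-suc k n)) bd)) hb ha) (cong (_+ ℓ q) (+-suc k n)))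

  E-bounded : ∀ n {a b z} → a ≢ b → Reduced (E n a b ++ z) → Below n a b
  E-bounded n {a} {b} ab r = Below-sym (alt-bounded n (ab ∘ sym) (subst Reduced (reverse-involutive (alt n b a))
    (Reduced-reverse (subst Reduced (E≡reverse n a b) (Reduced-prefix (E n a b) r)))))

-- Classification of rigid elements

module Classification (M : CoxeterMatrix) (no𝒯 : ¬ Coxeter.Contains𝒯 M) where
  open CoxeterMatrix M
  open Coxeter M
  open Words M
  open Tree M no𝒯 using (Below; alt-exact)
  open WordProblem M no𝒯
  open Bruhat M no𝒯
  open Coatoms M no𝒯
  open Triangles M no𝒯

  -- The last `2j` letters of the periodic word `… a b c a b c a`, built in pairs because that is
  -- how the classification finds them.
  spiral : ℕ → S → S → S → Word
  spiral zero a b c = []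
  spiral (suc j) a b c = spiral j b c a ++ c ∷ a ∷ []

  data Shape (s : S) (v u : Word) : Set where
    single  : v ≈ s ∷ [] → Shape s v u
    chain   : ∀ n a → a ≢ s → v ≈ E n a s → Below (suc n) a s → Dsc a u → Shape s v u
    -- Here and in `double` the alternating prefix has exactly one letter less than the longest
    -- element, whereas `chain` allows all smaller lengths.
    pair    : ∀ n b c → Tri s b c → m s b ≡ just (suc n) → m s c ≡ just 3 →
              v ≈ E n s b ++ c ∷ s ∷ [] → Dsc b u → Dsc c u → Shape s v u
    double  : ∀ n a b → Tri a b s → m a b ≡ just (suc n) → m a s ≡ just 3 → m b s ≡ just 3 →
              v ≈ E n a b ++ s ∷ a ∷ b ∷ s ∷ [] → Dsc a u → Dsc b u → Shape s v u
    spirals : ∀ j b c → Tri s b c → m s b ≡ just 3 → m s c ≡ just 3 → m b c ≡ just 3 →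
              v ≈ spiral j s b c → Dsc b u → Dsc c u → Shape s v u

  commute : ∀ {a d} → m a d ≡ just 2 → ∀ z → a ∷ d ∷ z ≈ d ∷ a ∷ z
  commute {a} {d} e z = ++-congʳ z (alt-braid a d 2 e)

  commute-word : ∀ {d} x → All (λ a → m a d ≡ just 2) x → ∀ z → x ++ d ∷ z ≈ d ∷ x ++ z
  commute-word [] [] z = ≈-refl
  commute-word (a ∷ x) (e ∷ es) z = ≈-trans (∷-cong a (commute-word x es z)) (commute e (x ++ z))

  module Rigidity {s v u} (mv : MinR s v) (us : All (_≢ s) u) (rvu : Reduced (v ++ u)) (rig : Rigid v u) where

    rv : Reduced v
    rv = Reduced-prefix v rvu

    record Split (p z : Word) : Set where
      no-eta-equality
      pattern
      constructor split
      field
        v≈ : v ≈ p ++ z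
        len : length v ≡ length p + length z

      reduced : Reduced (p ++ z)
      reduced = Reduced-cong rv (≈-sym v≈) (trans (length-++ p) (sym len))

      reduced-u : Reduced (p ++ z ++ u)
      reduced-u = subst Reduced (++-assoc p z u) (Reduced-cong rvu (++-congʳ u (≈-sym v≈))
        (trans (length-++ (p ++ z)) (trans (cong (_+ length u) (trans (length-++ p) (sym len))) (sym (length-++ v)))))

      reduced-zu : Reduced (z ++ u)
      reduced-zu = Reduced-suffix p reduced-u

      min-z : MinR s z
      min-z = go p reduced (MinR-cong v≈ mv)
        where
          go : ∀ p → Reduced (p ++ z) → MinR s (p ++ z) → MinR s z
          go [] _ h = h
          go (x ∷ p) r h = go p (Reduced-tail r) (MinR-tail h (reduced⇒asc r))

    open Split

    Split-cong : ∀ {p z z'} → z ≈ z' → length z ≡ length z' → Split p z → Split p z'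
    Split-cong {p} e l (split f k) = split (≈-trans f (++-congˡ p e)) (trans k (cong (length p +_) l))

    Split-shift : ∀ {p} x {z} → Split p (x ++ z) → Split (p ++ x) z
    Split-shift {p} x {z} (split f k) = split (≈-trans f (≡⇒≈ (sym (++-assoc p x z))))
      (trans k (trans (cong (length p +_) (length-++ x)) (trans (sym (+-assoc (length p) _ _)) (cong (_+ length z) (sym (length-++ p))))))

    rigid-at : ∀ {p y z} → p ≢ [] → Split p (y ∷ z) → ℓ (p ++ z ++ u) ≢ length p + ℓ (z ++ u)
    rigid-at {[]} n _ = ⊥-elim (n refl)
    rigid-at {x ∷ p} {y} {z} _ sp@(split e l) k = rig {x} {p ++ y ∷ z} {p ++ z} e
      (trans l (cong suc (sym (length-++ p)))) (Del-++ʳ p here)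
      (subst Reduced (cong (x ∷_) (sym (++-assoc p z u))) (ℓ⇒reduced (trans k (trans
        (cong (suc (length p) +_) (ℓ-reduced (Reduced-tail (reduced-zu sp)))) (sym (length-++ (x ∷ p)))))))

    -- A second descent `y` would give `v ≈ y x d`, where `x d` deletes a letter of `v` after the
    -- first. As `x d u ≈ y v u`, that word is reduced, against rigidity.
    unique-descent : ∀ {x y} → Dsc x v → Dsc y v → x ≡ y
    unique-descent {x} {y} dx dy = go (exchange {u = x ∷ v'} (Dsc-cong e dy))
      where
        v' : Word
        v' = nf (x ∷ v)
        e : v ≈ x ∷ v'
        e = ∷-swap x (≈-sym (nf≈ (x ∷ v)))
        l : length v ≡ suc (length v')
        l = trans (sym (ℓ-reduced rv)) (ℓ-dsc dx)
        go : (Σ Word λ d → Del (x ∷ v') d × y ∷ x ∷ v' ≈ d) → x ≡ y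
        go (_ , here , f) with x ≟ y
        ... | yes p = p
        ... | no n = ⊥-elim (alt-exact 0 n (m-off x y n) (≈-sym (++-cancelʳ (x ∷ v') (≈-trans f (≈-sym (ss≈ x v'))))))
        go (_ , there {d = d} δ , f) = ⊥-elim (rig e l δ λ w g → s≤s⁻¹ (subst₂ _≤_
          (trans (length-++ v) (trans (cong (_+ length u) l) (trans (cong (λ n → suc (n + length u)) (Del-length δ)) (cong (suc ∘ suc) (sym (length-++ d))))))
          refl (rvu (y ∷ w) (≈-trans (∷-cong y (≈-trans g (≈-trans (++-congʳ u (≈-sym f)) (∷-cong y (++-congʳ u (≈-sym e)))))) (ss≈ y (v ++ u))))))

    last-letter : ∀ {p a} → Split (p ++ a ∷ []) [] → a ≡ s
    last-letter {p} {a} (split e l) with a ≟ s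
    ... | yes q = q
    ... | no n = ⊥-elim (<-irrefl refl (<-trans (mv a n) (subst₂ _<_ (ℓ-cong p≈) (sym (ℓ-reduced rv))
          (≤-trans (s≤s (ℓ≤length p)) (≤-reflexive (sym (trans l (trans (+-identityʳ _) (trans (length-++ p) (+-comm (length p) 1))))))))))
      where
        p≈ : p ≈ v ++ a ∷ []
        p≈ = ++-swap a (≈-sym (≈-trans e (≡⇒≈ (++-identityʳ _))))

    -- A letter commuting with a nonempty prefix p would be a second left descent of v.
    no-commuting : ∀ {p d z} → p ≢ [] → Split p (d ∷ z) → All (_≢ d) p → All (λ a → m a d ≡ just 2) p → ⊥
    no-commuting {[]} n _ _ _ = n refl
    no-commuting {x ∷ p} {d} {z} _ sp@(split e l) (n ∷ _) es = n (unique-descent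
        (Dsc-cong (≈-sym e) (asc⇒Dsc (reduced⇒asc (reduced sp))))
        (Dsc-cong (≈-sym e') (asc⇒Dsc (reduced⇒asc (Reduced-cong rv (≈-sym e')
          (sym (trans l (trans (+-suc (suc (length p)) (length z)) (cong (suc ∘ suc) (sym (length-++ p)))))))))))
      where
        e' : v ≈ d ∷ x ∷ p ++ z
        e' = ≈-trans e (commute-word (x ∷ p) es z)

    not-empty : ∀ (p : Word) {x z} → p ++ x ∷ z ≢ []
    not-empty [] ()
    not-empty (_ ∷ _) ()

    -- If a z = z j with z minimal, the first letter c of z lies in a braid of a and c.
    record Braid (a c j : S) (z : Word) : Set where
      no-eta-equality
      field
        excess : ℕ
        m≡ : m a c ≡ just (3 + excess)
        core : Word
        z≈ : z ≈ c ∷ a ∷ alt excess c a ++ core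
        z-len : length z ≡ length (c ∷ a ∷ alt excess c a ++ core)
        conj-core : excess ≡ 0 → c ∷ core ≈ core ++ j ∷ []

    -- Since `c a z ≈ c z j` and `c z` is shorter than `z`, the letter `c` is a descent of `a z`, as
    -- is `a`.
    conj-longest : ∀ {a c j z} → MinR s z → j ≢ s → a ∷ z ≈ z ++ j ∷ [] → a ≢ c → Dsc c z → Longest a c (a ∷ z)
    conj-longest {a} {c} {j} {z} mz j≢s e ac dc = two-descents ac da dc'
      where
        ℓaz : ℓ z < ℓ (a ∷ z)
        ℓaz = subst (ℓ z <_) (sym (ℓ-cong e)) (mz j j≢s)
        da : Dsc a (a ∷ z)
        da = subst (_< ℓ (a ∷ z)) (sym (ℓ-cong (ss≈ a z))) ℓaz
        dc' : Dsc c (a ∷ z)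
        dc' = ≤-<-trans (subst (_≤ ℓ z) (sym (ℓ-cong (∷-cong c e))) (≤-trans (ℓ-++≤ (c ∷ z) (j ∷ []))
          (≤-trans (+-monoʳ-≤ (ℓ (c ∷ z)) (ℓ≤length (j ∷ []))) (≤-trans (≤-reflexive (+-comm (ℓ (c ∷ z)) 1)) dc)))) ℓaz

    conj-braid : ∀ {a c j z} → MinR s z → Reduced z → j ≢ s → a ∷ z ≈ z ++ j ∷ [] → NC a c → Dsc c z → Braid a c j z
    conj-braid {a} {c} {j} {z} mz rz j≢s e nc dc = go (conj-longest mz j≢s e (proj₁ nc) dc)
      where
        go : Longest a c (a ∷ z) → Braid a c j z
        go (longest k eq y p l _ _) = by (NC-≥3 nc eq) eq p l
          where
            by : ∀ {k} → 3 ≤ k → m a c ≡ just k → a ∷ z ≈ alt k a c ++ y → ℓ (a ∷ z) ≡ k + ℓ y → Braid a c j z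
            by (s≤s (s≤s (s≤s {n = i} _))) eq p l = record
              { excess = i ; m≡ = eq ; core = nf y
              ; z≈ = z≈
              ; z-len = trans (sym (ℓ-reduced rz)) (suc-injective (trans (sym ℓaz) (trans l
                  (cong suc (trans (cong (λ n → suc (suc (n + ℓ y))) (sym (length-alt i c a))) (cong (suc ∘ suc) (sym (length-++ (alt i c a)))))))))
              -- For order 3, both `a z ≈ c a c core` and `z j` begin with `c a`; cancelling this
              -- leaves the same relation for `core`.
              ; conj-core = λ { refl → ∷-cancel c (∷-cancel a (∷-cancel c (begin
                    c ∷ a ∷ c ∷ c ∷ nf y             ≈⟨ ∷-cong c (∷-cong a (ss≈ c (nf y))) ⟩
                    c ∷ a ∷ nf y                     ≈⟨ z≈ ⟨
                    z                                ≈⟨ ss≈ a z ⟨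
                    a ∷ a ∷ z                        ≈⟨ ∷-cong a e ⟩
                    a ∷ z ++ j ∷ []                  ≈⟨ ∷-cong a (++-congʳ (j ∷ []) z≈) ⟩
                    a ∷ c ∷ a ∷ nf y ++ j ∷ []       ≈⟨ ++-congʳ (nf y ++ j ∷ []) (alt-braid a c 3 eq) ⟩
                    c ∷ a ∷ c ∷ nf y ++ j ∷ [] ∎ ))) }
              }
              where
                open ≈R
                z≈ : z ≈ c ∷ a ∷ alt i c a ++ nf y
                z≈ = ≈-trans (∷-cancel a p) (++-congˡ (c ∷ a ∷ alt i c a) (≈-sym (nf≈ y)))
                ℓaz : ℓ (a ∷ z) ≡ suc (ℓ z)
                ℓaz = ℓ-asc λ d → <-irrefl refl (<-trans d (subst (ℓ z <_) (sym (ℓ-cong e)) (mz j j≢s)))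

    -- v = π c a y, where c is again conjugated by y into J. Rigidity forces y to be empty or to continue
    -- with b c, so that the state recurs with the letters rotated.
    record State (a b c : S) (π y : Word) : Set where
      no-eta-equality
      field
        tri : Tri a b c
        mac : m a c ≡ just 3
        j : S
        j≢s : j ≢ s
        π-letters : All (λ x → x ≡ a ⊎ x ≡ b ⊎ x ≡ c) π
        -- Used to show that a word remains reduced after a deletion to the right of `π`, in
        -- contradiction to rigidity.
        π-additive : ∀ g → Dsc a g → Dsc c g → ℓ (π ++ g) ≡ length π + ℓ g
        sp : Split (π ++ c ∷ a ∷ []) y
        conj-y : c ∷ y ≈ y ++ j ∷ []
        desc-b : Dsc b (y ++ u)
        desc-c : Dsc c (y ++ u)

    advance : ∀ {a b c π d y} → State a b c π (d ∷ y) →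
              m b c ≡ just 3 × (Σ Word λ y' → State c a b (π ++ c ∷ a ∷ []) y' × length y' < length (d ∷ y))
    advance {a} {b} {c} {π} {d} {y₁} st = go (d ≟ b)
      where
        open State st
        y pre X : Word
        y = d ∷ y₁
        pre = π ++ c ∷ a ∷ []
        X = y ++ u
        ac = proj₁ (proj₂ tri)
        bc = proj₂ (proj₂ tri)
        ry : Reduced y
        ry = Reduced-suffix pre (reduced sp)
        dy : Dsc d y
        dy = asc⇒Dsc (reduced⇒asc ry)
        dX : Dsc d X
        dX = asc⇒Dsc (reduced⇒asc (reduced-zu sp))
        ¬cy : ¬ Dsc c y
        ¬cy h = <-irrefl refl (<-trans h (subst (ℓ y <_) (sym (ℓ-cong conj-y)) (min-z sp j j≢s)))
        d≢c : d ≢ c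
        d≢c refl = ¬cy dy
        d≢a : d ≢ a
        d≢a refl = reduced⇒asc (Reduced-suffix (π ++ c ∷ []) (subst Reduced (trans (++-assoc π _ _) (sym (++-assoc π _ _))) (reduced sp))) dy
        pre≢[] : pre ≢ []
        pre≢[] = not-empty π
        pre-letters : All (λ x → x ≡ a ⊎ x ≡ b ⊎ x ≡ c) pre
        pre-letters = Allₚ.++⁺ π-letters (inj₂ (inj₂ refl) ∷ inj₁ refl ∷ [])

        mbc : Σ ℕ λ k → m b c ≡ just k × 3 ≤ k
        mbc = let L = two-descents (proj₁ bc) desc-b desc-c in
          Longest.order L , Longest.m≡ L , NC-≥3 bc (Longest.m≡ L)

        -- Besides `b` and `c`, `d` would be a third descent of `y u`, so it commutes with `b` or
        -- `c`; avoiding `𝒯` it then commutes with all of `a`, `b`, `c`, hence with the whole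
        -- prefix.
        foreign : d ≢ b → ⊥
        foreign d≢b = no-commuting pre≢[] sp
            (All.map (λ { (inj₁ refl) → d≢a ∘ sym ; (inj₂ (inj₁ refl)) → d≢b ∘ sym ; (inj₂ (inj₂ refl)) → d≢c ∘ sym }) pre-letters)
            (All.map (λ { (inj₁ refl) → mad ; (inj₂ (inj₁ refl)) → mbd ; (inj₂ (inj₂ refl)) → mcd }) pre-letters)
          where
            mcd : m c d ≡ just 2
            mcd with m≟2 c d
            ... | yes e = e
            ... | no n with m≟2 b d
            ...   | yes e = ⊥-elim (no𝒯 (b , d , c , d≢b ∘ sym , proj₁ bc , d≢c , e , mbc , NC-cases (NC-sym (d≢c ∘ sym , n))))
            ...   | no n' = ⊥-elim (no-three-descents (bc , (d≢b ∘ sym , n') , (d≢c ∘ sym , n)) desc-b desc-c dX)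
            mbd : m b d ≡ just 2
            mbd with m≟2 b d
            ... | yes e = e
            ... | no n = ⊥-elim (no𝒯 (c , d , b , d≢c ∘ sym , proj₁ bc ∘ sym , d≢b , mcd ,
                  (proj₁ mbc , trans (m-sym c b) (proj₁ (proj₂ mbc)) , proj₂ (proj₂ mbc)) , NC-cases (NC-sym (d≢b ∘ sym , n))))
            mad : m a d ≡ just 2
            mad with m≟2 a d
            ... | yes e = e
            ... | no n = ⊥-elim (no𝒯 (c , d , a , d≢c ∘ sym , proj₁ ac ∘ sym , d≢a , mcd ,
                  (3 , trans (m-sym c a) mac , ≤-refl) , NC-cases (NC-sym (d≢a ∘ sym , n))))

        go : Dec (d ≡ b) → m b c ≡ just 3 × (Σ Word λ y' → State c a b pre y' × length y' < length y)
        go (no n) = ⊥-elim (foreign n)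
        go (yes refl) = mbc3 , core , record
              { tri = rot (rot tri) ; mac = trans (m-sym c b) mbc3 ; j = j ; j≢s = j≢s
              ; π-letters = All.map (λ { (inj₁ p) → inj₂ (inj₁ p) ; (inj₂ (inj₁ p)) → inj₂ (inj₂ p) ; (inj₂ (inj₂ p)) → inj₁ p }) pre-letters
              ; π-additive = additive'
              ; sp = Split-shift (b ∷ c ∷ []) (Split-cong y≈ y-len sp)
              ; conj-y = conj-core excess≡0
              ; desc-b = subst (Dsc a) G≡ desc-a ; desc-c = subst (Dsc b) G≡ desc-b' } ,
              ≤-trans (n≤1+n _) (≤-reflexive (sym y-len))
          where
            open Braid (conj-braid (min-z sp) ry j≢s conj-y (NC-sym bc) dy)
            Y G : Word
            Y = alt excess b c ++ core
            G = Y ++ u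
            sp' : Split pre (b ∷ c ∷ Y)
            sp' = Split-cong z≈ z-len sp
            X≈ : X ≈ b ∷ c ∷ G
            X≈ = ++-congʳ u z≈
            cbX≈ : c ∷ b ∷ X ≈ G
            cbX≈ = ≈-trans (∷-cong c (≈-trans (∷-cong b X≈) (ss≈ b _))) (ss≈ c G)
            ¬cG : ¬ Dsc c G
            ¬cG = reduced⇒asc (Reduced-tail (reduced-zu sp'))
            desc-a : Dsc a G
            -- Otherwise `b` could be deleted: what follows `π` would begin with `c a c`, the
            -- longest element for `a` and `c`, over which `π` is additive.
            desc-a = decidable-stable (Dsc? a G) λ ¬aG → rigid-at pre≢[] sp' (begin
                ℓ (pre ++ c ∷ G)                ≡⟨ cong ℓ (++-assoc π _ _) ⟩
                ℓ (π ++ alt 3 c a ++ G)         ≡⟨ π-additive _ (Dsc-cong (++-congʳ G (≈-sym (alt-braid c a 3 mca)))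
                                                     (alt-Dsc 2 (proj₁ ac) (Below-sym bd) ¬aG ¬cG)) (alt-Dsc 2 (proj₁ ac ∘ sym) bd ¬cG ¬aG) ⟩
                length π + ℓ (alt 3 c a ++ G)   ≡⟨ cong (length π +_) (ℓ-alt 3 (proj₁ ac ∘ sym) bd ¬cG ¬aG) ⟩
                length π + (2 + suc (ℓ G))      ≡⟨ sym (+-assoc (length π) 2 _) ⟩
                length π + 2 + suc (ℓ G)        ≡⟨ cong₂ _+_ (sym (length-++ π)) (sym (ℓ-asc ¬cG)) ⟩
                length pre + ℓ (c ∷ G) ∎)
              where
                open ≡-Reasoning
                mca : m c a ≡ just 3
                mca = trans (m-sym c a) mac
                bd : Below 3 c a
                bd = order-Below mca ≤-refl
            desc-b' : Dsc b G
            desc-b' = Dsc-cong cbX≈ (peel₂ (proj₁ bc) desc-b desc-c bc)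

            -- A longer braid would make `c` a descent of `b G`, which `third-ascent` forbids
            -- because `a` and `b` are descents of `G`.
            excess≡0 : excess ≡ 0
            excess≡0 = by excess refl
              where
                by : ∀ i → excess ≡ i → i ≡ 0
                by zero _ = refl
                by (suc i) e = ⊥-elim (third-ascent (rot (rot tri)) desc-a desc-b'
                  (Dsc-cong (∷-cong b cbX≈) (peel₃ (proj₁ bc) desc-b desc-c (trans (m-sym b c) (trans m≡ (cong (λ n → just (3 + n)) e))))))
            mbc3 : m b c ≡ just 3
            mbc3 = trans (m-sym b c) (trans m≡ (cong (λ n → just (3 + n)) excess≡0))
            y≈ : y ≈ b ∷ c ∷ core
            y≈ = subst (λ i → y ≈ b ∷ c ∷ alt i b c ++ core) excess≡0 z≈
            y-len : length y ≡ length (b ∷ c ∷ core)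
            y-len = subst (λ i → length y ≡ length (b ∷ c ∷ alt i b c ++ core)) excess≡0 z-len
            G≡ : G ≡ core ++ u
            G≡ = cong (λ i → (alt i b c ++ core) ++ u) excess≡0
            additive' : ∀ g → Dsc c g → Dsc b g → ℓ (pre ++ g) ≡ length pre + ℓ g
            additive' g dc db = begin
                ℓ (pre ++ g)                  ≡⟨ cong ℓ (++-assoc π _ _) ⟩
                ℓ (π ++ c ∷ a ∷ g)            ≡⟨ π-additive _ descent-r descent-p ⟩
                length π + ℓ (c ∷ a ∷ g)      ≡⟨ cong (length π +_) grows ⟩
                length π + (2 + ℓ g)          ≡⟨ sym (+-assoc (length π) 2 _) ⟩
                length π + 2 + ℓ g            ≡⟨ cong (_+ ℓ g) (sym (length-++ π)) ⟩
                length pre + ℓ g ∎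
              where
                open ≡-Reasoning
                open Step (spiral-step {p = c} {q = b} {r = a} (flip (rot (rot tri))) (trans (m-sym c a) mac) dc db)

    end : ∀ {π a c} → Split (π ++ c ∷ a ∷ []) [] → a ≡ s × v ≈ π ++ c ∷ a ∷ []
    end {π} {a} {c} sp = last-letter {p = π ++ c ∷ []} (subst (λ p → Split p []) (sym (++-assoc π (c ∷ []) (a ∷ []))) sp) ,
      ≈-trans (v≈ sp) (≡⇒≈ (++-identityʳ _))

    wind : ∀ n k {a b c y} → State a b c (spiral k b c a) y → m a b ≡ just 3 → m b c ≡ just 3 →
           length y ≤ n → Shape s v u
    wind n k {a} {b} {c} {[]} st ab bc le = done (end (State.sp st)) (State.tri st) (State.mac st) ab
      where
        done : a ≡ s × v ≈ spiral (suc k) a b c → Tri a b c → m a c ≡ just 3 → m a b ≡ just 3 → Shape s v u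
        done (refl , e) t ac ab = spirals (suc k) b c t ab ac bc e (State.desc-b st) (State.desc-c st)
    wind (suc n) k {a} {b} {c} {d ∷ y} st ab bc le = next (advance st)
      where
        next : m b c ≡ just 3 × (Σ Word λ y' → State c a b (spiral (suc k) a b c) y' × length y' < length (d ∷ y)) → Shape s v u
        next (_ , y' , st' , lt) = wind n (suc k) st' (trans (m-sym c a) (State.mac st)) ab (s≤s⁻¹ (≤-trans lt le))

    -- The first advance yields order 3 for `b`, `c`, the second for `a`, `b`. After the second, `n`
    -- is 2 and the alternating prefix is itself a pair of a spiral; ending earlier gives `pair` or
    -- `double`.
    finish : ∀ n {a b c y} → m a b ≡ just (suc n) → State a b c (E n a b) y → Shape s v u
    finish n {a} {b} {c} {[]} ab st = done (end (State.sp st)) (State.tri st) (State.mac st) ab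
      where
        done : a ≡ s × v ≈ E n a b ++ c ∷ a ∷ [] → Tri a b c → m a c ≡ just 3 → m a b ≡ just (suc n) → Shape s v u
        done (refl , e) t ac ab = pair n b c t ab ac e (State.desc-b st) (State.desc-c st)
    finish n {a} {b} {c} {d ∷ y} ab st = next (advance st)
      where
        pre : Word
        pre = E n a b ++ c ∷ a ∷ []
        done : c ≡ s × v ≈ pre ++ b ∷ c ∷ [] → Tri a b c → m a c ≡ just 3 → m b c ≡ just 3 → Dsc a u → Dsc b u → Shape s v u
        done (refl , e) t ac bc da db = double n a b t ab ac bc (≈-trans e (≡⇒≈ (++-assoc (E n a b) _ _))) da db
        start : ∀ {y} → m a b ≡ just 3 → n ≡ 2 → m b c ≡ just 3 → State b c a (pre ++ b ∷ c ∷ []) y → Shape s v u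
        -- Three pairs so far: the prefix `a b`, then `c a` and `b c`.
        start {y} ab3 refl bc st'' = wind (length y) 3 st'' bc (trans (m-sym c a) (State.mac st)) ≤-refl
        next : m b c ≡ just 3 × (Σ Word λ y' → State c a b pre y' × length y' < length (d ∷ y)) → Shape s v u
        next (bc , [] , st' , _) = done (end (State.sp st')) (State.tri st) (State.mac st) bc (State.desc-b st') (State.desc-c st')
        next (bc , d' ∷ y' , st' , _) = next' (advance st')
          where
            next' : m a b ≡ just 3 × (Σ Word λ y'' → State b c a (pre ++ b ∷ c ∷ []) y'' × length y'' < length (d' ∷ y')) → Shape s v u
            next' (ab3 , y'' , st'' , _) = start ab3 (suc-injective (just-injective (trans (sym ab) ab3))) bc st''

    E≢[] : ∀ n {a b} → E (suc n) a b ≢ []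
    E≢[] n {a} {b} = not-empty (E n b a)

    -- Rewriting `z u` so that it starts with `a` continues the alternating prefix inside a reduced
    -- word.
    next-bounded : ∀ n {a b z} → a ≢ b → Split (E n a b) z → Dsc a (z ++ u) → Below (suc n) a b
    next-bounded n {a} {b} {z} ab sp da = Below-sym (E-bounded (suc n) {z = g} (ab ∘ sym)
        (Reduced-cong (reduced-u sp) (≈-trans (≡⇒≈ (E-snoc n b a g)) (++-congˡ (E n a b) (≈-sym zu≈)))
          (trans (cong length (E-snoc n b a g)) (trans (length-++ (E n a b)) (trans (cong (length (E n a b) +_) lg) (sym (length-++ (E n a b))))))))
      where
        g : Word
        g = nf (a ∷ z ++ u)
        zu≈ : z ++ u ≈ a ∷ g
        zu≈ = ∷-swap a (≈-sym (nf≈ (a ∷ z ++ u)))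
        lg : suc (length g) ≡ length (z ++ u)
        lg = trans (sym (ℓ-dsc da)) (ℓ-reduced (reduced-zu sp))

    -- The alternating prefix π of v cannot be continued: a z = z j, and z starts with a third letter c.
    module Turn {n a b c z₁ j} (ab : a ≢ b) (bd : Below (3 + n) a b) (sp : Split (E (2 + n) a b) (c ∷ z₁))
                (da : Dsc a (c ∷ z₁ ++ u)) (j≢s : j ≢ s) (az : a ∷ c ∷ z₁ ≈ (c ∷ z₁) ++ j ∷ []) where

      private
        π z : Word
        π = E (2 + n) a b
        z = c ∷ z₁
        rz : Reduced z
        rz = Reduced-suffix π (reduced sp)
        dz : Dsc c z
        dz = asc⇒Dsc (reduced⇒asc rz)
        ¬az : ¬ Dsc a z
        ¬az h = <-irrefl refl (<-trans h (subst (ℓ z <_) (sym (ℓ-cong az)) (min-z sp j j≢s)))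
        a≢c : a ≢ c
        a≢c refl = ¬az dz
        b≢c : b ≢ c
        b≢c refl = reduced⇒asc (Reduced-suffix (E (suc n) b a) (subst Reduced (++-assoc (E (suc n) b a) _ _) (reduced sp))) dz
        j-descent : ℓ (j ∷ u) < ℓ u
        j-descent = +-cancelˡ-< (ℓ z) _ _ (subst₂ _<_ (trans (ℓ-cong (≈-trans (++-congʳ u az) (≡⇒≈ (++-assoc z _ u))))
          (MinR-++ (min-z sp) (j≢s ∷ us))) (MinR-++ (min-z sp) us) da)

        mab≥3 : ∀ {k} → m a b ≡ just k → 3 ≤ k
        mab≥3 e = ≤-trans (s≤s (s≤s (s≤s z≤n))) (bd _ e)

        ab-NC : NC a b
        ab-NC = ab , λ e → 1+n≰n (mab≥3 e)

        -- If `c` also commutes with `b`, `no-commuting` applies. If not, avoiding `𝒯` makes `m a b`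
        -- infinite; then `a` and `b` are not both descents of `z₁ u`, the prefix is additive over
        -- it, and `c` could be deleted.
        commuting : m a c ≡ just 2 → ⊥
        commuting ac = by (m≟2 b c) (m a b) refl
          where
            sp₁ : Split (π ++ c ∷ []) z₁
            sp₁ = Split-shift (c ∷ []) sp
            z₁u : Word
            z₁u = z₁ ++ u
            az₁ : a ∷ z₁ ≈ z₁ ++ j ∷ []
            az₁ = ∷-cancel c (≈-trans (≈-sym (commute ac z₁)) az)
            da₁ : Dsc a z₁u
            da₁ = subst₂ _<_ (sym (trans (ℓ-cong (≈-trans (++-congʳ u az₁) (≡⇒≈ (++-assoc z₁ _ u)))) (MinR-++ (min-z sp₁) (j≢s ∷ us))))
              (sym (MinR-++ (min-z sp₁) us)) (+-monoʳ-< (ℓ z₁) j-descent)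
            rigid-c : ∀ i {q} → m a b ≡ nothing → z₁u ≈ alt i a b ++ q → ℓ z₁u ≡ i + ℓ q → ¬ Dsc a q → ¬ Dsc b q → ⊥
            rigid-c i {q} e f l ha hb = rigid-at (E≢[] (suc n)) sp (trans (ℓ-cong (++-congˡ π f))
              (trans (ℓ-E-alt (2 + n) i ab (λ k e' → case trans (sym e) e' of λ ()) ha hb)
                (trans (cong (_+ ℓ q) (+-comm i (2 + n))) (trans (+-assoc (2 + n) i (ℓ q)) (cong₂ _+_ (sym (length-E (2 + n) a b)) (sym l))))))
            by : Dec (m b c ≡ just 2) → ∀ o → m a b ≡ o → ⊥
            by (yes bc) _ _ = no-commuting (E≢[] (suc n)) sp
              (All.map (λ { (inj₁ refl) → a≢c ; (inj₂ refl) → b≢c }) (E-letters (2 + n) a b))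
              (All.map (λ { (inj₁ refl) → ac ; (inj₂ refl) → bc }) (E-letters (2 + n) a b))
            by (no bc) (just k) e = no𝒯 (a , c , b , a≢c , ab , b≢c ∘ sym , ac , (k , e , mab≥3 e) , NC-cases (NC-sym (b≢c , bc)))
            by (no bc) nothing e = [ inj₁-case , inj₂-case ]′ (dihedral ab z₁u)
              where
                inj₁-case : Dihedral a b z₁u → ⊥
                inj₁-case (dih i q f l _ ha hb) = rigid-c i e f l ha hb
                inj₂-case : Dihedral b a z₁u → ⊥
                inj₂-case (dih zero q f l _ hb ha) = rigid-c 0 e f l ha hb
                inj₂-case (dih (suc i) q f l bd' hb ha) =
                  finite (two-descents ab da₁ (Dsc-cong (≈-sym f) (alt-Dsc i (ab ∘ sym) bd' hb ha)))
                  where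
                    finite : Longest a b z₁u → ⊥
                    finite L = case trans (sym e) (Longest.m≡ L) of λ ()

      turn : Shape s v u
      turn = finish (2 + n) mab st
        where
          ac : NC a c
          ac = a≢c , commuting
          open Braid (conj-braid (min-z sp) rz j≢s az ac dz)
          bc : NC b c
          bc = b≢c , λ e → no𝒯 (c , b , a , b≢c ∘ sym , a≢c ∘ sym , ab ∘ sym , trans (m-sym c b) e ,
            (3 + excess , trans (m-sym c a) m≡ , s≤s (s≤s (s≤s z≤n))) , NC-cases (NC-sym ab-NC))
          tri : Tri a b c
          tri = ab-NC , ac , bc
          Y G X : Word
          Y = alt excess c a ++ core
          G = Y ++ u
          X = z ++ u
          sp' : Split π (c ∷ a ∷ Y)
          sp' = Split-cong z≈ z-len sp
          acX≈ : a ∷ c ∷ X ≈ G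
          acX≈ = ≈-trans (∷-cong a (≈-trans (∷-cong c (++-congʳ u z≈)) (ss≈ c _))) (ss≈ a G)
          desc-cX : Dsc c X
          desc-cX = asc⇒Dsc (reduced⇒asc (reduced-zu sp))
          ¬aG : ¬ Dsc a G
          ¬aG = reduced⇒asc (Reduced-tail (reduced-zu sp'))
          additive-⊥ : ℓ (π ++ a ∷ G) ≢ 2 + n + suc (ℓ G)
          additive-⊥ e = rigid-at (E≢[] (suc n)) sp' (trans e (cong₂ _+_ (sym (length-E (2 + n) a b)) (sym (ℓ-asc ¬aG))))
          desc-bG : Dsc b G
          -- Otherwise `c` could be deleted, the following `a` continuing the alternating prefix.
          desc-bG = decidable-stable (Dsc? b G) λ ¬bG → additive-⊥ (trans (cong ℓ (sym (E-snoc (2 + n) b a G)))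
            (trans (ℓ-E (3 + n) (ab ∘ sym) (Below-sym bd) ¬bG ¬aG) (sym (+-suc (2 + n) (ℓ G)))))
          desc-cG : Dsc c G
          desc-cG = Dsc-cong acX≈ (peel₂ (a≢c ∘ sym) desc-cX da (NC-sym ac))
          excess≡0 : excess ≡ 0
          excess≡0 = by excess refl
            where
              by : ∀ i → excess ≡ i → i ≡ 0
              by zero _ = refl
              by (suc i) e = ⊥-elim (third-ascent tri desc-bG desc-cG
                (Dsc-cong (∷-cong c acX≈) (peel₃ (a≢c ∘ sym) desc-cX da (trans (m-sym c a) (trans m≡ (cong (λ k → just (3 + k)) e))))))
          z≈' : z ≈ c ∷ a ∷ core
          z≈' = subst (λ i → z ≈ c ∷ a ∷ alt i c a ++ core) excess≡0 z≈
          z-len' : length z ≡ length (c ∷ a ∷ core)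
          z-len' = subst (λ i → length z ≡ length (c ∷ a ∷ alt i c a ++ core)) excess≡0 z-len
          G≡ : G ≡ core ++ u
          G≡ = cong (λ i → (alt i c a ++ core) ++ u) excess≡0
          -- With a larger order the prefix could be continued by `a b` in front of `b G`, again
          -- allowing `c` to be deleted. So the prefix has length `m a b ∸ 1`.
          not-below : ¬ Below (4 + n) a b
          not-below bd' = additive-⊥ (begin
              ℓ (π ++ a ∷ G)                     ≡⟨ ℓ-cong (++-congˡ π (∷-cong a (≈-sym (ss≈ b G)))) ⟩
              ℓ (π ++ a ∷ b ∷ b ∷ G)             ≡⟨ cong ℓ (sym (trans (E-snoc (3 + n) a b (b ∷ G)) (E-snoc (2 + n) b a (b ∷ b ∷ G)))) ⟩
              ℓ (E (4 + n) a b ++ b ∷ G)         ≡⟨ ℓ-E (4 + n) ab bd' (third-ascent (flip tri) desc-cG desc-bG) (Dsc⇒asc desc-bG) ⟩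
              4 + n + ℓ (b ∷ G)                  ≡⟨ cong (3 +_) (sym (+-suc n _)) ⟩
              3 + n + suc (ℓ (b ∷ G))            ≡⟨ cong (3 + n +_) (sym (ℓ-dsc desc-bG)) ⟩
              3 + n + ℓ G                        ≡⟨ cong (2 +_) (sym (+-suc n _)) ⟩
              2 + n + suc (ℓ G) ∎)
            where open ≡-Reasoning
          mab : m a b ≡ just (3 + n)
          mab = by (m a b) refl
            where
              by : ∀ o → m a b ≡ o → m a b ≡ just (3 + n)
              by nothing e = ⊥-elim (not-below λ k e' → case trans (sym e) e' of λ ())
              by (just k) e with k Data.Nat.≟ 3 + n
              ... | yes refl = e
              ... | no ne = ⊥-elim (not-below λ k' e' → subst (4 + n ≤_) (just-injective (trans (sym e) e')) (≤∧≢⇒< (bd k e) (ne ∘ sym)))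
          additive' : ∀ g → Dsc a g → Dsc c g → ℓ (π ++ g) ≡ length π + ℓ g
          additive' g da dc = begin
              ℓ (π ++ g)                      ≡⟨ ℓ-cong (++-congˡ π (≈-sym (ss≈ a g))) ⟩
              ℓ (π ++ a ∷ a ∷ g)              ≡⟨ cong ℓ (sym (E-snoc (2 + n) b a (a ∷ g))) ⟩
              ℓ (E (3 + n) b a ++ a ∷ g)      ≡⟨ ℓ-E (3 + n) (ab ∘ sym) (Below-sym bd) (third-ascent (rot tri) dc da) (Dsc⇒asc da) ⟩
              3 + n + ℓ (a ∷ g)               ≡⟨ cong (2 +_) (sym (+-suc n _)) ⟩
              2 + n + suc (ℓ (a ∷ g))         ≡⟨ cong₂ _+_ (sym (length-E (2 + n) a b)) (sym (ℓ-dsc da)) ⟩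
              length π + ℓ g ∎
            where open ≡-Reasoning
          st : State a b c π core
          st = record
            { tri = tri ; mac = trans m≡ (cong (λ k → just (3 + k)) excess≡0) ; j = j ; j≢s = j≢s
            ; π-letters = All.map (λ { (inj₁ p) → inj₁ p ; (inj₂ p) → inj₂ (inj₁ p) }) (E-letters (2 + n) a b)
            ; π-additive = additive'
            ; sp = Split-shift (c ∷ a ∷ []) (Split-cong z≈' z-len' sp)
            ; conj-y = conj-core excess≡0
            ; desc-b = subst (Dsc b) G≡ desc-bG ; desc-c = subst (Dsc c) G≡ desc-cG }

    -- When the prefix grows by `a`, rigidity makes `b` a descent of the rest. When it cannot grow,
    -- `a z` is not minimal, or `a` would be an ascent of `z u`; so Deodhar's lemma gives
    -- `a z ≈ z j` and a turn.
    alternate : ∀ k n {a b z} → a ≢ b → Split (E (2 + n) a b) z → Dsc a (z ++ u) → length z ≤ k → Shape s v u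
    alternate k n {a} {b} {[]} ab sp da le = done (last-letter sp) ab sp (next-bounded (2 + n) ab sp da)
      where
        done : ∀ {b} → b ≡ s → a ≢ b → Split (E (2 + n) a b) [] → Below (3 + n) a b → Shape s v u
        done refl ab sp bd = chain (2 + n) a ab (≈-trans (v≈ sp) (≡⇒≈ (++-identityʳ _))) bd da
    alternate (suc k) n {a} {b} {c ∷ z} ab sp da le = by (Dsc? a (c ∷ z))
      where
        rz : Reduced (c ∷ z)
        rz = Reduced-suffix (E (2 + n) a b) (reduced sp)
        bd : Below (3 + n) a b
        bd = next-bounded (2 + n) ab sp da
        onward : Desc a (c ∷ z) → Shape s v u
        onward (z' , δ , e) = alternate k (suc n) (ab ∘ sym) (Split-shift (a ∷ []) sp')
            (decidable-stable (Dsc? b (z' ++ u)) λ ¬b → rigid-at (E≢[] (suc n)) sp'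
              (trans (ℓ-E (2 + n) ab (Below-≤ (n≤1+n _) bd) (reduced⇒asc (reduced-zu sp')) ¬b)
                (cong (_+ ℓ (z' ++ u)) (sym (length-E (2 + n) a b)))))
            (s≤s⁻¹ (subst (_≤ suc k) (Del-length δ) le))
          where
            sp' : Split (E (2 + n) a b) (a ∷ z')
            sp' = Split-cong e (Del-length δ) sp
        by : Dec (Dsc a (c ∷ z)) → Shape s v u
        by (yes h) = let d , δ , e = exchange h in onward (d , δ , ∷-swap a e)
        by (no h) = [ (λ mz → ⊥-elim (<-irrefl refl (<-trans da (≤-reflexive (sym (trans (MinR-++ mz us)
                (trans (cong (_+ ℓ u) (ℓ-asc h)) (cong suc (sym (MinR-++ (min-z sp) us)))))))))) 
            , (λ (j , j≢s , e) → Turn.turn ab bd sp da j≢s e) ]′ (deodhar a (min-z sp) h)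

    classify : v ≢ [] → Shape s v u
    classify = go v ≈-refl refl
      where
        go : ∀ w → v ≈ w → length v ≡ length w → v ≢ [] → Shape s v u
        go [] e l n = ⊥-elim (n (empty v l))
          where
            empty : ∀ x → length x ≡ 0 → x ≡ []
            empty [] _ = refl
        go (x ∷ []) e l n = done (last-letter {p = []} (split e l)) e
          where
            done : ∀ {x} → x ≡ s → v ≈ x ∷ [] → Shape s v u
            done refl e = single e
        go (x ∷ y ∷ z) e l n = alternate (length z) 0 {x} {y} {z} x≢y (split e l)
            (decidable-stable (Dsc? x (z ++ u)) λ ¬x → rigid-at {x ∷ []} {y} {z} (λ ()) (split e l) (ℓ-asc ¬x)) ≤-refl
          where
            x≢y : x ≢ y
            x≢y refl = 1+n≰n (≤-trans (n≤1+n _) (Reduced-cong rv (≈-sym e) (sym l) z (≈-sym (ss≈ x z))))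

-- Polynomials as lists of exponents

module Counting where

  δ : ℕ → ℕ → ℕ
  δ zero zero = 1
  δ zero (suc k) = 0
  δ (suc a) zero = 0
  δ (suc a) (suc k) = δ a k

  -- The k-th coefficient of the polynomial whose exponents, with multiplicity, form the list.
  -- Lengths of group elements give such lists directly, and products become `_⊗_`.
  cnt : ℕ → List ℕ → ℕ
  cnt k [] = 0
  cnt k (a ∷ A) = δ a k + cnt k A

  δ-refl : ∀ a → δ a a ≡ 1
  δ-refl zero = refl
  δ-refl (suc a) = δ-refl a

  δ-≢ : ∀ a k → a ≢ k → δ a k ≡ 0
  δ-≢ zero zero n = ⊥-elim (n refl)
  δ-≢ zero (suc k) n = refl
  δ-≢ (suc a) zero n = refl
  δ-≢ (suc a) (suc k) n = δ-≢ a k (n ∘ cong suc)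

  cnt-++ : ∀ k A B → cnt k (A ++ B) ≡ cnt k A + cnt k B
  cnt-++ k [] B = refl
  cnt-++ k (a ∷ A) B = trans (cong (δ a k +_) (cnt-++ k A B)) (sym (+-assoc (δ a k) _ _))

  cnt-↭ : ∀ k {A B} → A ↭ B → cnt k A ≡ cnt k B
  cnt-↭ k Perm.refl = refl
  cnt-↭ k (prep a p) = cong (δ a k +_) (cnt-↭ k p)
  cnt-↭ k (Perm.swap a b p) = trans (cong (λ n → δ a k + (δ b k + n)) (cnt-↭ k p)) (swap-+ (δ a k) (δ b k) _)
    where
      swap-+ : ∀ x y z → x + (y + z) ≡ y + (x + z)
      swap-+ = solve-∀
  cnt-↭ k (Perm.trans p q) = trans (cnt-↭ k p) (cnt-↭ k q)

  cnt-filter : ∀ {A : Set} (f : A → ℕ) k L → length (filter (λ x → f x Data.Nat.≟ k) L) ≡ cnt k (map f L)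
  cnt-filter f k [] = refl
  cnt-filter f k (x ∷ L) = by (f x Data.Nat.≟ k)
    where
      by : Dec (f x ≡ k) → length (filter (λ x → f x Data.Nat.≟ k) (x ∷ L)) ≡ cnt k (map f (x ∷ L))
      by (yes refl) = trans (cong length (filter-accept (λ x → f x Data.Nat.≟ k) refl))
        (cong₂ _+_ (sym (δ-refl (f x))) (cnt-filter f k L))
      by (no n) = trans (cong length (filter-reject (λ x → f x Data.Nat.≟ k) n))
        (cong₂ _+_ (sym (δ-≢ (f x) k n)) (cnt-filter f k L))

  conv : ℕ → (ℕ → ℕ) → (ℕ → ℕ) → ℕ
  conv zero f g = f 0 * g 0
  conv (suc k) f g = f 0 * g (suc k) + conv k (f ∘ suc) g

  conv-+ : ∀ k f f' g → conv k (λ i → f i + f' i) g ≡ conv k f g + conv k f' g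
  conv-+ zero f f' g = *-distribʳ-+ (g 0) (f 0) (f' 0)
  conv-+ (suc k) f f' g = trans (cong₂ _+_ (*-distribʳ-+ (g (suc k)) (f 0) (f' 0)) (conv-+ k (f ∘ suc) (f' ∘ suc) g))
    (interchange (f 0 * g (suc k)) (f' 0 * g (suc k)) (conv k (f ∘ suc) g) (conv k (f' ∘ suc) g))
    where
      interchange : ∀ a b c d → a + b + (c + d) ≡ a + c + (b + d)
      interchange = solve-∀

  conv-0 : ∀ k g → conv k (λ _ → 0) g ≡ 0
  conv-0 zero g = refl
  conv-0 (suc k) g = conv-0 k g

  conv-cong : ∀ k {f f' g g'} → (∀ i → i ≤ k → f i ≡ f' i) → (∀ i → i ≤ k → g i ≡ g' i) → conv k f g ≡ conv k f' g'
  conv-cong zero p q = cong₂ _*_ (p 0 z≤n) (q 0 z≤n)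
  conv-cong (suc k) p q = cong₂ _+_ (cong₂ _*_ (p 0 z≤n) (q (suc k) ≤-refl))
    (conv-cong k (λ i le → p (suc i) (s≤s le)) (λ i le → q i (m≤n⇒m≤1+n le)))

  cnt-shift : ∀ k a B → cnt k (map (a +_) B) ≡ conv k (δ a) (λ i → cnt i B)
  cnt-shift zero zero B = trans (cnt-id 0 B) (sym (+-identityʳ _))
    where
      cnt-id : ∀ k B → cnt k (map (0 +_) B) ≡ cnt k B
      cnt-id k [] = refl
      cnt-id k (b ∷ B) = cong (δ b k +_) (cnt-id k B)
  cnt-shift (suc k) zero B = trans (cnt-id B) (sym (trans (cong₂ _+_ (+-identityʳ _) (conv-0 k _)) (+-identityʳ _)))
    where
      cnt-id : ∀ B → cnt (suc k) (map (0 +_) B) ≡ cnt (suc k) B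
      cnt-id [] = refl
      cnt-id (b ∷ B) = cong (δ b (suc k) +_) (cnt-id B)
  cnt-shift zero (suc a) [] = refl
  cnt-shift zero (suc a) (b ∷ B) = cnt-shift zero (suc a) B
  cnt-shift (suc k) (suc a) B = trans (lower B) (cnt-shift k a B)
    where
      lower : ∀ B → cnt (suc k) (map (suc a +_) B) ≡ cnt k (map (a +_) B)
      lower [] = refl
      lower (b ∷ B) = cong (δ (a + b) k +_) (lower B)

  infixr 7 _⊗_
  _⊗_ : List ℕ → List ℕ → List ℕ
  _⊗_ = cartesianProductWith _+_

  cnt-⊗ : ∀ k A B → cnt k (A ⊗ B) ≡ conv k (λ i → cnt i A) (λ i → cnt i B)
  cnt-⊗ k [] B = sym (conv-0 k _)
  cnt-⊗ k (a ∷ A) B = trans (cnt-++ k (map (a +_) B) (A ⊗ B)) (trans (cong₂ _+_ (cnt-shift k a B) (cnt-⊗ k A B))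
    (sym (conv-+ k (δ a) (λ i → cnt i A) (λ i → cnt i B))))

  infix 8 _ᵒ_
  -- The reversed polynomial `q^l A(1/q)`, for exponents at most `l`.
  _ᵒ_ : List ℕ → ℕ → List ℕ
  A ᵒ l = map (l ∸_) A

  ∸-+ : ∀ {l l' a b} → a ≤ l → b ≤ l' → (l + l') ∸ (a + b) ≡ (l ∸ a) + (l' ∸ b)
  ∸-+ {l} {l'} {a} {b} p q = begin
    (l + l') ∸ (a + b)                             ≡⟨ cong (_∸ (a + b)) (cong₂ _+_ (sym (m+[n∸m]≡n p)) (sym (m+[n∸m]≡n q))) ⟩
    ((a + (l ∸ a)) + (b + (l' ∸ b))) ∸ (a + b)     ≡⟨ cong (_∸ (a + b)) (arith a b (l ∸ a) (l' ∸ b)) ⟩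
    ((a + b) + ((l ∸ a) + (l' ∸ b))) ∸ (a + b)     ≡⟨ m+n∸m≡n (a + b) _ ⟩
    (l ∸ a) + (l' ∸ b) ∎
    where
      open ≡-Reasoning
      arith : ∀ a b c d → (a + c) + (b + d) ≡ (a + b) + (c + d)
      arith = solve-∀

  ⊗-ᵒ : ∀ {l l' A B} → All (_≤ l) A → All (_≤ l') B → (A ⊗ B) ᵒ (l + l') ≡ A ᵒ l ⊗ B ᵒ l'
  ⊗-ᵒ [] bs = refl
  ⊗-ᵒ {l} {l'} {a ∷ A} {B} (p ∷ ps) bs = trans (map-++ (l + l' ∸_) (map (a +_) B) (A ⊗ B))
    (cong₂ _++_ (row B bs) (⊗-ᵒ ps bs))
    where
      row : ∀ B → All (_≤ l') B → map (l + l' ∸_) (map (a +_) B) ≡ map ((l ∸ a) +_) (map (l' ∸_) B)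
      row [] [] = refl
      row (b ∷ B) (q ∷ qs) = cong₂ _∷_ (∸-+ p q) (row B qs)

  ⊗-≤ : ∀ {l l' A B} → All (_≤ l) A → All (_≤ l') B → All (_≤ l + l') (A ⊗ B)
  ⊗-≤ [] bs = []
  ⊗-≤ (p ∷ ps) bs = Allₚ.++⁺ (Allₚ.map⁺ (All.map (+-mono-≤ p) bs)) (⊗-≤ ps bs)

  Symmetric : ℕ → List ℕ → Set
  Symmetric l A = ∀ k → cnt k A ≡ cnt k (A ᵒ l)

  -- The direction of the inequality matters: all defects have the same sign and add up in a
  -- product.
  record Defective (l : ℕ) (A : List ℕ) : Set where
    field
      agree : ∀ k → k ≤ 2 → cnt k A ≡ cnt k (A ᵒ l)
      excess : cnt 3 A < cnt 3 (A ᵒ l)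
      3≤l : 3 ≤ l

  -- `X` will be `Contains33c`, so a defect carries along the triangle that caused it. The positive
  -- constant term keeps inequalities strict in products.
  record Status (X : Set) (l : ℕ) (A : List ℕ) : Set where
    field
      bounded : All (_≤ l) A
      bottom : 1 ≤ cnt 0 A
      shape : Symmetric l A ⊎ (X × Defective l A)

  cnt-ᵒ-cong : ∀ k {l l'} {A B} → All (_≤ l) A → All (_≤ l') B →
    (∀ i → i ≤ k → cnt i A ≡ cnt i (A ᵒ l)) → (∀ i → i ≤ k → cnt i B ≡ cnt i (B ᵒ l')) →
    cnt k (A ⊗ B) ≡ cnt k ((A ⊗ B) ᵒ (l + l'))
  cnt-ᵒ-cong k {l} {l'} {A} {B} as bs p q = begin
    cnt k (A ⊗ B)                                  ≡⟨ cnt-⊗ k A B ⟩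
    conv k (λ i → cnt i A) (λ i → cnt i B)         ≡⟨ conv-cong k p q ⟩
    conv k (λ i → cnt i (A ᵒ l)) (λ i → cnt i (B ᵒ l')) ≡⟨ cnt-⊗ k (A ᵒ l) (B ᵒ l') ⟨
    cnt k (A ᵒ l ⊗ B ᵒ l')                         ≡⟨ cong (cnt k) (⊗-ᵒ as bs) ⟨
    cnt k ((A ⊗ B) ᵒ (l + l')) ∎
    where open ≡-Reasoning

  -- With agreement below 3, the third coefficients of the products differ only in the end terms
  -- `f 0 * g 3` and `f 3 * g 0`.
  conv-3-< : ∀ {f f' g g'} → (∀ i → i ≤ 2 → f i ≡ f' i) → (∀ i → i ≤ 2 → g i ≡ g' i) → 1 ≤ f 0 → 1 ≤ g 0 →
    f 3 ≤ f' 3 → g 3 ≤ g' 3 → f 3 < f' 3 ⊎ g 3 < g' 3 → conv 3 f g < conv 3 f' g'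
  conv-3-< {f} {f'} {g} {g'} p q pos pos' le le' lt
    rewrite sym (p 0 z≤n) | sym (p 1 (s≤s z≤n)) | sym (p 2 ≤-refl) | sym (q 0 z≤n) | sym (q 1 (s≤s z≤n)) | sym (q 2 ≤-refl)
    = ends lt
    where
      scale : ∀ {n a b} → 1 ≤ n → a < b → n * a < n * b
      scale {suc n} _ h = *-monoʳ-< (suc n) h
      inner : ∀ {a b} → a ≤ b → f 1 * g 2 + (f 2 * g 1 + a) ≤ f 1 * g 2 + (f 2 * g 1 + b)
      inner h = +-monoʳ-≤ (f 1 * g 2) (+-monoʳ-≤ (f 2 * g 1) h)
      ends : f 3 < f' 3 ⊎ g 3 < g' 3 →
             f 0 * g 3 + (f 1 * g 2 + (f 2 * g 1 + f 3 * g 0)) < f 0 * g' 3 + (f 1 * g 2 + (f 2 * g 1 + f' 3 * g 0))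
      ends (inj₂ h) = +-mono-<-≤ (scale pos h) (inner (*-monoˡ-≤ (g 0) le))
      ends (inj₁ h) = +-mono-≤-< (*-monoʳ-≤ (f 0) le') (+-monoʳ-< (f 1 * g 2) (+-monoʳ-< (f 2 * g 1)
        (subst₂ _<_ (*-comm (g 0) (f 3)) (*-comm (g 0) (f' 3)) (scale pos' h))))

  Status-⊗ : ∀ {X l l' A B} → Status X l A → Status X l' B → Status X (l + l') (A ⊗ B)
  Status-⊗ {X} {l} {l'} {A} {B} SA SB = record
      { bounded = ⊗-≤ SA.bounded SB.bounded
      ; bottom = subst (1 ≤_) (sym (cnt-⊗ 0 A B)) (*-mono-≤ SA.bottom SB.bottom)
      ; shape = combine SA.shape SB.shape }
    where
      module SA = Status SA
      module SB = Status SB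
      strict : (∀ i → i ≤ 2 → cnt i A ≡ cnt i (A ᵒ l)) → (∀ i → i ≤ 2 → cnt i B ≡ cnt i (B ᵒ l')) →
               cnt 3 A ≤ cnt 3 (A ᵒ l) → cnt 3 B ≤ cnt 3 (B ᵒ l') →
               cnt 3 A < cnt 3 (A ᵒ l) ⊎ cnt 3 B < cnt 3 (B ᵒ l') → 3 ≤ l + l' → Defective (l + l') (A ⊗ B)
      strict p q le le' lt 3≤ = record
        { agree = λ k k≤2 → cnt-ᵒ-cong k SA.bounded SB.bounded (λ i i≤k → p i (≤-trans i≤k k≤2)) (λ i i≤k → q i (≤-trans i≤k k≤2))
        ; excess = subst₂ _<_ (sym (cnt-⊗ 3 A B)) (trans (sym (cnt-⊗ 3 (A ᵒ l) (B ᵒ l'))) (cong (cnt 3) (sym (⊗-ᵒ SA.bounded SB.bounded))))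
            (conv-3-< p q SA.bottom SB.bottom le le' lt)
        ; 3≤l = 3≤ }
      open Defective
      combine : Symmetric l A ⊎ (X × Defective l A) → Symmetric l' B ⊎ (X × Defective l' B) →
                Symmetric (l + l') (A ⊗ B) ⊎ (X × Defective (l + l') (A ⊗ B))
      combine (inj₁ p) (inj₁ q) = inj₁ λ k → cnt-ᵒ-cong k SA.bounded SB.bounded (λ i _ → p i) (λ i _ → q i)
      combine (inj₂ (x , D)) (inj₁ q) = inj₂ (x , strict (agree D) (λ i _ → q i) (<⇒≤ (excess D)) (≤-reflexive (q 3))
        (inj₁ (excess D)) (≤-trans (3≤l D) (m≤m+n l l')))
      combine (inj₁ p) (inj₂ (x , D)) = inj₂ (x , strict (λ i _ → p i) (agree D) (≤-reflexive (p 3)) (<⇒≤ (excess D))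
        (inj₂ (excess D)) (≤-trans (3≤l D) (m≤n+m l' l)))
      combine (inj₂ (x , D)) (inj₂ (_ , D')) = inj₂ (x , strict (agree D) (agree D') (<⇒≤ (excess D)) (<⇒≤ (excess D'))
        (inj₁ (excess D)) (≤-trans (3≤l D) (m≤m+n l l')))

  cnt-ᵒ : ∀ {l} A k → All (_≤ l) A → k ≤ l → cnt k (A ᵒ l) ≡ cnt (l ∸ k) A
  cnt-ᵒ [] k [] le = refl
  cnt-ᵒ {l} (a ∷ A) k (p ∷ ps) le = cong₂ _+_ (flip-δ (a Data.Nat.≟ l ∸ k)) (cnt-ᵒ A k ps le)
    where
      flip-δ : Dec (a ≡ l ∸ k) → δ (l ∸ a) k ≡ δ a (l ∸ k)
      flip-δ (yes refl) = trans (cong (λ x → δ x k) (m∸[m∸n]≡n le)) (trans (δ-refl k) (sym (δ-refl (l ∸ k))))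
      flip-δ (no n) = trans (δ-≢ (l ∸ a) k (λ { refl → n (sym (m∸[m∸n]≡n p)) })) (sym (δ-≢ a (l ∸ k) n))

-- Bruhat intervals as products

module Intervals (M : CoxeterMatrix) (no𝒯 : ¬ Coxeter.Contains𝒯 M) where
  open CoxeterMatrix M
  open Coxeter M
  open Words M
  open WordProblem M no𝒯
  open Bruhat M no𝒯
  open Coatoms M no𝒯
  open Counting

  record Interval (w : Word) (L : List Word) : Set where
    field
      reduced : All Reduced L
      lower : All (_≤B w) L
      distinct : Distinct L
      complete : ∀ x → x ≤B w → Any (x ≈_) L

  Interval-cong : ∀ {w w' L} → w ≈ w' → Interval w L → Interval w' L
  Interval-cong e I = record
    { reduced = reduced ; lower = All.map (≤B-respʳ e) lower ; distinct = distinct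
    ; complete = λ x p → complete x (≤B-respʳ (≈-sym e) p) }
    where open Interval I

  lens : List Word → List ℕ
  lens = map length

  coeff : ∀ {w L} → Interval w L → ∀ i → Coeff w i (cnt i (lens L))
  coeff {w} {L} I i = filter has L , cnt-filter length i L ,
      All.tabulate (λ p → let q , e = ∈-filter⁻ has p in All.lookup lower q , (_ , ≈-refl , All.lookup reduced q , e)) ,
      AllPairsₚ.filter⁺ has distinct , covers
    where
      open Interval I
      has : (x : Word) → Dec (length x ≡ i)
      has x = length x Data.Nat.≟ i
      covers : ∀ x → Lower w i x → Any (x ≈_) (filter has L)
      covers x (p , len) with find (complete x p)
      ... | y , y∈L , e = lose (∈-filter⁺ has y∈L (trans (sym (ℓ-reduced (All.lookup reduced y∈L))) (trans (sym (ℓ-cong e)) (Len⇒ℓ len)))) e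

  Count-unique : ∀ {P c c'} → Count P c → Count P c' → c ≡ c'
  Count-unique (L , refl , ps , ds , cov) (L' , refl , ps' , ds' , cov') =
    ≤-antisym (cover-length ds (All.map (cov' _) ps)) (cover-length ds' (All.map (cov _) ps'))

  ⊆-++⁻ : ∀ v {u z : Word} → z ⊆ v ++ u → Σ Word λ z₁ → Σ Word λ z₂ → z₁ ⊆ v × z₂ ⊆ u × z ≡ z₁ ++ z₂
  ⊆-++⁻ [] p = [] , _ , [] , p , refl
  ⊆-++⁻ (x ∷ v) (_ Sub.∷ʳ p) with ⊆-++⁻ v p
  ... | z₁ , z₂ , q , r , e = z₁ , z₂ , Sub._∷ʳ_ x q , r , e
  ⊆-++⁻ (x ∷ v) (refl ∷ p) with ⊆-++⁻ v p
  ... | z₁ , z₂ , q , r , e = x ∷ z₁ , z₂ , refl ∷ q , r , cong (x ∷_) e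

  Inner : S → Word → S → Set
  Inner s u x = x ≢ s × Dsc x u

  -- V represents the part of [e, v] in W^J, where J = S ∖ {s}, and every other letter of v is a left
  -- descent of u; then multiplication is a bijection V × [e, u] → [e, v u].
  record Factor (s : S) (v u : Word) (V : List Word) : Set where
    field
      additive : All (λ x → ℓ (x ++ u) ≡ length x + ℓ u) V
      letters : All (All (λ x → x ≡ s ⊎ Inner s u x)) V
      distinct : Distinct V
      subwords : All (λ x → Σ Word λ z → z ⊆ v × x ≈ z) V
      complete : ∀ z → z ⊆ v → Σ Word λ x → Σ Word λ y → x ∈ V × All (Inner s u) y × z ≈ x ++ y
      top : v ∈ V

  additive⇒reduced : ∀ {x u} → ℓ (x ++ u) ≡ length x + ℓ u → Reduced x
  additive⇒reduced {x} {u} e = ℓ⇒reduced (≤-antisym (ℓ≤length x)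
    (+-cancelʳ-≤ (ℓ u) _ _ (subst (_≤ ℓ x + ℓ u) e (ℓ-++≤ x u))))

  -- `x u ≈ (x j)(j u)`, and `j u` is shorter than `u`, so `x j` must make up for it.
  additive-∷ʳ : ∀ {x u j} → ℓ (x ++ u) ≡ length x + ℓ u → Dsc j u → length x < ℓ (x ++ j ∷ [])
  additive-∷ʳ {x} {u} {j} e d = +-cancelʳ-≤ (ℓ (j ∷ u)) _ _ (subst (_≤ ℓ (x ++ j ∷ []) + ℓ (j ∷ u))
    (trans (ℓ-cong (≈-trans (≡⇒≈ (++-assoc x _ _)) (++-congˡ x (ss≈ j u)))) (trans e (trans (cong (length x +_) (ℓ-dsc d)) (+-suc _ _))))
    (ℓ-++≤ (x ++ j ∷ []) (j ∷ u)))

  module Product {s v u V L} (us : All (_≢ s) u) (rvu : Reduced (v ++ u)) (F : Factor s v u V) (I : Interval u L) where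
    private
      module F = Factor F
      module I = Interval I

    -- A right descent `j ≢ s` of `x` occurs in `x`, so it is a left descent of `u`, against the
    -- additivity of `x u`.
    minimal : ∀ {x} → x ∈ V → MinR s x
    minimal {x} x∈V = no-right-descent⇒MinR λ (j , j≢s , lt) → descends j lt (inner j≢s (letter j lt))
      where
        letter : ∀ j → ℓ (x ++ j ∷ []) < ℓ x → j ∈ x
        letter j lt = Anyₚ.reverse⁻ (Dsc⇒∈ (subst₂ _<_ (ℓ-∷ʳ x j) (sym (ℓ-reverse x)) lt))
        inner : ∀ {j} → j ≢ s → j ∈ x → Dsc j u
        inner j≢s p = [ ⊥-elim ∘ j≢s , proj₂ ]′ (All.lookup (All.lookup F.letters x∈V) p)
        descends : ∀ j → ℓ (x ++ j ∷ []) < ℓ x → ¬ Dsc j u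
        descends j lt d = <-irrefl refl (<-trans lt (≤-<-trans (ℓ≤length x) (additive-∷ʳ {x} {u} (All.lookup F.additive x∈V) d)))

    outer : ∀ {y} → y ∈ L → All (_≢ s) y
    outer {y} y∈L with ≤B⇒⊆ (All.lookup I.lower y∈L) (Reduced-suffix v rvu) ≈-refl
    ... | z , sub , e = All.map (λ p → All.lookup us (Sub.lookup sub p)) (reduced-support (All.lookup I.reduced y∈L) e)

    products : List Word
    products = cartesianProductWith _++_ V L

    lens-products : lens products ≡ lens V ⊗ lens L
    lens-products = go V
      where
        row : ∀ (x : Word) L → lens (map (x ++_) L) ≡ map (length x +_) (lens L)
        row x [] = refl
        row x (y ∷ L) = cong₂ _∷_ (length-++ x) (row x L)
        go : ∀ V → lens (cartesianProductWith _++_ V L) ≡ lens V ⊗ lens L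
        go [] = refl
        go (x ∷ V) = trans (map-++ length (map (x ++_) L) _) (cong₂ _++_ (row x L) (go V))

    products-all : ∀ {P : Word → Set} → (∀ {x y} → x ∈ V → y ∈ L → P (x ++ y)) → All P products
    products-all {P} h = All.tabulate λ p → let x , y , x∈ , y∈ , e = ∈-cartesianProductWith⁻ _++_ V L p in subst P (sym e) (h x∈ y∈)

    products-distinct : Distinct products
    products-distinct = go V F.distinct (λ p → p)
      where
        go : ∀ V' → Distinct V' → (∀ {x} → x ∈ V' → x ∈ V) → Distinct (cartesianProductWith _++_ V' L)
        go [] _ _ = []
        go (x ∷ V') (d ∷ ds) inV = AllPairsₚ.++⁺
          (AllPairsₚ.map⁺ (AllPairs.map (λ n e → n (++-cancelˡ x e)) I.distinct)) (go V' ds (inV ∘ there))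
          (Allₚ.map⁺ (All.tabulate λ y∈ → All.tabulate λ p e →
            let x' , y' , x'∈ , y'∈ , eq = ∈-cartesianProductWith⁻ _++_ V' L p in
            All.lookup d x'∈ (proj₁ (MinR-unique (minimal (inV (here refl))) (minimal (inV (there x'∈))) (outer y∈) (outer y'∈)
              (≈-trans e (≡⇒≈ eq))))))

    interval : Interval (v ++ u) products
    interval = record
      { reduced = products-all λ {x} {y} x∈ y∈ → ℓ⇒reduced (trans (MinR-++ (minimal x∈) (outer y∈))
          (trans (cong₂ _+_ (ℓ-reduced (additive⇒reduced {x} {u} (All.lookup F.additive x∈))) (ℓ-reduced (All.lookup I.reduced y∈))) (sym (length-++ x))))
      ; lower = products-all below
      ; distinct = products-distinct
      ; complete = complete }
      where
        below : ∀ {x y} → x ∈ V → y ∈ L → x ++ y ≤B v ++ u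
        below {x} {y} x∈ y∈ with All.lookup F.subwords x∈ | ≤B⇒⊆ (All.lookup I.lower y∈) (Reduced-suffix v rvu) ≈-refl
        ... | z , sub , e | z' , sub' , e' = ≤B-trans (≤B-refl (≈-trans (++-congʳ y e) (++-congˡ z e'))) (⊆⇒≤B (Subₚ.++⁺ sub sub') rvu)
        absorb : ∀ {y z} → All (Inner s u) y → z ≤B u → y ++ z ≤B u
        absorb [] p = p
        absorb ((_ , d) ∷ ds) p = Dsc-≤B d (absorb ds p)
        -- The surplus `y` in a subword of `v` consists of left descents of `u`; multiplied onto an
        -- element below `u` it stays below `u`.
        complete : ∀ x → x ≤B v ++ u → Any (x ≈_) products
        complete x p with ≤B⇒⊆ p rvu ≈-refl
        ... | z , sub , e with ⊆-++⁻ v sub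
        ...   | z₁ , z₂ , sub₁ , sub₂ , refl with F.complete z₁ sub₁
        ...     | x' , y , x'∈ , ys , f with find (I.complete (y ++ z₂) (absorb ys (⊆⇒≤B sub₂ (Reduced-suffix v rvu))))
        ...       | y' , y'∈ , g = lose (∈-cartesianProductWith⁺ _++_ x'∈ y'∈)
                      (≈-trans e (≈-trans (++-congʳ z₂ f) (≈-trans (≡⇒≈ (++-assoc x' y z₂)) (++-congˡ x' g))))

-- Factors of alternating words and of pairs

module Factors (M : CoxeterMatrix) (no𝒯 : ¬ Coxeter.Contains𝒯 M) where
  open CoxeterMatrix M
  open Coxeter M
  open Words M
  open Tree M no𝒯 using (Below; alt-exact)
  open WordProblem M no𝒯
  open Bruhat M no𝒯
  open Coatoms M no𝒯
  open Triangles M no𝒯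
  open Classification M no𝒯 using (spiral)
  open Counting
  open Intervals M no𝒯

  record Factored (s : S) (v u : Word) : Set where
    constructor factored
    field
      elements : List Word
      isFactor : Factor s v u elements
      status : Status Contains33c (length v) (lens elements)

  mirror : ∀ n {f g : ℕ → ℕ} → (∀ i j → i + j ≡ n → g i ≡ f j) → applyUpTo g (suc n) ↭ applyUpTo f (suc n)
  mirror zero h = ↭-reflexive (cong (_∷ []) (h 0 0 refl))
  mirror (suc n) {f} {g} h = ↭-trans (↭-reflexive (cong (_∷ applyUpTo (g ∘ suc) (suc n)) (h 0 (suc n) refl)))
    (↭-trans (prep _ (mirror n {f} {g ∘ suc} λ i j e → h (suc i) j (cong suc e)))
      (↭-trans (Permₚ.∷↭∷ʳ _ _) (↭-reflexive (applyUpTo-∷ʳ f (suc n)))))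

  lens-applyUpTo : ∀ (f : ℕ → Word) {g} n → (∀ i → length (f i) ≡ g i) → lens (applyUpTo f n) ≡ applyUpTo g n
  lens-applyUpTo f n h = trans (map-applyUpTo f length n) (applyUpTo-cong h n)

  applyUpTo-≤ : ∀ {f : ℕ → ℕ} {l} n → (∀ {i} → i < n → f i ≤ l) → All (_≤ l) (applyUpTo f n)
  applyUpTo-≤ {f} n h = Allₚ.applyUpTo⁺₁ f n h

  reduced≈⇒length : ∀ {x y} → Reduced x → Reduced y → x ≈ y → length x ≡ length y
  reduced≈⇒length rx ry e = trans (sym (ℓ-reduced rx)) (trans (ℓ-cong e) (ℓ-reduced ry))

  graded-distinct : ∀ (f : ℕ → Word) d n → (∀ {i} → i < n → Reduced (f i)) → (∀ i → length (f i) ≡ d + i) → Distinct (applyUpTo f n)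
  graded-distinct f d n r l = AllPairsₚ.applyUpTo⁺₁ f n λ {i} {j} i<j j<n e → <-irrefl (+-cancelˡ-≡ d i j
    (trans (sym (l i)) (trans (reduced≈⇒length (r (<-trans i<j j<n)) (r j<n) e) (l j)))) i<j

  -- Alternating words with a fixed last letter

  -- The letter that continues `E n a b` on the left, see `E-cons`.
  lt : ℕ → S → S → S
  lt zero a b = b
  lt (suc n) a b = lt n b a

  E-cons : ∀ n a b → E (suc n) a b ≡ lt n a b ∷ E n a b
  E-cons zero a b = refl
  E-cons (suc n) a b = cong (_++ b ∷ []) (E-cons n b a)

  lt-cases : ∀ n {a b x} → x ≡ a ⊎ x ≡ b → x ≡ lt n a b ⊎ x ≡ lt (suc n) a b
  lt-cases zero (inj₁ p) = inj₂ p
  lt-cases zero (inj₂ p) = inj₁ p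
  lt-cases (suc n) p = lt-cases n (Sum.swap p)

  E-⊆ : ∀ {i n a b} → i ≤ n → E i a b ⊆ E n a b
  E-⊆ {i} {n} {a} {b} le = subst (λ k → E i a b ⊆ E k a b) (m∸n+n≡m le) (go (n ∸ i))
    where
      go : ∀ k → E i a b ⊆ E (k + i) a b
      go zero = ⊆-refl
      go (suc k) = subst (E i a b ⊆_) (sym (E-cons (k + i) a b)) (Sub._∷ʳ_ _ (go k))

  E-mult : ∀ i {a b x} → x ≡ a ⊎ x ≡ b →
    x ∷ E i a b ≈ E (suc i) a b ⊎ (Σ ℕ λ k → i ≡ suc k × x ∷ E i a b ≈ E k a b) ⊎ (i ≡ 0 × x ≡ a)
  E-mult i {a} {b} p with lt-cases i p
  ... | inj₁ refl = inj₁ (≡⇒≈ (sym (E-cons i a b)))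
  E-mult zero p | inj₂ refl = inj₂ (inj₂ (refl , refl))
  E-mult (suc k) {a} {b} p | inj₂ refl = inj₂ (inj₁ (k , refl ,
    ≈-trans (≡⇒≈ (cong (lt k a b ∷_) (E-cons k a b))) (ss≈ _ _)))

  E-braid : ∀ {a b n} → m a b ≡ just n → E n a b ≈ E n b a
  E-braid {a} {b} {n} e = ≈-trans (≡⇒≈ (E≡reverse n a b))
    (≈-trans (reverse-cong (≈-sym (alt-braid a b n e))) (≡⇒≈ (sym (E≡reverse n b a))))

  -- The descent `a` is borrowed from `G`: the word becomes `E (suc i) b a` in front of `a G`, of
  -- which neither letter is a descent.
  E-absorb : ∀ i {a b G} → a ≢ b → Below (suc i) a b → Dsc a G → ¬ Dsc b (a ∷ G) → ℓ (E i a b ++ G) ≡ i + ℓ G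
  E-absorb i {a} {b} {G} ab bd da hb = begin
    ℓ (E i a b ++ G)               ≡⟨ ℓ-cong (++-congˡ (E i a b) (≈-sym (ss≈ a G))) ⟩
    ℓ (E i a b ++ a ∷ a ∷ G)       ≡⟨ cong ℓ (sym (E-snoc i b a (a ∷ G))) ⟩
    ℓ (E (suc i) b a ++ a ∷ G)     ≡⟨ ℓ-E (suc i) (ab ∘ sym) (Below-sym bd) hb (Dsc⇒asc da) ⟩
    suc i + ℓ (a ∷ G)              ≡⟨ sym (+-suc i _) ⟩
    i + suc (ℓ (a ∷ G))            ≡⟨ cong (i +_) (sym (ℓ-dsc da)) ⟩
    i + ℓ G ∎
    where open ≡-Reasoning

  module _ {s : S} {u : Word} (us : All (_≢ s) u) where

    s-ascent : ¬ Dsc s u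
    s-ascent d = All.lookup us (Dsc⇒∈ d) refl

    s-ascent' : ∀ {a} → a ≢ s → ¬ Dsc s (a ∷ u)
    s-ascent' n d with Dsc⇒∈ d
    ... | here p = n (sym p)
    ... | there p = All.lookup us p refl

    single-factor : Factored s (s ∷ []) u
    single-factor = factored ([] ∷ (s ∷ []) ∷ []) (record
        { additive = refl ∷ ℓ-asc s-ascent ∷ []
        ; letters = [] ∷ (inj₁ refl ∷ []) ∷ []
        ; distinct = ((λ e → 0≢1+n (reduced≈⇒length {[]} (λ _ _ → z≤n) (additive⇒reduced {s ∷ []} {u} (ℓ-asc s-ascent)) e)) ∷ []) ∷ [] ∷ []
        ; subwords = ([] , minimum _ , ≈-refl) ∷ (s ∷ [] , ⊆-refl , ≈-refl) ∷ []
        ; complete = λ { .[] (_ Sub.∷ʳ []) → [] , [] , here refl , [] , ≈-refl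
                       ; (_ ∷ .[]) (refl ∷ []) → s ∷ [] , [] , there (here refl) , [] , ≈-refl }
        ; top = there (here refl) })
      (record { bounded = z≤n ∷ ≤-refl ∷ [] ; bottom = ≤-refl ; shape = inj₁ λ k → cnt-↭ k (Perm.swap {xs = []} 0 1 ↭-refl) })

    -- The representatives are the `E i a s` with `i ≤ n`, one in each rank.
    chain-factor : ∀ n {a} → a ≢ s → Below (suc n) a s → Dsc a u → Factored s (E n a s) u
    chain-factor n {a} as bd da = factored V (record
        { additive = additive
        ; letters = Allₚ.applyUpTo⁺₁ f (suc n) λ {i} _ → All.map (λ { (inj₁ refl) → inj₂ (as , da) ; (inj₂ p) → inj₁ p }) (E-letters i a s)
        ; distinct = graded-distinct f 0 (suc n) (λ {i} lt → E-reduced i as (Below-≤ (<⇒≤ lt) bd)) (λ i → length-E i a s)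
        ; subwords = Allₚ.applyUpTo⁺₁ f (suc n) λ {i} lt → E i a s , E-⊆ (s≤s⁻¹ lt) , ≈-refl
        ; complete = λ z sub → convert (complete n z sub)
        ; top = ∈-applyUpTo⁺ f ≤-refl })
      (record
        { bounded = subst (All (_≤ l)) (sym lens≡) (applyUpTo-≤ {id} (suc n) (λ lt → subst (_ ≤_) (sym (length-E n a s)) (s≤s⁻¹ lt)))
        ; bottom = subst (λ A → 1 ≤ cnt 0 A) (sym lens≡) (m≤m+n 1 _)
        ; shape = inj₁ λ k → trans (cong (cnt k) lens≡) (sym (trans (cong (λ A → cnt k (A ᵒ l)) lens≡)
            (trans (cong (cnt k) (map-applyUpTo id (l ∸_) (suc n))) (cnt-↭ k (mirror n {id} {l ∸_} λ i j e →
              trans (cong (_∸ i) (trans (length-E n a s) (sym e))) (m+n∸m≡n i j)))))) })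
      where
        f : ℕ → Word
        f i = E i a s
        V : List Word
        V = applyUpTo f (suc n)
        l : ℕ
        l = length (E n a s)
        lens≡ : lens V ≡ applyUpTo id (suc n)
        lens≡ = lens-applyUpTo f (suc n) (λ i → length-E i a s)
        additive : All (λ x → ℓ (x ++ u) ≡ length x + ℓ u) V
        additive = Allₚ.applyUpTo⁺₁ f (suc n) λ {i} lt → trans (absorb i lt) (cong (_+ ℓ u) (sym (length-E i a s)))
          where
            absorb : ∀ i → i < suc n → ℓ (E i a s ++ u) ≡ i + ℓ u
            absorb i lt = E-absorb i as (Below-≤ lt bd) da (s-ascent' as)
        convert : ∀ {z} → (Σ ℕ λ i → Σ Word λ y → i ≤ n × All (Inner s u) y × z ≈ E i a s ++ y) →
                  Σ Word λ x → Σ Word λ y → x ∈ V × All (Inner s u) y × z ≈ x ++ y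
        convert (i , y , le , ys , e) = E i a s , y , ∈-applyUpTo⁺ f (s≤s le) , ys , e
        complete : ∀ n z → z ⊆ E n a s → Σ ℕ λ i → Σ Word λ y → i ≤ n × All (Inner s u) y × z ≈ E i a s ++ y
        complete zero .[] [] = 0 , [] , z≤n , [] , ≈-refl
        complete (suc n) z sub = cases (lt n a s) refl (subst (z ⊆_) (E-cons n a s) sub)
          where
            letter : lt n a s ≡ a ⊎ lt n a s ≡ s
            letter = All.head (subst (All _) (E-cons n a s) (E-letters (suc n) a s))
            mult : ∀ {z x} → x ≡ a ⊎ x ≡ s → (Σ ℕ λ i → Σ Word λ y → i ≤ n × All (Inner s u) y × z ≈ E i a s ++ y) →
                   Σ ℕ λ i → Σ Word λ y → i ≤ suc n × All (Inner s u) y × x ∷ z ≈ E i a s ++ y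
            mult {z} {x} p (i , y , le , ys , e) with E-mult i p
            ... | inj₁ g = suc i , y , s≤s le , ys , ≈-trans (∷-cong x e) (++-congʳ y g)
            ... | inj₂ (inj₁ (k , refl , g)) = k , y , ≤-trans (n≤1+n k) (m≤n⇒m≤1+n le) , ys , ≈-trans (∷-cong x e) (++-congʳ y g)
            ... | inj₂ (inj₂ (refl , refl)) = 0 , a ∷ y , z≤n , (as , da) ∷ ys , ∷-cong a e
            cases : ∀ x {z} → x ≡ lt n a s → z ⊆ x ∷ E n a s → Σ ℕ λ i → Σ Word λ y → i ≤ suc n × All (Inner s u) y × z ≈ E i a s ++ y
            cases x _ (_ Sub.∷ʳ p) with complete n _ p
            ... | i , y , le , ys , e = i , y , m≤n⇒m≤1+n le , ys , e
            cases x refl (refl ∷ p) = mult letter (complete n _ p)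

    -- The representatives are `E i b s` and `E i s b c s` for `i ≤ n`. Their lengths, 0 to `n` and
    -- 2 to `n + 2`, are exchanged by reversal.
    module Pair (n : ℕ) {b c} (t : Tri s b c) (sb : m s b ≡ just (suc n)) (sc : m s c ≡ just 3) (db : Dsc b u) (dc : Dsc c u) where

      private
        s≢b : s ≢ b
        s≢b = proj₁ (proj₁ t)
        s≢c : s ≢ c
        s≢c = proj₁ (proj₁ (proj₂ t))
        b≢c : b ≢ c
        b≢c = proj₁ (proj₂ (proj₂ t))
        cs : Word
        cs = c ∷ s ∷ []
        v : Word
        v = E n s b ++ cs
        f g : ℕ → Word
        f i = E i b s
        g i = E i s b ++ cs
        V : List Word
        V = applyUpTo f (suc n) ++ applyUpTo g (suc n)
        bd : ∀ {i} → i ≤ suc n → Below i s b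
        bd = order-Below sb
        ib : Inner s u b
        ib = s≢b ∘ sym , db
        ic : Inner s u c
        ic = s≢c ∘ sym , dc
        open Step (spiral-step {p = c} {q = b} {r = s} (flip (rot (rot t))) (trans (m-sym c s) sc) dc db)

        length-g : ∀ i → length (g i) ≡ 2 + i
        length-g i = trans (length-++ (E i s b)) (trans (cong (_+ 2) (length-E i s b)) (+-comm i 2))

        f-additive : ∀ {i} → i < suc n → ℓ (f i ++ u) ≡ length (f i) + ℓ u
        f-additive {i} lt = trans (E-absorb i (s≢b ∘ sym) (Below-sym (bd lt)) db (s-ascent' (s≢b ∘ sym))) (cong (_+ ℓ u) (sym (length-E i b s)))

        g-additive : ∀ {i} → i < suc n → ℓ (g i ++ u) ≡ length (g i) + ℓ u
        g-additive {i} lt = trans (cong ℓ (++-assoc (E i s b) cs u))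
          (trans (E-absorb i s≢b (bd lt) descent-r (third-ascent (rot t) descent-p descent-r))
            (trans (cong (i +_) grows) (trans (sym (+-assoc i 2 (ℓ u))) (cong (_+ ℓ u) (trans (+-comm i 2) (sym (length-g i)))))))

        -- Normal forms up to inner letters on the right. Completeness follows because left
        -- multiplication by `s` or `b` preserves them.
        data Form (z : Word) : Set where
          low  : ∀ i y → i ≤ n → All (Inner s u) y → z ≈ E i b s ++ y → Form z
          high : ∀ i y → i ≤ n → All (Inner s u) y → z ≈ E i s b ++ c ∷ s ∷ y → Form z

        mult : ∀ {x z} → x ≡ s ⊎ x ≡ b → Form z → Form (x ∷ z)
        mult {x} p (low i y le ys e) with E-mult i (Sum.swap p)
        ... | inj₂ (inj₁ (k , refl , h)) = low k y (≤-trans (n≤1+n k) le) ys (≈-trans (∷-cong x e) (++-congʳ y h))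
        ... | inj₂ (inj₂ (refl , refl)) = low 0 (b ∷ y) z≤n (ib ∷ ys) (∷-cong b e)
        ... | inj₁ h with i Data.Nat.≟ n
        ...   | no ne = low (suc i) y (≤∧≢⇒< le ne) ys (≈-trans (∷-cong x e) (++-congʳ y h))
        -- At the top the longest element is rewritten with last letter `b`, which leaves to the
        -- right as an inner letter.
        ...   | yes refl = low n (b ∷ y) ≤-refl (ib ∷ ys) (≈-trans (∷-cong x e) (≈-trans (++-congʳ y (≈-trans h (≈-sym (E-braid sb))))
                  (≡⇒≈ (E-snoc n s b y))))
        mult {x} p (high i y le ys e) with E-mult i p
        ... | inj₂ (inj₁ (k , refl , h)) = high k y (≤-trans (n≤1+n k) le) ys (≈-trans (∷-cong x e) (++-congʳ (c ∷ s ∷ y) h))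
        ... | inj₂ (inj₂ (refl , refl)) = high 0 (c ∷ y) z≤n (ic ∷ ys) (≈-trans (∷-cong s e) (++-congʳ y (alt-braid s c 3 sc)))
        ... | inj₁ h with i Data.Nat.≟ n
        ...   | no ne = high (suc i) y (≤∧≢⇒< le ne) ys (≈-trans (∷-cong x e) (++-congʳ (c ∷ s ∷ y) h))
        ...   | yes refl = high n (c ∷ y) ≤-refl (ic ∷ ys) (≈-trans (∷-cong x e) (≈-trans (++-congʳ (c ∷ s ∷ y) (≈-trans h (E-braid sb)))
                  (≈-trans (≡⇒≈ (E-snoc n b s (c ∷ s ∷ y))) (++-congˡ (E n s b) (++-congʳ y (alt-braid s c 3 sc))))))

        mults : ∀ {x z} → All (λ a → a ≡ s ⊎ a ≡ b) x → Form z → Form (x ++ z)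
        mults [] F = F
        mults (p ∷ ps) F = mult p (mults ps F)

        base : ∀ {z} → z ⊆ cs → Form z
        base (_ Sub.∷ʳ _ Sub.∷ʳ []) = low 0 [] z≤n [] ≈-refl
        base (_ Sub.∷ʳ refl ∷ []) = mult (inj₁ refl) (low 0 [] z≤n [] ≈-refl)
        base (refl ∷ _ Sub.∷ʳ []) = low 0 (c ∷ []) z≤n (ic ∷ []) ≈-refl
        base (refl ∷ refl ∷ []) = high 0 [] z≤n [] ≈-refl

        complete : ∀ z → z ⊆ v → Σ Word λ x → Σ Word λ y → x ∈ V × All (Inner s u) y × z ≈ x ++ y
        complete z sub with ⊆-++⁻ (E n s b) sub
        ... | z₁ , z₂ , sub₁ , sub₂ , refl with mults (All-⊆ sub₁ (E-letters n s b)) (base sub₂)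
        ...   | low i y le ys e = f i , y , ∈-++⁺ˡ (∈-applyUpTo⁺ f (s≤s le)) , ys , e
        ...   | high i y le ys e = g i , y , ∈-++⁺ʳ (applyUpTo f (suc n)) (∈-applyUpTo⁺ g (s≤s le)) , ys , ≈-trans e (≡⇒≈ (sym (++-assoc (E i s b) cs y)))

        E-⊆-snoc : ∀ i → i ≤ n → E i b s ⊆ v
        E-⊆-snoc zero _ = minimum _
        E-⊆-snoc (suc i) le = Subₚ.++⁺ (E-⊆ (≤-trans (n≤1+n i) le)) (Sub._∷ʳ_ c (refl ∷ []))

        cross : ∀ {i j} → i < suc n → j < suc n → ¬ (f i ≈ g j)
        cross {i} {j} _ lt e = [ (λ p → b≢c (sym p)) , (λ p → s≢c (sym p)) ]′ (All.lookup (E-letters i b s)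
          (All.lookup (reduced-support (additive⇒reduced {g j} {u} (g-additive lt)) (≈-sym e)) (∈-++⁺ʳ (E j s b) (here refl))))

        lens≡ : lens V ≡ applyUpTo id (suc n) ++ applyUpTo (2 +_) (suc n)
        lens≡ = trans (map-++ length (applyUpTo f (suc n)) _) (cong₂ _++_ (lens-applyUpTo f (suc n) (λ i → length-E i b s)) (lens-applyUpTo g (suc n) length-g))

        symmetric : Symmetric (2 + n) (lens V)
        symmetric k = begin
          cnt k (lens V)                      ≡⟨ cong (cnt k) lens≡ ⟩
          cnt k (A ++ B)                      ≡⟨ cnt-++ k A B ⟩
          cnt k A + cnt k B                   ≡⟨ +-comm (cnt k A) _ ⟩
          cnt k B + cnt k A                   ≡⟨ cong₂ _+_ (cnt-↭ k A↭) (cnt-↭ k B↭) ⟨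
          cnt k (A ᵒ l) + cnt k (B ᵒ l)       ≡⟨ cnt-++ k (A ᵒ l) (B ᵒ l) ⟨
          cnt k (A ᵒ l ++ B ᵒ l)              ≡⟨ cong (cnt k) (sym (map-++ (l ∸_) A B)) ⟩
          cnt k ((A ++ B) ᵒ l)                ≡⟨ cong (λ A → cnt k (A ᵒ l)) lens≡ ⟨
          cnt k (lens V ᵒ l) ∎
          where
            open ≡-Reasoning
            l : ℕ
            l = 2 + n
            A B : List ℕ
            A = applyUpTo id (suc n)
            B = applyUpTo (2 +_) (suc n)
            A↭ : A ᵒ l ↭ B
            A↭ = ↭-trans (↭-reflexive (map-applyUpTo id (l ∸_) (suc n))) (mirror n {2 +_} {l ∸_} λ { i j refl →
              trans (cong (_∸ i) (trans (sym (+-suc (suc i) j)) (sym (+-suc i (suc j))))) (m+n∸m≡n i (2 + j)) })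
            B↭ : B ᵒ l ↭ A
            B↭ = ↭-trans (↭-reflexive (map-applyUpTo (2 +_) (l ∸_) (suc n))) (mirror n {id} {λ i → l ∸ (2 + i)} λ { i j refl → m+n∸m≡n i j })

      pair-factor : Factored s v u
      pair-factor = factored V (record
          { additive = Allₚ.++⁺ (Allₚ.applyUpTo⁺₁ f (suc n) f-additive) (Allₚ.applyUpTo⁺₁ g (suc n) g-additive)
          ; letters = Allₚ.++⁺
              (Allₚ.applyUpTo⁺₁ f (suc n) λ {i} _ → All.map (λ { (inj₁ refl) → inj₂ ib ; (inj₂ p) → inj₁ p }) (E-letters i b s))
              (Allₚ.applyUpTo⁺₁ g (suc n) λ {i} _ → Allₚ.++⁺ (All.map (λ { (inj₁ p) → inj₁ p ; (inj₂ refl) → inj₂ ib }) (E-letters i s b)) (inj₂ ic ∷ inj₁ refl ∷ []))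
          ; distinct = AllPairsₚ.++⁺ (graded-distinct f 0 (suc n) (λ {i} lt → additive⇒reduced {f i} {u} (f-additive lt)) (λ i → length-E i b s))
              (graded-distinct g 2 (suc n) (λ {i} lt → additive⇒reduced {g i} {u} (g-additive lt)) length-g)
              (Allₚ.applyUpTo⁺₁ f (suc n) λ lt → Allₚ.applyUpTo⁺₁ g (suc n) λ lt' → cross lt lt')
          ; subwords = Allₚ.++⁺ (Allₚ.applyUpTo⁺₁ f (suc n) λ {i} lt → f i , E-⊆-snoc i (s≤s⁻¹ lt) , ≈-refl)
              (Allₚ.applyUpTo⁺₁ g (suc n) λ {i} lt → g i , Subₚ.++⁺ (E-⊆ (s≤s⁻¹ lt)) ⊆-refl , ≈-refl)
          ; complete = complete
          ; top = ∈-++⁺ʳ (applyUpTo f (suc n)) (∈-applyUpTo⁺ g ≤-refl) })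
        (subst (λ l → Status Contains33c l (lens V)) (sym (length-g n)) (record
          { bounded = subst (All (_≤ 2 + n)) (sym lens≡) (Allₚ.++⁺ (applyUpTo-≤ {id} (suc n) (λ lt → ≤-trans (s≤s⁻¹ lt) (m≤n+m n 2))) (applyUpTo-≤ {2 +_} (suc n) (λ lt → s≤s lt)))
          ; bottom = subst (λ A → 1 ≤ cnt 0 A) (sym lens≡) (m≤m+n 1 _)
          ; shape = inj₁ symmetric }))

-- The exceptional factor

module TriangleFactors (M : CoxeterMatrix) (no𝒯 : ¬ Coxeter.Contains𝒯 M) where
  open CoxeterMatrix M
  open Coxeter M
  open Words M
  open Tree M no𝒯 using (Below; alt-exact)
  open WordProblem M no𝒯
  open Bruhat M no𝒯
  open Coatoms M no𝒯
  open Triangles M no𝒯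
  open Classification M no𝒯 using (spiral)
  open Counting
  open Intervals M no𝒯
  open Factors M no𝒯

  cnt-suc : ∀ k (f : ℕ → ℕ) n → cnt (suc k) (applyUpTo (suc ∘ f) n) ≡ cnt k (applyUpTo f n)
  cnt-suc k f zero = refl
  cnt-suc k f (suc n) = cong (δ (f 0) k +_) (cnt-suc k (f ∘ suc) n)

  cnt-zero : ∀ (f : ℕ → ℕ) n → cnt 0 (applyUpTo (suc ∘ f) n) ≡ 0
  cnt-zero f zero = refl
  cnt-zero f (suc n) = cnt-zero (f ∘ suc) n

  cnt-range-in : ∀ c i n → i < n → cnt (c + i) (applyUpTo (c +_) n) ≡ 1
  cnt-range-in (suc c) i n lt = trans (cnt-suc (c + i) (c +_) n) (cnt-range-in c i n lt)
  cnt-range-in zero zero (suc n) lt = cong suc (cnt-zero id n)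
  cnt-range-in zero (suc i) (suc n) lt = trans (cnt-suc i id n) (cnt-range-in zero i n (s≤s⁻¹ lt))

  cnt-range-out : ∀ c {k} n → k < c → cnt k (applyUpTo (c +_) n) ≡ 0
  cnt-range-out (suc c) {zero} n lt = cnt-zero (c +_) n
  cnt-range-out (suc c) {suc k} n lt = trans (cnt-suc k (c +_) n) (cnt-range-out c n (s≤s⁻¹ lt))

  module _ {s : S} {u : Word} (us : All (_≢ s) u) where

    -- Here [e, v] ∩ W^J has 1, 1, 2, 2 elements in ranks 0 to 3, but 1, 1, 2, 3 in coranks 0 to 3.
    module Double (n₀ : ℕ) {a b} (t : Tri a b s) (ab : m a b ≡ just (4 + n₀)) (as : m a s ≡ just 3) (bs : m b s ≡ just 3)
                  (da : Dsc a u) (db : Dsc b u) where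

      private
        n : ℕ
        n = 3 + n₀
        a≢b : a ≢ b
        a≢b = proj₁ (proj₁ t)
        a≢s : a ≢ s
        a≢s = proj₁ (proj₁ (proj₂ t))
        b≢s : b ≢ s
        b≢s = proj₁ (proj₂ (proj₂ t))
        sabs : Word
        sabs = s ∷ a ∷ b ∷ s ∷ []
        v : Word
        v = E n a b ++ sabs
        f₁ f₂ f₃ : ℕ → Word
        f₁ i = E i a b ++ s ∷ []
        -- The empty and the longest alternating word do not depend on the order of `a`, `b` and are
        -- counted in `f₁`; so `f₂` uses the lengths 1 to `n` only.
        f₂ i = E (suc i) b a ++ s ∷ []
        f₃ i = E i a b ++ sabs
        V₁ V₂ V₃ V : List Word
        V₁ = applyUpTo f₁ (2 + n)
        V₂ = applyUpTo f₂ n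
        V₃ = applyUpTo f₃ (suc n)
        V = [] ∷ V₁ ++ V₂ ++ V₃
        bd : ∀ {i} → i ≤ suc n → Below i a b
        bd = order-Below ab
        ia : Inner s u a
        ia = a≢s , da
        ib : Inner s u b
        ib = b≢s , db

        -- Two descents `s` and `x` of `s u` would by `peel₂` make `s` a descent of `x u`, a word
        -- without `s`.
        su-asc : ∀ {x} → NC s x → ¬ Dsc x (s ∷ u)
        su-asc {x} nc h = s-ascent' us (proj₁ nc ∘ sym) (Dsc-cong (∷-cong x (ss≈ s u))
          (peel₂ (proj₁ nc) (asc⇒Dsc (s-ascent us)) h nc))
        ¬a : ¬ Dsc a (s ∷ u)
        ¬a = su-asc (NC-sym (proj₁ (proj₂ t)))
        ¬b : ¬ Dsc b (s ∷ u)
        ¬b = su-asc (NC-sym (proj₂ (proj₂ t)))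

        module S₁ = Step (spiral-step {p = b} {q = a} {r = s} (flip (rot t)) bs db da)
        module S₂ = Step (spiral-step {p = s} {q = b} {r = a} (flip (rot (rot t))) (trans (m-sym s a) as) {b ∷ s ∷ u} S₁.descent-r S₁.descent-p)

        length-f₁ : ∀ i → length (f₁ i) ≡ 1 + i
        length-f₁ i = trans (length-++ (E i a b)) (trans (+-comm _ 1) (cong suc (length-E i a b)))
        length-f₂ : ∀ i → length (f₂ i) ≡ 2 + i
        length-f₂ i = trans (length-++ (E (suc i) b a)) (trans (+-comm _ 1) (cong suc (length-E (suc i) b a)))
        length-f₃ : ∀ i → length (f₃ i) ≡ 4 + i
        length-f₃ i = trans (length-++ (E i a b)) (trans (+-comm _ 4) (cong (4 +_) (length-E i a b)))

        one-additive : ∀ i {a b} → a ≢ b → Below i a b → ¬ Dsc a (s ∷ u) → ¬ Dsc b (s ∷ u) →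
                       ℓ ((E i a b ++ s ∷ []) ++ u) ≡ length (E i a b ++ s ∷ []) + ℓ u
        one-additive i {a} {b} a≢b bd ha hb = begin
          ℓ ((E i a b ++ s ∷ []) ++ u)          ≡⟨ cong ℓ (++-assoc (E i a b) _ u) ⟩
          ℓ (E i a b ++ s ∷ u)                  ≡⟨ ℓ-E i a≢b bd ha hb ⟩
          i + ℓ (s ∷ u)                         ≡⟨ cong (i +_) (ℓ-asc (s-ascent us)) ⟩
          i + (1 + ℓ u)                         ≡⟨ sym (+-assoc i 1 (ℓ u)) ⟩
          i + 1 + ℓ u                           ≡⟨ cong (λ k → k + 1 + ℓ u) (sym (length-E i a b)) ⟩
          length (E i a b) + 1 + ℓ u            ≡⟨ cong (_+ ℓ u) (sym (length-++ (E i a b))) ⟩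
          length (E i a b ++ s ∷ []) + ℓ u ∎
          where open ≡-Reasoning

        f₁-additive : ∀ {i} → i < 2 + n → ℓ (f₁ i ++ u) ≡ length (f₁ i) + ℓ u
        f₁-additive {i} lt = one-additive i a≢b (bd (s≤s⁻¹ lt)) ¬a ¬b
        f₂-additive : ∀ {i} → i < n → ℓ (f₂ i ++ u) ≡ length (f₂ i) + ℓ u
        f₂-additive {i} lt = one-additive (suc i) (a≢b ∘ sym) (Below-sym (bd (m≤n⇒m≤1+n lt))) ¬b ¬a
        f₃-additive : ∀ {i} → i < suc n → ℓ (f₃ i ++ u) ≡ length (f₃ i) + ℓ u
        f₃-additive {i} lt = begin
          ℓ (f₃ i ++ u)                  ≡⟨ cong ℓ (++-assoc (E i a b) sabs u) ⟩
          ℓ (E i a b ++ s ∷ a ∷ b ∷ s ∷ u) ≡⟨ E-absorb i a≢b (bd lt) S₂.descent-r (third-ascent (rot t) S₂.descent-p S₂.descent-r) ⟩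
          i + ℓ (s ∷ a ∷ b ∷ s ∷ u)      ≡⟨ cong (i +_) (trans S₂.grows (cong (2 +_) S₁.grows)) ⟩
          i + (4 + ℓ u)                  ≡⟨ sym (+-assoc i 4 (ℓ u)) ⟩
          i + 4 + ℓ u                    ≡⟨ cong (_+ ℓ u) (trans (+-comm i 4) (sym (length-f₃ i))) ⟩
          length (f₃ i) + ℓ u ∎
          where open ≡-Reasoning

        data Form (z : Word) : Set where
          nil  : ∀ y → All (Inner s u) y → z ≈ y → Form z
          one₁ : ∀ i y → i ≤ suc n → All (Inner s u) y → z ≈ E i a b ++ s ∷ y → Form z
          one₂ : ∀ i y → i ≤ n → All (Inner s u) y → z ≈ E i b a ++ s ∷ y → Form z
          two  : ∀ i y → i ≤ n → All (Inner s u) y → z ≈ E i a b ++ s ∷ a ∷ b ∷ s ∷ y → Form z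

        -- By two braids `a` passes through `s a b s` and comes out as `b`.
        swallow : ∀ y → a ∷ s ∷ a ∷ b ∷ s ∷ y ≈ s ∷ a ∷ b ∷ s ∷ b ∷ y
        swallow y = ≈-trans (++-congʳ (b ∷ s ∷ y) (alt-braid a s 3 as)) (++-congˡ (s ∷ a ∷ []) (++-congʳ y (≈-sym (alt-braid b s 3 bs))))

        over-top : ∀ {x} → x ∷ E (suc n) a b ≈ E (2 + n) a b → x ∷ E (suc n) a b ≈ E n b a
        over-top h = ≈-trans h (≈-trans (≡⇒≈ (E-cons (suc n) a b)) (≈-trans (∷-cong (lt n b a) (≈-trans (E-braid ab) (≡⇒≈ (E-cons n b a)))) (ss≈ _ _)))

        mult : ∀ {x z} → x ≡ a ⊎ x ≡ b → Form z → Form (x ∷ z)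
        mult {x} p (nil y ys e) = nil (x ∷ y) ([ (λ { refl → ia }) , (λ { refl → ib }) ]′ p ∷ ys) (∷-cong x e)
        mult {x} p (one₁ i y le ys e) with E-mult i p
        ... | inj₂ (inj₁ (k , refl , h)) = one₁ k y (≤-trans (n≤1+n k) le) ys (≈-trans (∷-cong x e) (++-congʳ (s ∷ y) h))
        ... | inj₂ (inj₂ (refl , refl)) = one₂ 1 y (s≤s z≤n) ys (∷-cong a e)
        ... | inj₁ h with i Data.Nat.≟ suc n
        ...   | no ne = one₁ (suc i) y (≤∧≢⇒< le ne) ys (≈-trans (∷-cong x e) (++-congʳ (s ∷ y) h))
        ...   | yes refl = one₂ n y ≤-refl ys (≈-trans (∷-cong x e) (++-congʳ (s ∷ y) (over-top h)))
        mult {x} p (one₂ i y le ys e) with E-mult i (Sum.swap p)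
        ... | inj₂ (inj₁ (k , refl , h)) = one₂ k y (≤-trans (n≤1+n k) le) ys (≈-trans (∷-cong x e) (++-congʳ (s ∷ y) h))
        ... | inj₂ (inj₂ (refl , refl)) = one₁ 1 y (s≤s z≤n) ys (∷-cong b e)
        ... | inj₁ h with i Data.Nat.≟ n
        ...   | no ne = one₂ (suc i) y (≤∧≢⇒< le ne) ys (≈-trans (∷-cong x e) (++-congʳ (s ∷ y) h))
        ...   | yes refl = one₁ (suc n) y ≤-refl ys (≈-trans (∷-cong x e) (++-congʳ (s ∷ y) (≈-trans h (≈-sym (E-braid ab)))))
        mult {x} p (two i y le ys e) with E-mult i p
        ... | inj₂ (inj₁ (k , refl , h)) = two k y (≤-trans (n≤1+n k) le) ys (≈-trans (∷-cong x e) (++-congʳ (s ∷ a ∷ b ∷ s ∷ y) h))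
        ... | inj₂ (inj₂ (refl , refl)) = two 0 (b ∷ y) z≤n (ib ∷ ys) (≈-trans (∷-cong a e) (swallow y))
        ... | inj₁ h with i Data.Nat.≟ n
        ...   | no ne = two (suc i) y (≤∧≢⇒< le ne) ys (≈-trans (∷-cong x e) (++-congʳ (s ∷ a ∷ b ∷ s ∷ y) h))
        ...   | yes refl = two n (b ∷ y) ≤-refl (ib ∷ ys) (≈-trans (∷-cong x e) (≈-trans (++-congʳ (s ∷ a ∷ b ∷ s ∷ y) (≈-trans h (E-braid ab)))
                  (≈-trans (≡⇒≈ (E-snoc n b a (s ∷ a ∷ b ∷ s ∷ y))) (++-congˡ (E n a b) (swallow y)))))

        mults : ∀ {x z} → All (λ w → w ≡ a ⊎ w ≡ b) x → Form z → Form (x ++ z)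
        mults [] F = F
        mults (p ∷ ps) F = mult p (mults ps F)

        right : ∀ {z} → z ⊆ s ∷ [] → Form z
        right (_ Sub.∷ʳ []) = nil [] [] ≈-refl
        right (refl ∷ []) = one₁ 0 [] z≤n [] ≈-refl

        base : ∀ {z} → z ⊆ sabs → Form z
        base (_ Sub.∷ʳ p) with ⊆-++⁻ (a ∷ b ∷ []) p
        ... | z₁ , z₂ , p₁ , p₂ , refl = mults (All-⊆ p₁ (inj₁ refl ∷ inj₂ refl ∷ [])) (right p₂)
        base (refl ∷ _ Sub.∷ʳ _ Sub.∷ʳ _ Sub.∷ʳ []) = one₁ 0 [] z≤n [] ≈-refl
        base (refl ∷ _ Sub.∷ʳ _ Sub.∷ʳ refl ∷ []) = nil [] [] (ss≈ s [])
        base (refl ∷ _ Sub.∷ʳ refl ∷ _ Sub.∷ʳ []) = one₁ 0 (b ∷ []) z≤n (ib ∷ []) ≈-refl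
        base (refl ∷ _ Sub.∷ʳ refl ∷ refl ∷ []) = one₁ 1 (b ∷ []) (s≤s z≤n) (ib ∷ []) (≈-sym (alt-braid b s 3 bs))
        base (refl ∷ refl ∷ _ Sub.∷ʳ _ Sub.∷ʳ []) = one₁ 0 (a ∷ []) z≤n (ia ∷ []) ≈-refl
        base (refl ∷ refl ∷ _ Sub.∷ʳ refl ∷ []) = one₂ 1 (a ∷ []) (s≤s z≤n) (ia ∷ []) (≈-sym (alt-braid a s 3 as))
        base (refl ∷ refl ∷ refl ∷ _ Sub.∷ʳ []) = one₁ 0 (a ∷ b ∷ []) z≤n (ia ∷ ib ∷ []) ≈-refl
        base (refl ∷ refl ∷ refl ∷ refl ∷ []) = two 0 [] z≤n [] ≈-refl

        in₁ : ∀ {x} → x ∈ V₁ → x ∈ V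
        in₁ p = there (∈-++⁺ˡ p)
        in₂ : ∀ {x} → x ∈ V₂ → x ∈ V
        in₂ p = there (∈-++⁺ʳ V₁ (∈-++⁺ˡ p))
        in₃ : ∀ {x} → x ∈ V₃ → x ∈ V
        in₃ p = there (∈-++⁺ʳ V₁ (∈-++⁺ʳ V₂ p))

        represent : ∀ {z} → Form z → Σ Word λ x → Σ Word λ y → x ∈ V × All (Inner s u) y × z ≈ x ++ y
        represent (nil y ys e) = [] , y , here refl , ys , e
        represent (one₁ i y le ys e) = f₁ i , y , in₁ (∈-applyUpTo⁺ f₁ (s≤s le)) , ys , ≈-trans e (≡⇒≈ (sym (++-assoc (E i a b) _ y)))
        represent (one₂ zero y le ys e) = f₁ 0 , y , in₁ (∈-applyUpTo⁺ f₁ (s≤s z≤n)) , ys , e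
        represent (one₂ (suc i) y le ys e) = f₂ i , y , in₂ (∈-applyUpTo⁺ f₂ le) , ys , ≈-trans e (≡⇒≈ (sym (++-assoc (E (suc i) b a) _ y)))
        represent (two i y le ys e) = f₃ i , y , in₃ (∈-applyUpTo⁺ f₃ (s≤s le)) , ys , ≈-trans e (≡⇒≈ (sym (++-assoc (E i a b) sabs y)))

        complete : ∀ z → z ⊆ v → Σ Word λ x → Σ Word λ y → x ∈ V × All (Inner s u) y × z ≈ x ++ y
        complete z sub with ⊆-++⁻ (E n a b) sub
        ... | z₁ , z₂ , sub₁ , sub₂ , refl = represent (mults (All-⊆ sub₁ (E-letters n a b)) (base sub₂))

        r₁ : ∀ {i} → i < 2 + n → Reduced (f₁ i)
        r₁ {i} lt = additive⇒reduced {f₁ i} {u} (f₁-additive lt)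
        r₂ : ∀ {i} → i < n → Reduced (f₂ i)
        r₂ {i} lt = additive⇒reduced {f₂ i} {u} (f₂-additive lt)
        r₃ : ∀ {i} → i < suc n → Reduced (f₃ i)
        r₃ {i} lt = additive⇒reduced {f₃ i} {u} (f₃-additive lt)

        []≉ : ∀ {x k} → Reduced x → length x ≡ suc k → ¬ ([] ≈ x)
        []≉ r l e = 0≢1+n (trans (reduced≈⇒length {[]} (λ _ _ → z≤n) r e) l)

        cross₁₂ : ∀ {i j} → i < 2 + n → j < n → ¬ (f₁ i ≈ f₂ j)
        cross₁₂ {i} {j} lt lt' e = by i (suc-injective (trans (sym (length-f₁ i)) (trans (reduced≈⇒length (r₁ lt) (r₂ lt') e) (length-f₂ j))))
            (++-cancelʳ (s ∷ []) e)
          where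
            by : ∀ i → i ≡ suc j → E i a b ≈ E (suc j) b a → ⊥
            by _ refl h = alt-exact j (a≢b ∘ sym) (Below-sym (bd (s≤s lt'))) (subst₂ _≈_ (back b a) (back a b) (reverse-cong h))
              where
                back : ∀ b a → reverse (E (suc j) a b) ≡ alt (suc j) b a
                back b a = trans (cong reverse (E≡reverse (suc j) a b)) (reverse-involutive _)

        -- Without its last letter `f₃ j` is a reduced word that still contains `s`, unlike `x`.
        cross₃ : ∀ {x j} → All (λ w → w ≡ a ⊎ w ≡ b) x → j < suc n → ¬ (x ++ s ∷ [] ≈ f₃ j)
        cross₃ {x} {j} xs lt e = [ (λ p → a≢s (sym p)) , (λ p → b≢s (sym p)) ]′ (All.lookup xs (All.lookup (reduced-support r (≈-sym e')) (∈-++⁺ʳ (E j a b) (here refl))))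
          where
            w : Word
            w = E j a b ++ s ∷ a ∷ b ∷ []
            w≡ : w ++ s ∷ [] ≡ f₃ j
            w≡ = ++-assoc (E j a b) _ _
            r : Reduced w
            r = Reduced-prefix w (subst Reduced (sym w≡) (r₃ lt))
            e' : x ≈ w
            e' = ++-cancelʳ (s ∷ []) (≈-trans e (≡⇒≈ (sym w≡)))

        distinct : Distinct V
        distinct = Allₚ.++⁺ (Allₚ.applyUpTo⁺₁ f₁ (2 + n) λ {i} lt → []≉ (r₁ lt) (length-f₁ i))
            (Allₚ.++⁺ (Allₚ.applyUpTo⁺₁ f₂ n λ {i} lt → []≉ (r₂ lt) (length-f₂ i)) (Allₚ.applyUpTo⁺₁ f₃ (suc n) λ {i} lt → []≉ (r₃ lt) (length-f₃ i)))
          ∷ AllPairsₚ.++⁺ (graded-distinct f₁ 1 (2 + n) r₁ length-f₁)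
              (AllPairsₚ.++⁺ (graded-distinct f₂ 2 n r₂ length-f₂) (graded-distinct f₃ 4 (suc n) r₃ length-f₃)
                (Allₚ.applyUpTo⁺₁ f₂ n λ {i} _ → Allₚ.applyUpTo⁺₁ f₃ (suc n) λ lt → cross₃ (All.map Sum.swap (E-letters (suc i) b a)) lt))
              (Allₚ.applyUpTo⁺₁ f₁ (2 + n) λ {i} lt → Allₚ.++⁺ (Allₚ.applyUpTo⁺₁ f₂ n λ lt' → cross₁₂ lt lt')
                (Allₚ.applyUpTo⁺₁ f₃ (suc n) λ lt' → cross₃ (E-letters i a b) lt'))

        sub₁ : ∀ i → i ≤ suc n → Σ Word λ z → z ⊆ v × f₁ i ≈ z
        sub₁ i le with i Data.Nat.≟ suc n
        ... | no ne = f₁ i , Subₚ.++⁺ (E-⊆ (s≤s⁻¹ (≤∧≢⇒< le ne))) (refl ∷ minimum _) , ≈-refl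
        -- The longest element does not fit into the prefix `E n a b`; written with last letter `a`,
        -- it takes that letter from `sabs`.
        ... | yes refl = E n a b ++ a ∷ s ∷ [] , Subₚ.++⁺ ⊆-refl (Sub._∷ʳ_ s (refl ∷ Sub._∷ʳ_ b (refl ∷ []))) ,
              ≈-trans (++-congʳ (s ∷ []) (E-braid ab)) (≡⇒≈ (E-snoc n b a (s ∷ [])))

        l : ℕ
        l = 4 + n
        A : List ℕ
        A = 0 ∷ applyUpTo (1 +_) (2 + n) ++ applyUpTo (2 +_) n ++ applyUpTo (4 +_) (suc n)
        lens≡ : lens V ≡ A
        lens≡ = cong (0 ∷_) (trans (map-++ length V₁ _) (cong₂ _++_ (lens-applyUpTo f₁ (2 + n) length-f₁)
          (trans (map-++ length V₂ V₃) (cong₂ _++_ (lens-applyUpTo f₂ n length-f₂) (lens-applyUpTo f₃ (suc n) length-f₃)))))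

        cnt-A : ∀ k → cnt k A ≡ δ 0 k + (cnt k (applyUpTo (1 +_) (2 + n)) + (cnt k (applyUpTo (2 +_) n) + cnt k (applyUpTo (4 +_) (suc n))))
        cnt-A k = cong (δ 0 k +_) (trans (cnt-++ k (applyUpTo (1 +_) (2 + n)) _) (cong (cnt k (applyUpTo (1 +_) (2 + n)) +_) (cnt-++ k (applyUpTo (2 +_) n) _)))

        cnt-Aᵒ : ∀ k → cnt k (A ᵒ l) ≡ δ l k + (cnt k (applyUpTo (2 +_) (2 + n)) + (cnt k (applyUpTo (3 +_) n) + cnt k (applyUpTo (0 +_) (suc n))))
        cnt-Aᵒ k = cong (δ l k +_) (trans (cong (cnt k) (trans (map-++ (l ∸_) (applyUpTo (1 +_) (2 + n)) _)
            (cong (applyUpTo (1 +_) (2 + n) ᵒ l ++_) (map-++ (l ∸_) (applyUpTo (2 +_) n) _))))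
          (trans (cnt-++ k (applyUpTo (1 +_) (2 + n) ᵒ l) _) (cong₂ _+_ (row 1 2 (suc n) λ i j e → eq₁ i j e)
            (trans (cnt-++ k (applyUpTo (2 +_) n ᵒ l) _) (cong₂ _+_ (row 2 3 (2 + n₀) eq₂) (row 4 0 n eq₃))))))
          where
            row : ∀ c d N → (∀ i j → i + j ≡ N → l ∸ (c + i) ≡ d + j) → cnt k (applyUpTo (c +_) (suc N) ᵒ l) ≡ cnt k (applyUpTo (d +_) (suc N))
            row c d N h = cnt-↭ k (↭-trans (↭-reflexive (map-applyUpTo (c +_) (l ∸_) (suc N))) (mirror N {d +_} {λ i → l ∸ (c + i)} h))
            eq₁ : ∀ i j → i + j ≡ suc n → l ∸ (1 + i) ≡ 2 + j
            eq₁ i j e = trans (cong (λ z → 2 + z ∸ i) (sym e)) (trans (cong (_∸ i) (arith i j)) (m+n∸m≡n i (2 + j)))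
              where
                arith : ∀ i j → 2 + (i + j) ≡ i + (2 + j)
                arith = solve-∀
            eq₂ : ∀ i j → i + j ≡ 2 + n₀ → l ∸ (2 + i) ≡ 3 + j
            eq₂ i j e = trans (cong (λ z → 3 + z ∸ i) (sym e)) (trans (cong (_∸ i) (arith i j)) (m+n∸m≡n i (3 + j)))
              where
                arith : ∀ i j → 3 + (i + j) ≡ i + (3 + j)
                arith = solve-∀
            eq₃ : ∀ i j → i + j ≡ n → l ∸ (4 + i) ≡ j
            eq₃ i j e = trans (cong (_∸ i) (sym e)) (m+n∸m≡n i j)

        0<n : ∀ {n} → 0 < suc n
        0<n = s≤s z≤n

        agree : ∀ k → k ≤ 2 → cnt k A ≡ cnt k (A ᵒ l)
        agree 0 _ = trans
          (trans (cnt-A 0) (cong (1 +_) (cong₂ _+_ (cnt-range-out 1 (2 + n) 0<n) (cong₂ _+_ (cnt-range-out 2 n 0<n) (cnt-range-out 4 (suc n) 0<n)))))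
          (sym (trans (cnt-Aᵒ 0) (cong₂ _+_ (cnt-range-out 2 (2 + n) 0<n) (cong₂ _+_ (cnt-range-out 3 n 0<n) (cnt-range-in 0 0 (suc n) 0<n)))))
        agree 1 _ = trans
          (trans (cnt-A 1) (cong₂ _+_ (cnt-range-in 1 0 (2 + n) 0<n) (cong₂ _+_ (cnt-range-out 2 n ≤-refl) (cnt-range-out 4 (suc n) (s≤s 0<n)))))
          (sym (trans (cnt-Aᵒ 1) (cong₂ _+_ (cnt-range-out 2 (2 + n) ≤-refl) (cong₂ _+_ (cnt-range-out 3 n (s≤s 0<n)) (cnt-range-in 0 1 (suc n) (s≤s 0<n))))))
        agree 2 _ = trans
          (trans (cnt-A 2) (cong₂ _+_ (cnt-range-in 1 1 (2 + n) (s≤s 0<n)) (cong₂ _+_ (cnt-range-in 2 0 n 0<n) (cnt-range-out 4 (suc n) (s≤s (s≤s 0<n))))))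
          (sym (trans (cnt-Aᵒ 2) (cong₂ _+_ (cnt-range-in 2 0 (2 + n) 0<n) (cong₂ _+_ (cnt-range-out 3 n ≤-refl) (cnt-range-in 0 2 (suc n) (s≤s (s≤s 0<n)))))))
        agree (suc (suc (suc k))) (s≤s (s≤s ()))

        -- In rank 3 there are `f₁ 2` and `f₂ 1`; in corank 3 each of the three families has an
        -- element, the one of `f₃` because `n` is at least 3.
        excess : cnt 3 A < cnt 3 (A ᵒ l)
        excess = subst₂ _<_
          (sym (trans (cnt-A 3) (cong₂ _+_ (cnt-range-in 1 2 (2 + n) (s≤s (s≤s 0<n))) (cong₂ _+_ (cnt-range-in 2 1 n (s≤s 0<n)) (cnt-range-out 4 (suc n) ≤-refl)))))
          (sym (trans (cnt-Aᵒ 3) (cong₂ _+_ (cnt-range-in 2 1 (2 + n) (s≤s 0<n)) (cong₂ _+_ (cnt-range-in 3 0 n 0<n) (cnt-range-in 0 3 (suc n) (s≤s (s≤s (s≤s 0<n))))))))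
          (≤-refl {3})

        3<4+n₀ : 3 < 4 + n₀
        3<4+n₀ = s≤s (s≤s (s≤s (s≤s z≤n)))

      double-factor : Factored s v u
      double-factor = factored V (record
          { additive = refl ∷ Allₚ.++⁺ (Allₚ.applyUpTo⁺₁ f₁ (2 + n) f₁-additive) (Allₚ.++⁺ (Allₚ.applyUpTo⁺₁ f₂ n f₂-additive) (Allₚ.applyUpTo⁺₁ f₃ (suc n) f₃-additive))
          ; letters = [] ∷ Allₚ.++⁺ (Allₚ.applyUpTo⁺₁ f₁ (2 + n) λ {i} _ → Allₚ.++⁺ (All.map inner (E-letters i a b)) (inj₁ refl ∷ []))
              (Allₚ.++⁺ (Allₚ.applyUpTo⁺₁ f₂ n λ {i} _ → Allₚ.++⁺ (All.map (inner ∘ Sum.swap) (E-letters (suc i) b a)) (inj₁ refl ∷ []))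
                (Allₚ.applyUpTo⁺₁ f₃ (suc n) λ {i} _ → Allₚ.++⁺ (All.map inner (E-letters i a b)) (inj₁ refl ∷ inj₂ ia ∷ inj₂ ib ∷ inj₁ refl ∷ [])))
          ; distinct = distinct
          ; subwords = ([] , minimum _ , ≈-refl) ∷ Allₚ.++⁺ (Allₚ.applyUpTo⁺₁ f₁ (2 + n) λ {i} lt → sub₁ i (s≤s⁻¹ lt))
              (Allₚ.++⁺ (Allₚ.applyUpTo⁺₁ f₂ n λ {i} lt → E i a b ++ a ∷ s ∷ [] ,
                  Subₚ.++⁺ (E-⊆ (<⇒≤ lt)) (Sub._∷ʳ_ s (refl ∷ Sub._∷ʳ_ b (refl ∷ []))) , ≡⇒≈ (E-snoc i b a (s ∷ [])))
                (Allₚ.applyUpTo⁺₁ f₃ (suc n) λ {i} lt → f₃ i , Subₚ.++⁺ (E-⊆ (s≤s⁻¹ lt)) ⊆-refl , ≈-refl))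
          ; complete = complete
          ; top = in₃ (∈-applyUpTo⁺ f₃ ≤-refl) })
        (subst₂ (Status Contains33c) (sym (length-f₃ n)) (sym lens≡) (record
          { bounded = z≤n ∷ Allₚ.++⁺ (applyUpTo-≤ {1 +_} (2 + n) (λ lt → s≤s (≤-trans (s≤s⁻¹ lt) (m≤n+m (suc n) 2))))
              (Allₚ.++⁺ (applyUpTo-≤ {2 +_} n (λ lt → s≤s (s≤s (≤-trans (<⇒≤ lt) (m≤n+m n 2))))) (applyUpTo-≤ {4 +_} (suc n) (λ lt → +-monoʳ-≤ 4 (s≤s⁻¹ lt))))
          ; bottom = m≤m+n 1 _
          ; shape = inj₂ ((s , a , b , a≢s ∘ sym , b≢s ∘ sym , a≢b , trans (m-sym s a) as , trans (m-sym s b) bs , 4 + n₀ , ab , 3<4+n₀) ,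
              record { agree = agree ; excess = excess ; 3≤l = s≤s (s≤s (s≤s z≤n)) }) }))
        where
          inner : ∀ {x} → x ≡ a ⊎ x ≡ b → x ≡ s ⊎ Inner s u x
          inner (inj₁ refl) = inj₂ ia
          inner (inj₂ refl) = inj₂ ib

-- Spirals in the affine group of type A₂

module SpiralFactors (M : CoxeterMatrix) (no𝒯 : ¬ Coxeter.Contains𝒯 M) where
  open CoxeterMatrix M
  open Coxeter M
  open Words M
  open WordProblem M no𝒯
  open Bruhat M no𝒯
  open Coatoms M no𝒯
  open Triangles M no𝒯
  open Classification M no𝒯 using (spiral)
  open Counting
  open Intervals M no𝒯
  open Factors M no𝒯

  -- W^J for the affine group of type A₂ is indexed by partitions with parts 1 and 2; U ν x z is the
  -- element with x parts 2 and z parts 1, the letter of a row being determined by its height mod 3.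
  U : (ℕ → S) → ℕ → ℕ → Word
  U ν zero zero = []
  U ν (suc x) zero = ν (2 + x) ∷ ν x ∷ U ν x zero
  U ν x (suc z) = ν (z + x) ∷ U ν x z

  U-spiral : ∀ j ν → (∀ k → ν (3 + k) ≡ ν k) → U ν j 0 ≡ spiral j (ν 0) (ν 1) (ν 2)
  U-spiral zero ν h = refl
  U-spiral (suc j) ν h = trans (snoc j) (cong (_++ ν 2 ∷ ν 0 ∷ []) (trans (U-spiral j (ν ∘ suc) (h ∘ suc)) (cong (spiral j (ν 1) (ν 2)) (h 0))))
    where
      snoc : ∀ j → U ν (suc j) 0 ≡ U (ν ∘ suc) j 0 ++ ν 2 ∷ ν 0 ∷ []
      snoc zero = refl
      snoc (suc j) = cong (λ w → ν (3 + j) ∷ ν (suc j) ∷ w) (snoc j)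

  dbl : ℕ → ℕ
  dbl zero = zero
  dbl (suc e) = suc (suc (dbl e))

  half : ∀ z → Σ ℕ λ e → z ≡ dbl e ⊎ z ≡ suc (dbl e)
  half zero = 0 , inj₁ refl
  half (suc z) with half z
  ... | e , inj₁ refl = e , inj₂ refl
  ... | e , inj₂ refl = suc e , inj₁ refl

  dbl-+ : ∀ e x → dbl e + (x + x) ≡ dbl (e + x)
  dbl-+ zero zero = refl
  dbl-+ zero (suc x) = cong suc (trans (+-suc x x) (cong suc (dbl-+ zero x)))
  dbl-+ (suc e) x = cong (suc ∘ suc) (dbl-+ e x)

  dbl-injective : ∀ a b → dbl a ≡ dbl b → a ≡ b
  dbl-injective zero zero _ = refl
  dbl-injective (suc a) (suc b) e = cong suc (dbl-injective a b (suc-injective (suc-injective e)))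

  dbl-even : ∀ a b → dbl a ≢ suc (dbl b)
  dbl-even (suc a) (suc b) e = dbl-even a b (suc-injective (suc-injective e))

  module Spiral (j : ℕ) {s b c u} (us : All (_≢ s) u) (t : Tri s b c) (sb : m s b ≡ just 3) (sc : m s c ≡ just 3) (bc : m b c ≡ just 3)
                (db : Dsc b u) (dc : Dsc c u) where

    private
      ν : ℕ → S
      ν 0 = s
      ν 1 = b
      ν 2 = c
      ν (suc (suc (suc k))) = ν k

      ν-tri : ∀ k → Tri (ν k) (ν (1 + k)) (ν (2 + k))
      ν-tri 0 = t
      ν-tri 1 = rot t
      ν-tri 2 = rot (rot t)
      ν-tri (suc (suc (suc k))) = ν-tri k

      ν-m : ∀ k → m (ν k) (ν (1 + k)) ≡ just 3
      ν-m 0 = sb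
      ν-m 1 = bc
      ν-m 2 = trans (m-sym c s) sc
      ν-m (suc (suc (suc k))) = ν-m k

      ν-cases : ∀ i k → ν i ≡ ν k ⊎ ν i ≡ ν (1 + k) ⊎ ν i ≡ ν (2 + k)
      ν-cases i (suc (suc (suc k))) = ν-cases i k
      ν-cases (suc (suc (suc i))) 0 = ν-cases i 0
      ν-cases (suc (suc (suc i))) 1 = ν-cases i 1
      ν-cases (suc (suc (suc i))) 2 = ν-cases i 2
      ν-cases 0 0 = inj₁ refl
      ν-cases 1 0 = inj₂ (inj₁ refl)
      ν-cases 2 0 = inj₂ (inj₂ refl)
      ν-cases 0 1 = inj₂ (inj₂ refl)
      ν-cases 1 1 = inj₁ refl
      ν-cases 2 1 = inj₂ (inj₁ refl)
      ν-cases 0 2 = inj₂ (inj₁ refl)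
      ν-cases 1 2 = inj₂ (inj₂ refl)
      ν-cases 2 2 = inj₁ refl

      ν-shift : ∀ i k → ν i ≡ ν k → ν (2 + i) ≡ ν (2 + k)
      ν-shift i (suc (suc (suc k))) e = ν-shift i k e
      ν-shift (suc (suc (suc i))) 0 e = ν-shift i 0 e
      ν-shift (suc (suc (suc i))) 1 e = ν-shift i 1 e
      ν-shift (suc (suc (suc i))) 2 e = ν-shift i 2 e
      ν-shift 0 0 e = refl
      ν-shift 1 1 e = refl
      ν-shift 2 2 e = refl
      ν-shift 0 1 e = ⊥-elim (proj₁ (proj₁ t) e)
      ν-shift 1 0 e = ⊥-elim (proj₁ (proj₁ t) (sym e))
      ν-shift 0 2 e = ⊥-elim (proj₁ (proj₁ (proj₂ t)) e)
      ν-shift 2 0 e = ⊥-elim (proj₁ (proj₁ (proj₂ t)) (sym e))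
      ν-shift 1 2 e = ⊥-elim (proj₁ (proj₂ (proj₂ t)) e)
      ν-shift 2 1 e = ⊥-elim (proj₁ (proj₂ (proj₂ t)) (sym e))

      ib : Inner s u b
      ib = proj₁ (proj₁ t) ∘ sym , db
      ic : Inner s u c
      ic = proj₁ (proj₁ (proj₂ t)) ∘ sym , dc

      ν-letter : ∀ k → ν k ≡ s ⊎ Inner s u (ν k)
      ν-letter 0 = inj₁ refl
      ν-letter 1 = inj₂ ib
      ν-letter 2 = inj₂ ic
      ν-letter (suc (suc (suc k))) = ν-letter k

      W : ℕ → ℕ → Word
      W = U ν

      v : Word
      v = W j 0

      W-letters : ∀ x z → All (λ w → w ≡ s ⊎ Inner s u w) (W x z)
      W-letters zero zero = []
      W-letters (suc x) zero = ν-letter (2 + x) ∷ ν-letter x ∷ W-letters x zero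
      W-letters zero (suc z) = ν-letter (z + 0) ∷ W-letters zero z
      W-letters (suc x) (suc z) = ν-letter (z + suc x) ∷ W-letters (suc x) z

      W-suc : ∀ x z → W x (suc z) ≡ ν (z + x) ∷ W x z
      W-suc zero z = refl
      W-suc (suc x) z = refl

      length-W : ∀ x z → length (W x z) ≡ z + (x + x)
      length-W zero zero = refl
      length-W (suc x) zero = cong suc (trans (cong suc (length-W x zero)) (sym (+-suc x x)))
      length-W zero (suc z) = cong suc (length-W zero z)
      length-W (suc x) (suc z) = cong suc (length-W (suc x) z)

      -- The descents of W x z u for even z: all letters but ν (z + x).
      record Even (x e : ℕ) : Set where
        G : Word
        G = W x (dbl e) ++ u
        field
          desc₁ : Dsc (ν (1 + (dbl e + x))) G
          desc₂ : Dsc (ν (2 + (dbl e + x))) G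
          size : ℓ G ≡ dbl e + (x + x) + ℓ u

      step-left : ∀ k {G} → Dsc (ν (1 + k)) G → Dsc (ν (2 + k)) G → Step (ν (1 + k)) (ν k) G
      step-left k d₁ d₂ = spiral-step {q = ν (2 + k)} (rot (ν-tri k)) (trans (m-sym (ν (1 + k)) (ν k)) (ν-m k)) d₁ d₂

      step-right : ∀ k {G} → Dsc (ν (1 + k)) G → Dsc (ν (2 + k)) G → Step (ν (2 + k)) (ν k) G
      step-right k d₁ d₂ = spiral-step {q = ν (1 + k)} (flip (rot (rot (ν-tri k)))) (ν-m (2 + k)) d₂ d₁

      -- Each pair of letters is one `spiral-step`, which rotates the two descents.
      even : ∀ x e → Even x e
      even zero zero = record { desc₁ = db ; desc₂ = dc ; size = refl }
      even (suc x) zero = record { desc₁ = S.descent-p ; desc₂ = S.descent-r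
          ; size = trans S.grows (trans (cong (2 +_) I.size) (cong (λ n → suc n + ℓ u) (sym (+-suc x x)))) }
        where
          module I = Even (even x zero)
          module S = Step (step-right x I.desc₁ I.desc₂)
      even x (suc e) = record
          { desc₁ = subst (Dsc (ν k)) (sym W≡) S.descent-r ; desc₂ = subst (Dsc (ν (1 + k))) (sym W≡) S.descent-p
          ; size = trans (cong ℓ W≡) (trans S.grows (cong (2 +_) I.size)) }
        where
          module I = Even (even x e)
          k : ℕ
          k = dbl e + x
          module S = Step (step-left k I.desc₁ I.desc₂)
          W≡ : W x (dbl (suc e)) ++ u ≡ ν (1 + k) ∷ ν k ∷ I.G
          W≡ = cong (_++ u) (trans (W-suc x (suc (dbl e))) (cong (ν (1 + k) ∷_) (W-suc x (dbl e))))

      ascent : ∀ x e → ¬ Dsc (ν (dbl e + x)) (W x (dbl e) ++ u)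
      ascent x e = Step.ascent (step-left (dbl e + x) desc₁ desc₂)
        where open Even (even x e)

      W-additive : ∀ x z → ℓ (W x z ++ u) ≡ length (W x z) + ℓ u
      W-additive x z = trans (by (half z)) (cong (_+ ℓ u) (sym (length-W x z)))
        where
          by : ∀ {z} → (Σ ℕ λ e → z ≡ dbl e ⊎ z ≡ suc (dbl e)) → ℓ (W x z ++ u) ≡ z + (x + x) + ℓ u
          by (e , inj₁ refl) = Even.size (even x e)
          by (e , inj₂ refl) = trans (cong (λ w → ℓ (w ++ u)) (W-suc x (dbl e))) (trans (ℓ-asc (ascent x e)) (cong suc (Even.size (even x e))))

      W-reduced : ∀ x z → Reduced (W x z)
      W-reduced x z = additive⇒reduced {W x z} {u} (W-additive x z)

      -- A second descent `p` beside `ν k` would by `peel₂` make `ν k` a descent of `p G`, excluded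
      -- by `third-ascent`.
      odd-descent : ∀ x e {i} → Dsc (ν i) (ν (dbl e + x) ∷ W x (dbl e) ++ u) → ν i ≡ ν (dbl e + x)
      odd-descent x e {i} d = by (ν-cases i k)
        where
          open Even (even x e)
          k : ℕ
          k = dbl e + x
          contra : ∀ {p q} → Tri (ν k) q p → Dsc q G → Dsc p G → ¬ Dsc p (ν k ∷ G)
          contra {p} tr dq dp d = third-ascent tr dq dp (Dsc-cong (∷-cong p (ss≈ (ν k) G))
            (peel₂ (proj₁ (proj₁ (proj₂ tr))) (asc⇒Dsc (ascent x e)) d (proj₁ (proj₂ tr))))
          by : ν i ≡ ν k ⊎ ν i ≡ ν (1 + k) ⊎ ν i ≡ ν (2 + k) → ν i ≡ ν k
          by (inj₁ p) = p
          by (inj₂ (inj₁ p)) = ⊥-elim (contra (flip (ν-tri k)) desc₂ desc₁ (subst (λ w → Dsc w (ν k ∷ G)) p d))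
          by (inj₂ (inj₂ p)) = ⊥-elim (contra (ν-tri k) desc₁ desc₂ (subst (λ w → Dsc w (ν k ∷ G)) p d))

      even-residue : ∀ x e x' e' → W x (dbl e) ≈ W x' (dbl e') → ν (dbl e + x) ≡ ν (dbl e' + x')
      even-residue x e x' e' f = by (ν-cases (dbl e + x) (dbl e' + x'))
        where
          module I = Even (even x' e')
          k' : ℕ
          k' = dbl e' + x'
          by : ν (dbl e + x) ≡ ν k' ⊎ ν (dbl e + x) ≡ ν (1 + k') ⊎ ν (dbl e + x) ≡ ν (2 + k') → ν (dbl e + x) ≡ ν k'
          by (inj₁ p) = p
          by (inj₂ (inj₁ p)) = ⊥-elim (ascent x e (Dsc-cong (++-congʳ u (≈-sym f)) (subst (λ w → Dsc w I.G) (sym p) I.desc₁)))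
          by (inj₂ (inj₂ p)) = ⊥-elim (ascent x e (Dsc-cong (++-congʳ u (≈-sym f)) (subst (λ w → Dsc w I.G) (sym p) I.desc₂)))

      -- The letter passes through each pair by a braid and arrives at the right end as `c`.
      fix : ∀ x → Σ S λ i → Inner s u i × ν (2 + x) ∷ W x 0 ≈ W x 0 ++ i ∷ []
      fix zero = c , ic , ≈-refl
      fix (suc x) with fix x
      ... | i , p , e = i , p , ≈-trans (++-congʳ (W x 0) (alt-braid (ν x) (ν (2 + x)) 3 (trans (m-sym (ν x) (ν (2 + x))) (ν-m (2 + x)))))
              (++-congˡ (ν (2 + x) ∷ ν x ∷ []) e)

      fixed-ascent : ∀ x → ¬ Dsc (ν (2 + x)) (W x 0)
      fixed-ascent x d = by (fix x)
        where
          by : (Σ S λ i → Inner s u i × ν (2 + x) ∷ W x 0 ≈ W x 0 ++ i ∷ []) → ⊥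
          by (i , (_ , di) , e) = <-irrefl refl (<-trans (<-≤-trans d (ℓ≤length (W x 0)))
            (subst (length (W x 0) <_) (ℓ-cong (≈-sym e)) (additive-∷ʳ {W x 0} {u} (W-additive x 0) di)))

      -- Equal elements have the same descents, which determines the height mod 3, hence the first letter.
      zero≢ : ∀ x x' e' → ¬ (W x 0 ≈ W x' (dbl (suc e')))
      zero≢ x x' e' f = fixed-ascent x (Dsc-cong (≈-sym f) (subst₂ Dsc (sym head≡) (sym (W-suc x' (suc (dbl e'))))
          (asc⇒Dsc (reduced⇒asc (subst Reduced (W-suc x' (suc (dbl e'))) (W-reduced x' (dbl (suc e'))))))))
        where
          head≡ : ν (2 + x) ≡ ν (suc (dbl e') + x')
          head≡ = ν-shift x (dbl (suc e') + x') (even-residue x 0 x' (suc e') f)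

      odd-cancel : ∀ x e x' e' → W x (suc (dbl e)) ≈ W x' (suc (dbl e')) → W x (dbl e) ≈ W x' (dbl e')
      odd-cancel x e x' e' f = ∷-cancel (ν (dbl e' + x')) (≈-trans (≡⇒≈ (cong (_∷ W x (dbl e)) h)) f')
        where
          f' : ν (dbl e + x) ∷ W x (dbl e) ≈ ν (dbl e' + x') ∷ W x' (dbl e')
          f' = subst₂ _≈_ (W-suc x (dbl e)) (W-suc x' (dbl e')) f
          h : ν (dbl e' + x') ≡ ν (dbl e + x)
          h = odd-descent x e {dbl e' + x'} (Dsc-cong (≈-sym (++-congʳ u f')) (asc⇒Dsc (ascent x' e')))

      even-injective : ∀ e e' x x' → W x (dbl e) ≈ W x' (dbl e') → e ≡ e'
      even-injective zero zero x x' f = refl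
      even-injective zero (suc e') x x' f = ⊥-elim (zero≢ x x' e' f)
      even-injective (suc e) zero x x' f = ⊥-elim (zero≢ x' x e (≈-sym f))
      even-injective (suc e) (suc e') x x' f = cong suc (even-injective e e' x x' (odd-cancel x e x' e'
          (∷-cancel (ν (suc (dbl e') + x')) (≈-trans (≡⇒≈ (cong (_∷ W x (suc (dbl e))) (sym h))) (subst₂ _≈_ (W-suc x (suc (dbl e))) (W-suc x' (suc (dbl e'))) f)))))
        where
          h : ν (suc (dbl e) + x) ≡ ν (suc (dbl e') + x')
          h = ν-shift (dbl (suc e) + x) (dbl (suc e') + x') (even-residue x (suc e) x' (suc e') f)

      -- The length determines the parity of `z`; cancelling first letters then determines `z`, and
      -- the length gives `x`.
      W-injective : ∀ {x z x' z'} → W x z ≈ W x' z' → z ≡ z' × x ≡ x'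
      W-injective {x} {z} {x'} {z'} f = z≡ (half z) (half z') f lengths , x≡
        where
          lengths : z + (x + x) ≡ z' + (x' + x')
          lengths = trans (sym (length-W x z)) (trans (reduced≈⇒length (W-reduced x z) (W-reduced x' z') f) (length-W x' z'))
          z≡ : ∀ {z z'} → (Σ ℕ λ e → z ≡ dbl e ⊎ z ≡ suc (dbl e)) → (Σ ℕ λ e → z' ≡ dbl e ⊎ z' ≡ suc (dbl e)) →
               W x z ≈ W x' z' → z + (x + x) ≡ z' + (x' + x') → z ≡ z'
          z≡ (e , inj₁ refl) (e' , inj₁ refl) f _ = cong dbl (even-injective e e' x x' f)
          z≡ (e , inj₂ refl) (e' , inj₂ refl) f _ = cong (suc ∘ dbl) (even-injective e e' x x' (odd-cancel x e x' e' f))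
          z≡ (e , inj₁ refl) (e' , inj₂ refl) _ l = ⊥-elim (dbl-even (e + x) (e' + x') (trans (sym (dbl-+ e x)) (trans l (cong suc (dbl-+ e' x')))))
          z≡ (e , inj₂ refl) (e' , inj₁ refl) _ l = ⊥-elim (dbl-even (e' + x') (e + x) (trans (sym (dbl-+ e' x')) (trans (sym l) (cong suc (dbl-+ e x)))))
          x≡ : x ≡ x'
          x≡ = dbl-injective x x' (trans (sym (dbl-+ 0 x)) (trans (+-cancelˡ-≡ z _ _ (trans lengths (cong (_+ (x' + x')) (sym (z≡ (half z) (half z') f lengths))))) (dbl-+ 0 x')))

      -- `z + x` is the number of parts of the partition. `v` has `j` parts, and this bound
      -- describes the elements of `W^J` below `v`.
      Form : ℕ → Word → Set
      Form K w = Σ ℕ λ x → Σ ℕ λ z → Σ Word λ y → z + x ≤ K × All (Inner s u) y × w ≈ W x z ++ y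

      -- Braids carry the letter past two parts 1 at a time, until it changes the last part 1 into a
      -- 2 or a part 2 into a 1, or is absorbed on the right. The number of parts stays the same.
      turn : ∀ x z → Σ ℕ λ x' → Σ ℕ λ z' → Σ Word λ y → z' + x' ≡ z + x × All (Inner s u) y × ν (1 + (z + x)) ∷ W x z ≈ W x' z' ++ y
      turn zero zero = 0 , 0 , b ∷ [] , refl , ib ∷ [] , ≈-refl
      turn (suc x) zero = x , 1 , [] , refl , [] , ≈-trans (ss≈ (ν (2 + x)) _) (≡⇒≈ (trans (sym (W-suc x 0)) (sym (++-identityʳ _))))
      turn x (suc zero) = suc x , 0 , [] , refl , [] , ≡⇒≈ (trans (cong (ν (2 + x) ∷_) (W-suc x 0)) (sym (++-identityʳ _)))
      turn x (suc (suc z)) with turn x z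
      ... | x' , z' , y , h , ys , e = x' , 2 + z' , y , cong (2 +_) h , ys , (begin
            ν K ∷ W x (2 + z)                       ≡⟨ cong (ν K ∷_) (trans (W-suc x (suc z)) (cong (ν (1 + K) ∷_) (W-suc x z))) ⟩
            ν K ∷ ν (1 + K) ∷ ν K ∷ W x z           ≈⟨ ++-congʳ (W x z) (alt-braid (ν K) (ν (1 + K)) 3 (ν-m K)) ⟩
            ν (1 + K) ∷ ν K ∷ ν (1 + K) ∷ W x z     ≈⟨ ++-congˡ (ν (1 + K) ∷ ν K ∷ []) e ⟩
            ν (1 + K) ∷ ν K ∷ W x' z' ++ y          ≡⟨ cong (λ k → ν (1 + k) ∷ ν k ∷ W x' z' ++ y) (sym h) ⟩
            ν (suc z' + x') ∷ ν (z' + x') ∷ W x' z' ++ y ≡⟨ cong (_++ y) (trans (cong (ν (suc z' + x') ∷_) (sym (W-suc x' z'))) (sym (W-suc x' (suc z')))) ⟩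
            W x' (2 + z') ++ y ∎)
        where
          open ≈R
          K : ℕ
          K = z + x

      turned : ∀ {K w x z y} → z + x ≤ K → All (Inner s u) y → w ≈ W x z ++ y → Form K (ν (1 + (z + x)) ∷ w)
      turned {K} {w} {x} {z} {y} le ys e with turn x z
      ... | x' , z' , y' , h , ys' , e' = x' , z' , y' ++ y , subst (_≤ K) (sym h) le , Allₚ.++⁺ ys' ys ,
            ≈-trans (∷-cong _ e) (≈-trans (++-congʳ y e') (≡⇒≈ (++-assoc (W x' z') y' y)))

      lowered : ∀ {K w x y} z → z + x ≤ K → All (Inner s u) y → w ≈ W x z ++ y → Form K (ν (2 + (z + x)) ∷ w)
      lowered {K} {w} {x} {y} (suc z) le ys e = x , z , y , ≤-trans (n≤1+n _) le , ys ,
        ≈-trans (∷-cong _ (≈-trans e (≡⇒≈ (cong (_++ y) (W-suc x z))))) (ss≈ (ν (z + x)) _)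
      lowered {K} {w} {x} {y} zero le ys e with fix x
      ... | i , p , e' = x , 0 , i ∷ y , le , p ∷ ys , ≈-trans (∷-cong _ e) (≈-trans (++-congʳ y e') (≡⇒≈ (++-assoc (W x 0) _ y)))

      weaken : ∀ {K w} → Form K w → Form (suc K) w
      weaken (x , z , y , le , rest) = x , z , y , m≤n⇒m≤1+n le , rest

      mult : ∀ {K w} i → Form K w → Form (suc K) (ν i ∷ w)
      mult {K} {w} i (x , z , y , le , ys , e) = by (ν-cases i (z + x))
        where
          by : ν i ≡ ν (z + x) ⊎ ν i ≡ ν (1 + (z + x)) ⊎ ν i ≡ ν (2 + (z + x)) → Form (suc K) (ν i ∷ w)
          by (inj₁ p) = x , suc z , y , s≤s le , ys , ≈-trans (≡⇒≈ (cong (_∷ w) p)) (≈-trans (∷-cong _ e) (≡⇒≈ (cong (_++ y) (sym (W-suc x z)))))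
          by (inj₂ (inj₁ p)) = subst (λ l → Form (suc K) (l ∷ w)) (sym p) (weaken (turned le ys e))
          by (inj₂ (inj₂ p)) = subst (λ l → Form (suc K) (l ∷ w)) (sym p) (weaken (lowered z le ys e))

      -- With fewer than `K + 1` parts there is room for another; with exactly `K + 1` this letter
      -- is the one treated by `turn`, which adds none.
      mult-top : ∀ {K w} → Form (suc K) w → Form (suc K) (ν (2 + K) ∷ w)
      mult-top {K} {w} (x , z , y , le , ys , e) = by (z + x ≤? K)
        where
          by : Dec (z + x ≤ K) → Form (suc K) (ν (2 + K) ∷ w)
          by (yes le') = mult (2 + K) (x , z , y , le' , ys , e)
          by (no n) = subst (λ k → Form (suc K) (ν (1 + k) ∷ w)) (≤-antisym le (≰⇒> n)) (turned le ys e)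

      forms : ∀ j {z} → z ⊆ W j 0 → Form j z
      forms zero [] = 0 , 0 , [] , z≤n , [] , ≈-refl
      forms (suc j) (_ Sub.∷ʳ _ Sub.∷ʳ p) = weaken (forms j p)
      forms (suc j) (_ Sub.∷ʳ refl ∷ p) = mult j (forms j p)
      forms (suc j) (refl ∷ _ Sub.∷ʳ p) = mult-top (weaken (forms j p))
      forms (suc j) (refl ∷ refl ∷ p) = mult-top (mult j (forms j p))

      row : ℕ → ℕ → List Word
      row z n = applyUpTo (λ x → W x z) (suc n)

      rows : ℕ → ℕ → List Word
      rows z zero = row z zero
      rows z (suc n) = row z (suc n) ++ rows (suc z) n

      rows-all : ∀ {P : Word → Set} z n → (∀ i x → i + x ≤ n → P (W x (i + z))) → All P (rows z n)
      rows-all z zero h = h 0 0 z≤n ∷ []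
      rows-all {P} z (suc n) h = Allₚ.++⁺ (Allₚ.applyUpTo⁺₁ (λ x → W x z) (suc (suc n)) λ {x} lt → h 0 x (s≤s⁻¹ lt))
        (rows-all (suc z) n λ i x le → subst (λ k → P (W x k)) (sym (+-suc i z)) (h (suc i) x (s≤s le)))

      ∈-rows : ∀ z n i x → i + x ≤ n → W x (i + z) ∈ rows z n
      ∈-rows z zero zero zero le = here refl
      ∈-rows z (suc n) zero x le = ∈-++⁺ˡ (∈-applyUpTo⁺ (λ x → W x z) (s≤s le))
      ∈-rows z (suc n) (suc i) x le = ∈-++⁺ʳ (row z (suc n)) (subst (λ k → W x k ∈ rows (suc z) n) (+-suc i z) (∈-rows (suc z) n i x (s≤s⁻¹ le)))

      row-distinct : ∀ z n → Distinct (row z n)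
      row-distinct z n = AllPairsₚ.applyUpTo⁺₁ (λ x → W x z) (suc n) λ {x} {x'} lt _ e → <-irrefl (proj₂ (W-injective {x} {z} {x'} {z} e)) lt

      rows-distinct : ∀ z n → Distinct (rows z n)
      rows-distinct z zero = row-distinct z zero
      rows-distinct z (suc n) = AllPairsₚ.++⁺ (row-distinct z (suc n)) (rows-distinct (suc z) n)
        (Allₚ.applyUpTo⁺₁ (λ x → W x z) (2 + n) λ {x} _ → rows-all (suc z) n λ i x' _ e →
          1+n≰n (≤-trans (s≤s (m≤n+m z i)) (≤-reflexive (trans (sym (+-suc i z)) (sym (proj₁ (W-injective {x} {z} {x'} {i + suc z} e)))))))

      row-symmetric : ∀ l z n → l ≡ (n + z) + (n + z) → Symmetric l (lens (row z n))
      row-symmetric l z n l≡ k = trans (cong (cnt k) lens≡) (sym (trans (cong (λ A → cnt k (A ᵒ l)) lens≡)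
          (trans (cong (cnt k) (map-applyUpTo f (l ∸_) (suc n))) (cnt-↭ k (mirror n {f} {λ x → l ∸ f x} λ { i i' refl →
            trans (cong (_∸ f i) (trans l≡ (arith i i' z))) (m+n∸m≡n (f i) (f i')) })))))
        where
          f : ℕ → ℕ
          f x = z + (x + x)
          lens≡ : lens (row z n) ≡ applyUpTo f (suc n)
          lens≡ = lens-applyUpTo (λ x → W x z) (suc n) (λ x → length-W x z)
          arith : ∀ i i' z → (i + i' + z) + (i + i' + z) ≡ (z + (i + i)) + (z + (i' + i'))
          arith = solve-∀

      -- With `j = n + z` constant along the recursion, the row of `z` has lengths z, z + 2, ..., 2j
      -- - z and is symmetric by itself. For `z = 0` the sum is the Gaussian binomial coefficient of
      -- j + 2 over 2.
      rows-symmetric : ∀ l z n → l ≡ (n + z) + (n + z) → Symmetric l (lens (rows z n))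
      rows-symmetric l z zero l≡ = row-symmetric l z zero l≡
      rows-symmetric l z (suc n) l≡ k = begin
          cnt k (lens (row z (suc n) ++ rows (suc z) n))                   ≡⟨ cong (cnt k) (map-++ length (row z (suc n)) _) ⟩
          cnt k (lens (row z (suc n)) ++ lens (rows (suc z) n))            ≡⟨ cnt-++ k (lens (row z (suc n))) _ ⟩
          cnt k (lens (row z (suc n))) + cnt k (lens (rows (suc z) n))     ≡⟨ cong₂ _+_ (row-symmetric l z (suc n) l≡ k)
              (rows-symmetric l (suc z) n (trans l≡ (cong₂ _+_ (sym (+-suc n z)) (sym (+-suc n z)))) k) ⟩
          cnt k (lens (row z (suc n)) ᵒ l) + cnt k (lens (rows (suc z) n) ᵒ l) ≡⟨ cnt-++ k (lens (row z (suc n)) ᵒ l) _ ⟨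
          cnt k (lens (row z (suc n)) ᵒ l ++ lens (rows (suc z) n) ᵒ l)    ≡⟨ cong (cnt k) (map-++ (l ∸_) (lens (row z (suc n))) _) ⟨
          cnt k ((lens (row z (suc n)) ++ lens (rows (suc z) n)) ᵒ l)      ≡⟨ cong (λ A → cnt k (A ᵒ l)) (map-++ length (row z (suc n)) _) ⟨
          cnt k (lens (row z (suc n) ++ rows (suc z) n) ᵒ l) ∎
        where open ≡-Reasoning

      V : List Word
      V = rows 0 j

      V-all : ∀ {P : Word → Set} → (∀ z x → z + x ≤ j → P (W x z)) → All P V
      V-all {P} h = rows-all 0 j λ i x le → subst (λ k → P (W x k)) (sym (+-identityʳ i)) (h i x le)

      W-⊆ : ∀ x z → W x z ⊆ W (z + x) 0
      W-⊆ x zero = ⊆-refl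
      W-⊆ x (suc z) = subst (_⊆ W (suc z + x) 0) (sym (W-suc x z)) (Sub._∷ʳ_ _ (refl ∷ W-⊆ x z))

      W₀-⊆ : ∀ i k → W k 0 ⊆ W (i + k) 0
      W₀-⊆ zero k = ⊆-refl
      W₀-⊆ (suc i) k = Sub._∷ʳ_ _ (Sub._∷ʳ_ _ (W₀-⊆ i k))

      W-⊆-v : ∀ z x → z + x ≤ j → W x z ⊆ v
      W-⊆-v z x le = ⊆-trans (W-⊆ x z) (subst (λ k → W (z + x) 0 ⊆ W k 0) (m∸n+n≡m le) (W₀-⊆ (j ∸ (z + x)) (z + x)))

      convert : ∀ {w} → Form j w → Σ Word λ x → Σ Word λ y → x ∈ V × All (Inner s u) y × w ≈ x ++ y
      convert (x , z , y , le , ys , e) = W x z , y , subst (λ k → W x k ∈ V) (+-identityʳ z) (∈-rows 0 j z x le) , ys , e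

      length-v : length v ≡ j + j
      length-v = length-W j 0

      double-≤ : ∀ z x → z + x ≤ j → z + (x + x) ≤ j + j
      double-≤ z x le = ≤-trans (≤-reflexive (sym (+-assoc z x x))) (+-mono-≤ le (≤-trans (m≤n+m x z) le))

      bottom : 1 ≤ cnt 0 (lens V)
      bottom = by j
        where
          by : ∀ n → 1 ≤ cnt 0 (lens (rows 0 n))
          by zero = ≤-refl
          by (suc n) = m≤m+n 1 _

    spiral-factor : Factored s (spiral j s b c) u
    spiral-factor = subst (λ w → Factored s w u) (U-spiral j ν (λ _ → refl)) (factored V (record
        { additive = V-all λ z x _ → W-additive x z
        ; letters = V-all λ z x _ → W-letters x z
        ; distinct = rows-distinct 0 j
        ; subwords = V-all λ z x le → W x z , W-⊆-v z x le , ≈-refl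
        ; complete = λ z sub → convert (forms j sub)
        ; top = ∈-rows 0 j 0 j ≤-refl })
      (record
        { bounded = Allₚ.map⁺ (V-all λ z x le → subst₂ _≤_ (sym (length-W x z)) (sym length-v) (double-≤ z x le))
        ; bottom = bottom
        ; shape = inj₁ (rows-symmetric (length v) 0 j (trans length-v (cong₂ _+_ (sym (+-identityʳ j)) (sym (+-identityʳ j))))) }))

-- From palindromic coefficients to the product

module Palindromes (M : CoxeterMatrix) (no𝒯 : ¬ Coxeter.Contains𝒯 M) where
  open CoxeterMatrix M
  open Coxeter M
  open Words M
  open Tree M no𝒯 using (alt-exact)
  open WordProblem M no𝒯
  open Bruhat M no𝒯
  open Coatoms M no𝒯
  open Triangles M no𝒯
  open Classification M no𝒯
  open Counting
  open Intervals M no𝒯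
  open Factors M no𝒯
  open TriangleFactors M no𝒯
  open SpiralFactors M no𝒯

  shape-factor : ∀ {s v u} → All (_≢ s) u → Shape s v u → Σ Word λ v° → v ≈ v° × Factored s v° u
  shape-factor us (single e) = _ , e , single-factor us
  shape-factor us (chain n a as e bd da) = _ , e , chain-factor us n as bd da
  shape-factor us (pair n b c t sb sc e db dc) = _ , e , Pair.pair-factor us n t sb sc db dc
  shape-factor us (spirals j b c t sb sc bc e db dc) = _ , e , Spiral.spiral-factor j us t sb sc bc db dc
  shape-factor {s} us (double n a b t ab as bs e da db) = by n (NC-≥3 (proj₁ t) ab) ab e
    where
      by : ∀ n → 3 ≤ suc n → m a b ≡ just (suc n) → _ ≈ E n a b ++ s ∷ a ∷ b ∷ s ∷ [] → Σ Word λ v° → _ ≈ v° × Factored s v° _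
      by 1 (s≤s (s≤s ())) _ _
      -- For `m a b ≡ 3` the word is `a b s a b s`, a spiral, whose factor is symmetric.
      by 2 _ ab e = spiral 3 s a b , e ,
        Spiral.spiral-factor 3 us (rot (rot t)) (trans (m-sym s a) as) (trans (m-sym s b) bs) ab da db
      by (suc (suc (suc n₀))) _ ab e = _ , e , Double.double-factor us n₀ t ab as bs da db

  Graded : Word → Set
  Graded w = Σ (List Word) λ L → Interval w L × Status Contains33c (length w) (lens L)

  graded : ∀ k w → length w ≤ k → Reduced w → AtMost (supp w) w → Graded w
  graded k [] le r h = [] ∷ [] , record
      { reduced = r ∷ [] ; lower = ≤B-refl ≈-refl ∷ [] ; distinct = [] ∷ []
      ; complete = λ x p → here (bottom (≤B⇒⊆ p r ≈-refl)) } ,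
    record { bounded = z≤n ∷ [] ; bottom = ≤-refl ; shape = inj₁ λ _ → refl }
    where
      bottom : ∀ {x} → (Σ Word λ z → z ⊆ [] × x ≈ z) → x ≈ []
      bottom (_ , [] , e) = e
  graded (suc k) w@(_ ∷ _) le r h = combine (shape-factor u≢s (Rigidity.classify min u≢s r' rigid (λ ())))
      (graded k u (s≤s⁻¹ (≤-trans (subst (suc (length u) ≤_) (sym lengths)
        (s≤s (≤-trans (m≤n+m _ (length rest)) (≤-reflexive (sym (length-++ rest)))))) le)) (Reduced-suffix (first ∷ rest) r') u-tight)
    where
      D : Decomposition w
      D = decompose (λ ()) r
      open Decomposition D
      open Tight r h D
      combine : (Σ Word λ v° → first ∷ rest ≈ v° × Factored s v° u) → Graded u → Graded w
      combine (v° , e , factored V F st) (L , I , st') = products ,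
          Interval-cong (≈-sym (≈-trans w≈ (++-congʳ u e))) interval ,
          subst₂ (Status Contains33c) (sym total) (sym lens-products) (Status-⊗ st st')
        where
          len : length (first ∷ rest) ≡ length v°
          len = reduced≈⇒length (Reduced-prefix (first ∷ rest) r') (additive⇒reduced {v°} {u} (All.lookup (Factor.additive F) (Factor.top F))) e
          total : length w ≡ length v° + length u
          total = trans lengths (trans (length-++ (first ∷ rest)) (cong (_+ length u) len))
          open Product u≢s (Reduced-cong r' (++-congʳ u (≈-sym e))
            (trans (length-++ v°) (trans (cong (_+ length u) (sym len)) (sym (length-++ (first ∷ rest)))))) F I

  singleton-injective : ∀ {s t} → s ∷ [] ≈ t ∷ [] → s ≡ t
  singleton-injective {s} {t} e with s ≟ t
  ... | yes p = p
  ... | no n = ⊥-elim (alt-exact 0 n (m-off s t n) e)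

  atoms : ∀ w → Coeff w 1 (supp (nf w))
  atoms w = map (_∷ []) (deduplicate _≟_ (nf w)) , length-map (λ t → t ∷ []) (deduplicate _≟_ (nf w)) ,
      Allₚ.map⁺ (All.tabulate λ {t} p → ≤B-respʳ (nf≈ w) (⊆⇒≤B (Sub.from∈ (∈-deduplicate⁻ _≟_ (nf w) p)) (nf-reduced w)) , singleton t) ,
      AllPairsₚ.map⁺ (AllPairs.map (λ n e → n (singleton-injective e)) (deduplicate-! _≟_ (nf w))) , covers
    where
      singleton : ∀ t → Len (t ∷ []) 1
      singleton t = t ∷ [] , ≈-refl , asc⇒reduced (λ _ _ → z≤n) (λ p → case ≤-trans p (ℓ≤length []) of λ ()) , refl
      covers : ∀ x → Lower w 1 x → Any (x ≈_) (map (_∷ []) (deduplicate _≟_ (nf w)))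
      covers x (p , t ∷ [] , e , r , _) with ≤B⇒⊆ p (nf-reduced w) (nf≈ w)
      ... | z , sub , f = lose (∈-map⁺ (_∷ []) (∈-deduplicate⁺ _≟_ (Sub.lookup sub
              (All.head (reduced-support r (≈-trans e f)))))) (≈-sym e)

  -- The equality at index 1 compares the number of letters, by `atoms`, with the number of coatoms.
  tight : ∀ w → KPalindromic 2 w → AtMost (supp (nf w)) (nf w)
  tight w h [] ds cs = z≤n
  tight w h L@(_ ∷ _) ds cs@((_ , l₀) ∷ _) = by (h (ℓ w) (Len-ℓ w) 1 ≤-refl 1≤ℓ _ (atoms w))
    where
      1≤ℓ : 1 ≤ ℓ w
      1≤ℓ = subst (1 ≤_) (trans (sym l₀) (ℓ-cong (nf≈ w))) (s≤s z≤n)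
      by : Coeff w (ℓ w ∸ 1) (supp (nf w)) → length L ≤ supp (nf w)
      by (L' , e , _ , _ , cov) = subst (length L ≤_) e (cover-length ds (All.map (λ {x} (p , l) → cov x (≤B-respʳ (nf≈ w) p ,
        subst (Len x) (cong (_∸ 1) (trans (sym l) (ℓ-cong (nf≈ w)))) (Len-ℓ x))) cs))

  module _ (w : Word) (h : KPalindromic 2 w) where

    private
      g : Graded (nf w)
      g = graded (ℓ w) (nf w) ≤-refl (nf-reduced w) (tight w h)
      A : List ℕ
      A = lens (proj₁ g)
      interval : Interval w (proj₁ g)
      interval = Interval-cong (nf≈ w) (proj₁ (proj₂ g))
      open Status (proj₂ (proj₂ g))

    symmetric⇒palindromic : Symmetric (ℓ w) A → Palindromic w
    symmetric⇒palindromic sy l len i le c C with refl ← Len⇒ℓ len = subst (Coeff w (ℓ w ∸ i))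
      (sym (trans (Count-unique C (coeff interval i)) (trans (sy i) (cnt-ᵒ A i bounded le)))) (coeff interval (ℓ w ∸ i))

    -- Index 3, the last one covered by 4-palindromicity, is where a defect shows.
    defective⇒¬4-palindromic : Defective (ℓ w) A → ¬ KPalindromic 4 w
    defective⇒¬4-palindromic D h₄ = <-irrefl (trans (Count-unique (h₄ (ℓ w) (Len-ℓ w) 3 ≤-refl 3≤l _ (coeff interval 3)) (coeff interval (ℓ w ∸ 3)))
        (sym (cnt-ᵒ A 3 bounded 3≤l))) excess
      where open Defective D

    palindromic : (Contains33c → ¬ KPalindromic 4 w → ⊥) → Palindromic w
    palindromic k = [ symmetric⇒palindromic , (λ (x , D) → ⊥-elim (k x (defective⇒¬4-palindromic D))) ]′ shape

theorem1p2 : (M : CoxeterMatrix) → let open Coxeter M in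
    ¬ Contains𝒯 →
    ((w : Word) → KPalindromic 4 w → Palindromic w)
    × (¬ Contains33c → (w : Word) → KPalindromic 2 w → Palindromic w)
theorem1p2 M no𝒯 =
  (λ w h → palindromic w (λ l len i i<2 → h l len i (≤-trans i<2 (s≤s (s≤s z≤n)))) (λ _ n → n h)) ,
  (λ no33c w h → palindromic w h (λ x _ → no33c x))
  where open Palindromes M no𝒯
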